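{- The bidirectional Dijkstra algorithm $\mathcal{B}$ described in the context is an instance-optimal algorithm, under query complexity, for the shortest $st$-path problem in both directed and undirected multigraphs with positive real edge weights. That is, (for directed multigraphs, and likewise for undirected multigraphs) $\mathcal{B}$ is correct, and there is an absolute constant $c$ such that for every input $(G,\ell,s,t)$ with $s\neq t$ and every (possibly randomized) correct algorithm $A'$ for the shortest $st$-path problem, the expected numbers of queries $T_{\mathcal{B}}(G,\ell,s,t)$ and $T_{A'}(G,\ell,s,t)$ made by $\mathcal{B}$ and $A'$ on this input satisfy $$T_{\mathcal{B}}(G,\ell,s,t)\le c\cdot T_{A'}(G,\ell,s,t).$$
   Context: Problem. The input is a (directed or undirected) multigraph $G$ (self-loops and parallel edges allowed) with vertices numbered $1,\dots,n$, weights $\ell:E(G)\to\mathbb{R}_{>0}$, and two vertices $s\ne t$. Let $d(u,v)$ be the shortest-path distance from $u$ to $v$ ($+\infty$ if unreachable). The task is to return an arbitrary shortest $st$-path, given by its specific edges (or to report that $t$ is unreachable from $s$). Query model. The graph is accessible only through unit-cost queries. Undirected case: Degree$(i)$ returns the degree of vertex $i$; Edge$(i,j)$, $1\le j\le\deg(i)$, returns the $j$-th edge incident to $i$, with its weight and its other end. Directed case: Indegree$(i)$, Outdegree$(i)$, and Inedge$(i,j)$, Outedge$(i,j)$, which return the $j$-th incoming, resp. outgoing, edge of $i$ with its weight and other end. Query complexity is the expected number of queries. An algorithm (possibly randomized) is correct if on every input it returns a correct output with probability at least $0.9$. Algorithm $\mathcal{B}$. Maintain $\mu$ (initially $+\infty$),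 $e_{\mathrm{mid}}$ (initially $\bot$), vertices $u_s$ (initially $s$) and $u_t$ (initially $t$), and values $\hat d(s,\cdot),\hat d(\cdot,t)$, initially $+\infty$ except $\hat d(s,s)=\hat d(t,t)=0$. Two executions are run, a forward one and a backward one, alternating between relaxing one edge in the forward execution and one edge in the backward execution, until the whole algorithm is terminated or one of the two executions has no open vertex left. Forward execution: open $s$. While an open vertex exists: let $u$ be the open vertex with smallest $\hat d(s,u)$; close $u$; set $u_s:=u$; if $\hat d(s,u_s)+\hat d(u_t,t)\ge\mu$, terminate the whole algorithm; otherwise, for each edge $uv$ leaving $u$ (incident to $u$ in the undirected case), relax it: (1) if $v$ is not closed in the forward execution, set $\hat d(s,v):=\min(\hat d(s,v),\hat d(s,u)+\ell(uv))$ and make $v$ open if it was unvisited; (2) if $\hat d(s,u)+\ell(uv)+\hat d(v,t)<\mu$, set $\mu:=\hat d(s,u)+\ell(uv)+\hat d(v,t)$ and $e_{\mathrm{mid}}:=uv$. Backward execution: the same with the roles of forward and backward exchanged: it starts from $t$, follows edges in reverse direction, and maintains $\hat d(\cdot,t)$, $u_t$ and its own open/closed statuses; relaxing an edge $vu$ while processing $u$ compares $\hat d(s,v)+\ell(vu)+\hat d(u,t)$ with $\mu$. Output: with $uv=e_{\mathrm{mid}}$, return the concatenation of the shortest $su$-path according to the forward execution, the edge $e_{\mathrm{mid}}$, and the shortest $vt$-path according to the backward execution; if $e_{\mathrm{mid}}=\bot$, report that $t$ is unreachable. The edges of a vertex are accessed using one degree query for the vertex (Outdegree in the forward and Indegree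 in the backward execution for directed graphs) and one edge query per edge relaxation. -}

module Defs where

open import Algebra.Structures using (IsCommutativeRing)
open import Data.Bool.Base using (Bool; not; if_then_else_)
open import Data.Fin.Base using (Fin; toℕ; fromℕ<)
open import Data.Fin.Properties using (any?)
open import Data.List.Base using (List; []; _∷_; _∷ʳ_; _++_; map; foldr)
open import Data.List.Relation.Unary.Unique.Propositional using (Unique)
open import Data.Maybe.Base using (Maybe; just; nothing; zipWith)
open import Data.Nat.Base as ℕ using (ℕ; zero; suc)
open import Data.Nat.Properties as ℕ using ()
open import Data.Product.Base using (Σ; ∃; _×_; _,_; proj₁; proj₂)
open import Data.Vec.Functional using (updateAt)
open import Function.Base using (_∘_; const)
open import Function.Bundles using (_↔_; Inverse)
open import Relation.Binary.PropositionalEquality.Core using (_≡_; _≢_; refl)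
open import Relation.Binary.Structures using (IsDecTotalOrder)
open import Relation.Nullary.Construct.Add.Supremum using (_⁺; ⊤⁺; [_])
open import Relation.Nullary.Decidable.Core using (Dec; yes; no; does)
open import Relation.Nullary.Negation.Core using (¬_)
import Relation.Binary.Construct.Add.Supremum.NonStrict as NonStrict⁺
import Relation.Binary.Construct.Add.Supremum.Strict as Strict⁺
import Relation.Binary.Construct.NonStrictToStrict as ToStrict

-- The real numbers, axiomatised as a Dedekind-complete ordered field.  The
-- mathematics is classical, so the order is decidable.

record Reals : Set₁ where
  infix  8 -_
  infixl 7 _*_
  infixl 6 _+_
  infix  4 _≤_
  field
    Carrier           : Set
    _+_ _*_           : Carrier → Carrier → Carrier
    -_                : Carrier → Carrier
    0# 1#             : Carrier
    _≤_               : Carrier → Carrier → Set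
    isCommutativeRing : IsCommutativeRing _≡_ _+_ _*_ -_ 0# 1#
    isDecTotalOrder   : IsDecTotalOrder _≡_ _≤_
    0≢1               : 0# ≢ 1#
    inverse           : ∀ x → x ≢ 0# → ∃ λ y → x * y ≡ 1#
    +-monoˡ-≤         : ∀ z {x y} → x ≤ y → x + z ≤ y + z
    *-nonneg          : ∀ {x y} → 0# ≤ x → 0# ≤ y → 0# ≤ x * y

  UpperBound : (Carrier → Set) → Carrier → Set
  UpperBound S u = ∀ x → S x → x ≤ u

  IsSup : (Carrier → Set) → Carrier → Set
  IsSup S u = UpperBound S u × (∀ v → UpperBound S v → u ≤ v)

  field
    complete : ∀ (S : Carrier → Set) → ∃ S → ∃ (UpperBound S) → ∃ (IsSup S)

  open IsCommutativeRing isCommutativeRing public using (_-_)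
  open IsDecTotalOrder isDecTotalOrder public using (_≟_; _≤?_)
  open ToStrict _≡_ _≤_ public using (_<_)

  _<?_ : ∀ x y → Dec (x < y)
  _<?_ = ToStrict.<-decidable _≡_ _≤_ _≟_ _≤?_

  fromℕ : ℕ → Carrier
  fromℕ zero    = 0#
  fromℕ (suc k) = 1# + fromℕ k

  open NonStrict⁺ _≤_ public using (_≤⁺_)
  open Strict⁺ _<_ public using (_<⁺_)

  _≤⁺?_ : ∀ x y → Dec (x ≤⁺ y)
  _≤⁺?_ = NonStrict⁺.≤⁺-dec _≤_ _≤?_

  _<⁺?_ : ∀ x y → Dec (x <⁺ y)
  _<⁺?_ = Strict⁺.<⁺-dec _<_ _<?_

  infixl 6 _+⁺_
  _+⁺_ : Carrier ⁺ → Carrier ⁺ → Carrier ⁺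
  _+⁺_ = zipWith _+_

data Kind : Set where
  directed undirected : Kind

data Form : Set where
  degreeForm edgeForm : Form

-- Edge positions are counted from 0.

data Query : Kind → ℕ → Form → Set where
  outdegree indegree : ∀ {n} → Fin n → Query directed n degreeForm
  outedge inedge     : ∀ {n} → Fin n → ℕ → Query directed n edgeForm
  degree             : ∀ {n} → Fin n → Query undirected n degreeForm
  edge               : ∀ {n} → Fin n → ℕ → Query undirected n edgeForm

-- nothing: t is unreachable; just es: the path with edges named es.

Output : Set
Output = Maybe (List ℕ)

module Model (ℝ : Reals) where
  open Reals ℝ

  -- The edges are the elements of Fin m.  The position of an edge among the
  -- outgoing (incoming) edges of its tail (head) is part of the input; the
  -- bijections below give both the endpoint and the position.

  record DirectedGraph (n : ℕ) : Set where
    field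
      m        : ℕ
      outdeg   : Fin n → ℕ
      indeg    : Fin n → ℕ
      out      : Fin m ↔ Σ (Fin n) (Fin ∘ outdeg)
      inn      : Fin m ↔ Σ (Fin n) (Fin ∘ indeg)
      weight   : Fin m → Carrier
      positive : ∀ e → 0# < weight e

    source target : Fin m → Fin n
    source = proj₁ ∘ Inverse.to out
    target = proj₁ ∘ Inverse.to inn

  -- Each edge e has two ends (e , true) and (e , false), so a self-loop
  -- occupies two positions at its vertex and contributes 2 to its degree.

  record UndirectedGraph (n : ℕ) : Set where
    field
      m        : ℕ
      deg      : Fin n → ℕ
      ends     : (Fin m × Bool) ↔ Σ (Fin n) (Fin ∘ deg)
      weight   : Fin m → Carrier
      positive : ∀ e → 0# < weight e

    endpoint : Fin m → Bool → Fin n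
    endpoint e b = proj₁ (Inverse.to ends (e , b))

  Graph : Kind → ℕ → Set
  Graph directed   = DirectedGraph
  Graph undirected = UndirectedGraph

  Edge : ∀ {κ n} → Graph κ n → Set
  Edge {directed}   G = Fin (DirectedGraph.m G)
  Edge {undirected} G = Fin (UndirectedGraph.m G)

  name : ∀ {κ n} (G : Graph κ n) → Edge G → ℕ
  name {directed}   G = toℕ
  name {undirected} G = toℕ

  weight : ∀ {κ n} (G : Graph κ n) → Edge G → Carrier
  weight {directed}   = DirectedGraph.weight
  weight {undirected} = UndirectedGraph.weight

  Joins : ∀ {κ n} (G : Graph κ n) → Fin n → Edge G → Fin n → Set
  Joins {directed}   G u e v = source e ≡ u × target e ≡ v
    where open DirectedGraph G
  Joins {undirected} G u e v = ∃ λ b → endpoint e b ≡ u × endpoint e (not b) ≡ v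
    where open UndirectedGraph G

  module _ {κ : Kind} {n : ℕ} (G : Graph κ n) where

    -- Walk u es vs v: a walk from u to v along the edges es, visiting vs.

    data Walk : Fin n → List (Edge G) → List (Fin n) → Fin n → Set where
      stop : ∀ {u} → Walk u [] (u ∷ []) u
      step : ∀ {u e v es vs w} → Joins G u e v → Walk v es vs w →
             Walk u (e ∷ es) (u ∷ vs) w

    Path : Fin n → List (Edge G) → Fin n → Set
    Path u es v = ∃ λ vs → Walk u es vs v × Unique vs

    pathLength : List (Edge G) → Carrier
    pathLength = foldr (λ e r → weight G e + r) 0#

    Shortest : Fin n → List (Edge G) → Fin n → Set
    Shortest u es v =
      Path u es v × (∀ es′ → Path u es′ v → pathLength es ≤ pathLength es′)

    Solves : Fin n → Fin n → Output → Set
    Solves s t nothing   = ∀ es → ¬ Path s es t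
    Solves s t (just ns) = ∃ λ es → ns ≡ map (name G) es × Shortest s es t

  -- An edge query returns the edge, its weight and its other end, or nothing
  -- if the position is out of range.

  EdgeAnswer : ℕ → Set
  EdgeAnswer n = Maybe (ℕ × Carrier × Fin n)

  Answer : ℕ → Form → Set
  Answer n degreeForm = ℕ
  Answer n edgeForm   = EdgeAnswer n

  atPosition : ∀ {n} (d : ℕ) → ℕ → (Fin d → ℕ × Carrier × Fin n) → EdgeAnswer n
  atPosition d j f with j ℕ.<? d
  ... | yes j<d = just (f (fromℕ< j<d))
  ... | no  _   = nothing

  answer : ∀ {κ n f} → Graph κ n → Query κ n f → Answer n f
  answer G (outdegree i) = DirectedGraph.outdeg G i
  answer G (indegree i)  = DirectedGraph.indeg G i
  answer G (outedge i j) = atPosition (outdeg i) j λ p →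
    let e = Inverse.from out (i , p) in toℕ e , weight G e , target e
    where open DirectedGraph G using (outdeg; out; target)
  answer G (inedge i j)  = atPosition (indeg i) j λ p →
    let e = Inverse.from inn (i , p) in toℕ e , weight G e , source e
    where open DirectedGraph G using (indeg; inn; source)
  answer G (degree i)    = UndirectedGraph.deg G i
  answer G (edge i j)    = atPosition (deg i) j λ p →
    let (e , b) = Inverse.from ends (i , p)
    in  toℕ e , weight G e , endpoint e (not b)
    where open UndirectedGraph G using (deg; ends; endpoint)

  -- A randomised algorithm, as a transition system.  In each step it returns,
  -- makes a query, or moves to the first state with probability p and to the
  -- second with probability 1 - p.  Since states may record the whole history
  -- and p is an arbitrary real, every distribution on the countably many next
  -- queries and outputs can be sampled by successive flips.

  data Action (κ : Kind) (n : ℕ) (S : Set) : Set where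
    return : Output → Action κ n S
    ask    : ∀ {f} → Query κ n f → (Answer n f → S) → Action κ n S
    flip   : ∀ p → 0# ≤ p → p ≤ 1# → S → S → Action κ n S

  record Machine (κ : Kind) (n : ℕ) : Set₁ where
    field
      State : Set
      start : State
      next  : State → Action κ n State

  -- An algorithm knows n, s and t without making queries.

  Algorithm : Kind → Set₁
  Algorithm κ = ∀ n → (s t : Fin n) → Machine κ n

  module _ {κ : Kind} {n : ℕ} (G : Graph κ n) (M : Machine κ n) where
    open Machine M

    mutual
      -- The expected number of queries made in the first k steps.

      queries : ℕ → State → Carrier
      queries zero    x = 0#
      queries (suc k) x = queriesFrom k (next x)

      queriesFrom : ℕ → Action κ n State → Carrier
      queriesFrom k (return _)       = 0#
      queriesFrom k (ask q f)        = 1# + queries k (f (answer G q))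
      queriesFrom k (flip p _ _ x y) = p * queries k x + (1# - p) * queries k y

    module _ (E : Output → Set) where
      mutual
        -- Returns k x r: started in x, the machine returns an output in E
        -- within k steps with probability r.  (A relation rather than a
        -- function because E need not come with a decision procedure.)

        data Returns : ℕ → State → Carrier → Set where
          timeout : ∀ {x} → Returns zero x 0#
          within  : ∀ {k x r} → ReturnsFrom k (next x) r → Returns (suc k) x r

        data ReturnsFrom (k : ℕ) : Action κ n State → Carrier → Set where
          hit  : ∀ {o} → E o → ReturnsFrom k (return o) 1#
          miss : ∀ {o} → ¬ E o → ReturnsFrom k (return o) 0#
          ask  : ∀ {f} {q : Query κ n f} {g r} →
                 Returns k (g (answer G q)) r → ReturnsFrom k (ask q g) r
          flip : ∀ {p 0≤p p≤1 x y r r′} → Returns k x r → Returns k y r′ →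
                 ReturnsFrom k (flip p 0≤p p≤1 x y) (p * r + (1# - p) * r′)

    Probability : (Output → Set) → Carrier → Set
    Probability E = IsSup (λ r → ∃ λ k → Returns E k start r)

    -- Has no solution if the expectation is infinite.

    ExpectedQueries : Carrier → Set
    ExpectedQueries = IsSup (λ r → ∃ λ k → r ≡ queries k start)

  Correct : ∀ {κ} → Algorithm κ → Set
  Correct {κ} A = ∀ n (G : Graph κ n) (s t : Fin n) → s ≢ t →
    ∃ λ P → Probability G (A n s t) (Solves G s t) P × fromℕ 9 ≤ fromℕ 10 * P

  data Direction : Set where
    forward backward : Direction

  opposite : Direction → Direction
  opposite forward  = backward
  opposite backward = forward

  data Status : Set where
    unvisited isOpen closed : Status

  isOpen? : ∀ x → Dec (x ≡ isOpen)
  isOpen? unvisited = no λ ()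
  isOpen? isOpen    = yes refl
  isOpen? closed    = no λ ()

  -- route v is the path realising the tentative distance dist v, as a list of
  -- edges in order from s to t; it replaces the usual parent pointers.  current
  -- is u_s, resp. u_t; the first `relaxed` of its `total` edges have been
  -- relaxed.

  record Execution (n : ℕ) : Set where
    field
      dist          : Fin n → Carrier ⁺
      route         : Fin n → List ℕ
      status        : Fin n → Status
      current       : Fin n
      relaxed total : ℕ

    Open : Fin n → Set
    Open v = status v ≡ isOpen

    Pending : Set
    Pending = relaxed ℕ.< total

  open Execution

  open? : ∀ {n} (x : Execution n) → Dec (∃ (Open x))
  open? x = any? (isOpen? ∘ status x)

  pending? : ∀ {n} (x : Execution n) → Dec (Pending x)
  pending? x = relaxed x ℕ.<? total x

  -- A choice of an open vertex of smallest tentative distance, ties being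
  -- broken arbitrarily.

  Selection : Set
  Selection = ∀ {n} (x : Execution n) → ∃ (Open x) →
    ∃ λ u → Open x u × (∀ v → Open x v → dist x u ≤⁺ dist x v)

  open-at : ∀ {n} → Fin n → Execution n
  open-at v = record
    { dist    = updateAt (const ⊤⁺) v (const [ 0# ])
    ; route   = const []
    ; status  = updateAt (const unvisited) v (const isOpen)
    ; current = v
    ; relaxed = 0
    ; total   = 0
    }

  degreeQuery : ∀ κ {n} → Direction → Fin n → Query κ n degreeForm
  degreeQuery directed   forward  = outdegree
  degreeQuery directed   backward = indegree
  degreeQuery undirected _        = degree

  edgeQuery : ∀ κ {n} → Direction → Fin n → ℕ → Query κ n edgeForm
  edgeQuery directed   forward  = outedge
  edgeQuery directed   backward = inedge
  edgeQuery undirected _        = edge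

  -- The execution `active` runs in direction `turn` and relaxes the next edge.
  -- mid is e_mid together with its ends, the one on the side of s first.

  record Configuration (n : ℕ) : Set where
    field
      turn           : Direction
      active passive : Execution n
      μ              : Carrier ⁺
      mid            : Maybe (Fin n × ℕ × Fin n)

  open Configuration

  initial : ∀ {n} → Fin n → Fin n → Configuration n
  initial s t = record
    { turn    = forward
    ; active  = open-at s
    ; passive = open-at t
    ; μ       = ⊤⁺
    ; mid     = nothing
    }

  result : ∀ {n} → Configuration n → Output
  result c with mid c | turn c
  ... | nothing          | _        = nothing
  ... | just (u , e , v) | forward  = just (route (active c) u ++ e ∷ route (passive c) v)
  ... | just (u , e , v) | backward = just (route (passive c) u ++ e ∷ route (active c) v)

  extend : Direction → List ℕ → ℕ → List ℕ
  extend forward  es e = es ∷ʳ e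
  extend backward es e = e ∷ es

  orient : ∀ {n} → Direction → Fin n → ℕ → Fin n → Fin n × ℕ × Fin n
  orient forward  u e v = u , e , v
  orient backward u e v = v , e , u

  improve : ∀ {n} → Direction → Execution n → ℕ → Fin n → Carrier ⁺ → Execution n
  improve δ x e v d with status x v
  ... | closed = x
  ... | _      = if does (d <⁺? dist x v)
    then record y { dist  = updateAt (dist x) v (const d)
                  ; route = updateAt (route x) v (const (extend δ (route x (current x)) e))
                  }
    else y
    where y = record x { status = updateAt (status x) v (const isOpen) }

  meet : ∀ {n} → Fin n × ℕ × Fin n → Carrier ⁺ → Configuration n → Configuration n
  meet uev d c = if does (d <⁺? μ c) then record c { μ = d ; mid = just uev } else c

  pass : ∀ {n} → Configuration n → Configuration n
  pass c = record c
    { turn    = opposite (turn c)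
    ; active  = passive c
    ; passive = record (active c) { relaxed = suc (relaxed (active c)) }
    }

  -- The case nothing does not arise, as the position is in range.

  relax : ∀ {n} → Configuration n → EdgeAnswer n → Configuration n
  relax c nothing            = pass c
  relax c (just (e , w , v)) = pass
    (meet (orient (turn c) u e v) (d +⁺ dist (passive c) v)
      (record c { active = improve (turn c) (active c) e v d }))
    where
    u = current (active c)
    d = dist (active c) u +⁺ [ w ]

  close : ∀ {n} → Configuration n → Fin n → Configuration n
  close c u = record c { active = record (active c)
    { status  = updateAt (status (active c)) u (const closed)
    ; current = u
    ; relaxed = 0
    ; total   = 0
    } }

  scan : ∀ {n} → Configuration n → ℕ → Configuration n
  scan c d = record c { active = record (active c) { total = d } }

  process : ∀ {κ n} → Configuration n → Fin n → Action κ n (Configuration n)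
  process {κ} c u =
    if does (μ c ≤⁺? (dist (active c) u +⁺ dist (passive c) (current (passive c))))
    then return (result c)
    else ask (degreeQuery κ (turn c) u) (scan (close c u))

  -- An execution has no open vertex left, and has come to its end, once its
  -- current vertex has no edge to relax and no vertex is open.

  advance : Selection → ∀ {κ n} → Configuration n → Action κ n (Configuration n)
  advance select {κ} c with pending? (passive c) | open? (passive c)
  ... | no _ | no _ = return (result c)
  ... | _    | _    with pending? (active c) | open? (active c)
  ...   | yes _ | _     =
          ask (edgeQuery κ (turn c) (current (active c)) (relaxed (active c))) (relax c)
  ...   | no _  | no _  = return (result c)
  ...   | no _  | yes o = process c (proj₁ (select (active c) o))

  bidirectionalDijkstra : Selection → ∀ {κ} → Algorithm κ
  bidirectionalDijkstra select n s t = record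
    { State = Configuration n
    ; start = initial s t
    ; next  = advance select
    }

module Submission where

-- Lower bound.  Let e leave a vertex u and let f enter a vertex v such that
-- the distance a from s to u and the distance b from v to t satisfy
-- a + b < d(s,t).  Replace e and f by a very short edge from u to v and a very
-- long edge between their other ends.  This can be done in two ways, the short
-- edge being named f or e, and it changes the answers to those queries only
-- that reveal e or f.  A shortest path of the first graph contains f but not e,
-- and one of the second contains e but not f.  So no output is correct for
-- both, and a correct algorithm reveals e or f with probability at least 0.8
-- on the original graph.  Hence it is likely to reveal almost all edges leaving
-- the vertices closed by the forward execution, or almost all edges entering
-- those closed by the backward execution, provided that any two such vertices
-- are less than d(s,t) apart in the above sense.
--
-- Upper bound.  The last condition, as well as correctness, follows from the
-- invariant μ ≤ d̂(s,v) + d̂(v,t) for all v: on a path of length at most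
-- d̂(s,u) + d̂(u_t,t), the first vertex not closed by the active execution has
-- been reached by the other one, so μ is at most the length of the path.

open import Defs
open import Algebra.Bundles using (CommutativeRing; CommutativeSemiring)
import Algebra.Properties.Ring as RingProperties
import Algebra.Solver.Ring.NaturalCoefficients.Default as Solver
open import Algebra.Structures using (IsCommutativeRing)
open import Data.Bool.Base using (Bool; false; not; true)
open import Data.Bool.Properties as Bool using (not-involutive)
open import Data.Fin.Base using (Fin; fromℕ<; suc; toℕ; zero)
open import Data.Fin.Properties as Fin using (2↔Bool; fromℕ<-toℕ; toℕ-fromℕ<; toℕ-injective; toℕ<n)
open import Data.List.Base using (List; []; _∷_; _∷ʳ_; _++_; filter; length; map)
import Data.List.Membership.DecPropositional as DecMembership
open import Data.List.Membership.Propositional using (_∈_; _∉_; find)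
open import Data.List.Membership.Propositional.Properties using (∈-++⁻; ∈-filter⁻; ∈-map⁻)
open import Data.List.Properties using (filter-accept; filter-reject; length-map)
open import Data.List.Relation.Unary.All as All using (All; []; _∷_; all?)
open import Data.List.Relation.Unary.All.Properties using (¬All⇒Any¬; ¬Any⇒All¬)
open import Data.List.Relation.Unary.AllPairs using ([]; _∷_)
open import Data.List.Relation.Unary.Any using (here; there)
open import Data.List.Relation.Unary.Unique.Propositional using (Unique)
import Data.List.Relation.Unary.Unique.Propositional.Properties as Unique
open import Data.Maybe.Base as Maybe using (Maybe; just; nothing)
open import Data.Maybe.Properties using (just-injective)
open import Data.Nat.Base as ℕ using (ℕ; s≤s; suc; z≤n; zero)
open import Data.Nat.ListAction using (sum)
import Data.Nat.Properties as ℕ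
import Data.Nat.Solver
open import Data.Product.Base using (Σ; ∃; _×_; _,_; proj₁; proj₂)
open import Data.Product.Properties using (≡-dec)
open import Data.Sum.Base as Sum using (_⊎_; inj₁; inj₂)
open import Data.Vec.Functional using (updateAt)
open import Data.Vec.Functional.Properties using (updateAt-minimal; updateAt-updates)
open import Function.Base using (_∘_; case_of_; const)
open import Function.Bundles using (_↔_; Inverse; mk↔ₛ′)
open import Function.Properties.Inverse using (↔-refl; ↔-trans)
open import Level using (0ℓ)
open import Relation.Binary.Bundles using (Poset)
import Relation.Binary.Construct.Add.Supremum.NonStrict as NonStrict⁺
import Relation.Binary.Construct.Add.Supremum.Strict as Strict⁺
import Relation.Binary.Construct.NonStrictToStrict as ToStrict
open import Relation.Binary.Definitions using (DecidableEquality)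
open import Relation.Binary.PropositionalEquality.Core using (_≡_; _≢_; refl; sym; trans; cong; cong₂; subst; subst₂)
open import Relation.Binary.Structures using (IsDecTotalOrder)
open import Relation.Nullary.Construct.Add.Supremum using (_⁺; ⊤⁺; [_])
open import Relation.Nullary.Decidable.Core using (Dec; does; no; yes)
open import Relation.Nullary.Negation.Core using (¬_; contradiction)

open DecMembership ℕ._≟_ using () renaming (_∈?_ to _∈ℕ?_)
open NonStrict⁺ using ([_]; _≤⊤⁺)
open Strict⁺ using ([_]; [_]<⊤⁺)

-- The lower bound yields only `m e + m f` ≥ 0.8 for the expected numbers of queries that reveal `e`
-- and `f`, and neither edge need be likely on its own. But either all edges found from s have `m e`
-- ≥ 0.4, or one of them falls short and then every edge found from t, other than that one, has at
-- least 0.4. So just one of the two explored sets is charged, and nothing tells which. This is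
-- where the alternation enters: the executions relax equally many edges up to one, so either set
-- bounds the whole run. An execution makes at most one degree query more than relaxations, since
-- each closes an open vertex and a relaxation opens at most one. An undirected edge may be explored
-- from both ends, so the sum of `m` over a set is at most twice the number of queries. Additive
-- constants are absorbed because a correct algorithm needs at least 0.8 expected queries on every
-- input. Expectations are suprema of finite-step values, and probabilities are compared by
-- following a common run step by step. Inequalities are multiplied by 10 to keep to natural
-- numerals.

-- Arithmetic and order in an ordered field.

module OrderedField (ℝ : Reals) where
  open Reals ℝ
  open IsCommutativeRing isCommutativeRing public
    using (+-comm; +-assoc; +-identityˡ; +-identityʳ; -‿inverseˡ; -‿inverseʳ; *-identityˡ; *-identityʳ; distribˡ;
        distribʳ; zeroˡ; zeroʳ)
  open IsDecTotalOrder isDecTotalOrder public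
    using ()
    renaming (refl to ≤-refl; trans to ≤-trans; antisym to ≤-antisym; total to ≤-total; reflexive to ≤-reflexive)

  semiring : CommutativeSemiring 0ℓ 0ℓ
  semiring = record { isCommutativeSemiring = IsCommutativeRing.isCommutativeSemiring isCommutativeRing }

  open Solver semiring public using (solve; Polynomial; _:=_; _:+_; _:*_; con)

  numeral : ∀ {n} → ℕ → Polynomial n
  numeral zero    = con 0
  numeral (suc k) = con 1 :+ numeral k

  ≤-poset : Poset 0ℓ 0ℓ 0ℓ
  ≤-poset = record { isPartialOrder = IsDecTotalOrder.isPartialOrder isDecTotalOrder }

  open import Relation.Binary.Reasoning.PartialOrder ≤-poset public
    using (begin_; _∎; step-≤; step-≡-⟩; step-≡-⟨)

  <⇒≤ : ∀ {x y} → x < y → x ≤ y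
  <⇒≤ = proj₁

  ≰⇒> : ∀ {x y} → ¬ x ≤ y → y < x
  ≰⇒> = ToStrict.≰⇒> _≡_ _≤_ sym ≤-reflexive ≤-total

  <⇒≱ : ∀ {x y} → x < y → ¬ y ≤ x
  <⇒≱ = ToStrict.<⇒≱ _≡_ _≤_ ≤-antisym

  <-irrefl : ∀ {x} → ¬ x < x
  <-irrefl x<x = proj₂ x<x refl

  <-≤-trans : ∀ {x y z} → x < y → y ≤ z → x < z
  <-≤-trans = ToStrict.<-≤-trans _≡_ _≤_ sym ≤-trans ≤-antisym λ { {_} refl p → p }

  ≤-<-trans : ∀ {x y z} → x ≤ y → y < z → x < z
  ≤-<-trans = ToStrict.≤-<-trans _≡_ _≤_ ≤-trans ≤-antisym λ { {_} refl p → p }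

  +-mono-≤ : ∀ {x y u v} → x ≤ y → u ≤ v → x + u ≤ y + v
  +-mono-≤ {x} {y} {u} {v} x≤y u≤v = ≤-trans (+-monoˡ-≤ u x≤y)
    (subst₂ _≤_ (+-comm u y) (+-comm v y) (+-monoˡ-≤ y u≤v))

  +-monoʳ-≤ : ∀ x {u v} → u ≤ v → x + u ≤ x + v
  +-monoʳ-≤ x = +-mono-≤ ≤-refl

  +-cancelʳ-≤ : ∀ z {x y} → x + z ≤ y + z → x ≤ y
  +-cancelʳ-≤ z {x} {y} p = subst₂ _≤_ (undo x) (undo y) (+-monoˡ-≤ (- z) p)
    where
    undo : ∀ w → (w + z) + - z ≡ w
    undo w = trans (+-assoc w z (- z)) (trans (cong (w +_) (-‿inverseʳ z)) (+-identityʳ w))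

  +-cancelˡ-≤ : ∀ z {x y} → z + x ≤ z + y → x ≤ y
  +-cancelˡ-≤ z {x} {y} p = +-cancelʳ-≤ z (subst₂ _≤_ (+-comm z x) (+-comm z y) p)

  +-monoˡ-< : ∀ z {x y} → x < y → x + z < y + z
  +-monoˡ-< z x<y = ≰⇒> λ p → <⇒≱ x<y (+-cancelʳ-≤ z p)

  +-monoʳ-< : ∀ z {x y} → x < y → z + x < z + y
  +-monoʳ-< z x<y = ≰⇒> λ p → <⇒≱ x<y (+-cancelˡ-≤ z p)

  +-nonneg : ∀ {x y} → 0# ≤ x → 0# ≤ y → 0# ≤ x + y
  +-nonneg {x} {y} 0≤x 0≤y = subst (_≤ x + y) (+-identityˡ 0#) (+-mono-≤ 0≤x 0≤y)

  x≤x+y : ∀ x {y} → 0# ≤ y → x ≤ x + y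
  x≤x+y x {y} 0≤y = subst (_≤ x + y) (+-identityʳ x) (+-monoʳ-≤ x 0≤y)

  x≤y+x : ∀ x {y} → 0# ≤ y → x ≤ y + x
  x≤y+x x {y} 0≤y = subst (_≤ y + x) (+-identityˡ x) (+-monoˡ-≤ x 0≤y)

  x<y+x : ∀ x {y} → 0# < y → x < y + x
  x<y+x x {y} 0<y = subst (_< y + x) (+-identityˡ x) (+-monoˡ-< x 0<y)

  *-monoˡ-≤ : ∀ {z x y} → 0# ≤ z → x ≤ y → z * x ≤ z * y
  *-monoˡ-≤ {z} {x} {y} 0≤z x≤y = subst₂ _≤_ (+-identityˡ (z * x)) lemma
    (+-monoˡ-≤ (z * x) (*-nonneg 0≤z 0≤y-x))
    where
    0≤y-x : 0# ≤ y - x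
    0≤y-x = subst (_≤ y - x) (-‿inverseʳ x) (+-monoˡ-≤ (- x) x≤y)
    lemma : z * (y - x) + z * x ≡ z * y
    lemma = trans (sym (distribˡ z (y - x) x)) (cong (z *_)
      (trans (+-assoc y (- x) x) (trans (cong (y +_) (-‿inverseˡ x)) (+-identityʳ y))))

  0≤1 : 0# ≤ 1#
  0≤1 with ≤-total 0# 1#
  ... | inj₁ 0≤1 = 0≤1
  ... | inj₂ 1≤0 = subst (0# ≤_) square (*-nonneg 0≤-1 0≤-1)
    where
    commutativeRing : CommutativeRing 0ℓ 0ℓ
    commutativeRing = record { isCommutativeRing = isCommutativeRing }
    open RingProperties (CommutativeRing.ring commutativeRing) using (-1*x≈-x; -‿involutive)
    0≤-1 : 0# ≤ - 1#
    0≤-1 = subst₂ _≤_ (-‿inverseʳ 1#) (+-identityˡ (- 1#)) (+-monoˡ-≤ (- 1#) 1≤0)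
    square : - 1# * - 1# ≡ 1#
    square = trans (-1*x≈-x (- 1#)) (-‿involutive 1#)

  0<1 : 0# < 1#
  0<1 = 0≤1 , 0≢1

  fromℕ-nonneg : ∀ k → 0# ≤ fromℕ k
  fromℕ-nonneg zero    = ≤-refl
  fromℕ-nonneg (suc k) = +-nonneg 0≤1 (fromℕ-nonneg k)

  fromℕ-mono : ∀ {j k} → j ℕ.≤ k → fromℕ j ≤ fromℕ k
  fromℕ-mono {k = k} z≤n = fromℕ-nonneg k
  fromℕ-mono (s≤s j≤k)   = +-monoʳ-≤ 1# (fromℕ-mono j≤k)

  fromℕ-+ : ∀ j k → fromℕ (j ℕ.+ k) ≡ fromℕ j + fromℕ k
  fromℕ-+ zero    k = sym (+-identityˡ _)
  fromℕ-+ (suc j) k = trans (cong (1# +_) (fromℕ-+ j k)) (sym (+-assoc 1# _ _))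

  fromℕ-* : ∀ j k → fromℕ (j ℕ.* k) ≡ fromℕ j * fromℕ k
  fromℕ-* zero    k = sym (zeroˡ _)
  fromℕ-* (suc j) k = trans (fromℕ-+ k (j ℕ.* k)) (trans (cong₂ _+_ (sym (*-identityˡ _)) (fromℕ-* j k))
    (sym (distribʳ _ _ _)))

  half : ∀ x → ∃ λ h → h + h ≡ x
  half x = x * ½ , trans (sym (distribˡ x ½ ½)) (trans (cong (x *_) ½+½≡1) (*-identityʳ x))
    where
    2≢0 : 1# + 1# ≢ 0#
    2≢0 2≡0 = <⇒≱ 0<1 (subst (1# ≤_) 2≡0 (x≤x+y 1# 0≤1))
    ½ : Carrier
    ½ = proj₁ (inverse (1# + 1#) 2≢0)
    ½+½≡1 : ½ + ½ ≡ 1#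
    ½+½≡1 = trans (solve 1 (λ h → h :+ h := (con 1 :+ con 1) :* h) refl ½) (proj₂ (inverse (1# + 1#) 2≢0))

  -- Half of the difference leaves the inequality strict; this provides the length of the short
  -- edge.
  room : ∀ {x y} → x < y → ∃ λ ε → 0# < ε × x + ε < y
  room {x} {y} x<y = h , 0<h , subst (x + h <_) x+h+h≡y
    (subst (x + h <_) (+-assoc x h h) (subst (_< (x + h) + h) (+-identityʳ (x + h)) (+-monoʳ-< (x + h) 0<h)))
    where
    h : Carrier
    h = proj₁ (half (y - x))
    x+h+h≡y : x + (h + h) ≡ y
    x+h+h≡y = trans (cong (x +_) (proj₂ (half (y - x)))) (trans (+-comm x (y - x))
      (trans (+-assoc y (- x) x) (trans (cong (y +_) (-‿inverseˡ x)) (+-identityʳ y))))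
    0<h : 0# < h
    0<h = ≰⇒> λ h≤0 → <⇒≱ x<y (subst₂ _≤_ x+h+h≡y (trans (cong (x +_) (+-identityˡ 0#)) (+-identityʳ x))
      (+-monoʳ-≤ x (+-mono-≤ h≤0 h≤0)))

  ∑ : List Carrier → Carrier
  ∑ []       = 0#
  ∑ (x ∷ xs) = x + ∑ xs

-- Suprema of increasing sequences and of their sums.

module Suprema (ℝ : Reals) where
  open Reals ℝ
  open OrderedField ℝ

  Limit : (ℕ → Carrier) → Carrier → Set
  Limit a = IsSup (λ r → ∃ λ k → r ≡ a k)

  Increasing : (ℕ → Carrier) → Set
  Increasing a = ∀ {j k} → j ℕ.≤ k → a j ≤ a k

  increasing : ∀ {a : ℕ → Carrier} → (∀ k → a k ≤ a (suc k)) → Increasing a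
  increasing {a} step j≤k = go (ℕ.≤⇒≤′ j≤k)
    where
    go : ∀ {j k} → j ℕ.≤′ k → a j ≤ a k
    go (ℕ.≤′-reflexive refl) = ≤-refl
    go (ℕ.≤′-step j≤k)       = ≤-trans (go j≤k) (step _)

  private
    x+y-y : ∀ x y → (x + y) - y ≡ x
    x+y-y x y = trans (+-assoc x y (- y)) (trans (cong (x +_) (-‿inverseʳ y)) (+-identityʳ x))

    x-y+y : ∀ x y → (x - y) + y ≡ x
    x-y+y x y = trans (+-assoc x (- y) y) (trans (cong (x +_) (-‿inverseˡ y)) (+-identityʳ x))

  -- Subtracting `y` turns the hypothesis into an upper bound `v - y` of `S`. Two applications treat
  -- a sum of two suprema taken over independent indices.
  sup-+-≤ : ∀ {S : Carrier → Set} {u v} y → IsSup S u → (∀ r → S r → r + y ≤ v) → u + y ≤ v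
  sup-+-≤ {v = v} y (_ , least) bound = subst (_ ≤_) (x-y+y v y) (+-monoˡ-≤ y (least (v - y) λ r Sr →
    subst (_≤ v - y) (x+y-y r y) (+-monoˡ-≤ (- y) (bound r Sr))))

  -- The sums pair values at equal indices only; monotonicity brings `a j` and `b k` to the common
  -- index `j ⊔ k`.
  limit-+ : ∀ {a b M N} → Increasing a → Increasing b → Limit a M → Limit b N → Limit (λ k → a k + b k) (M + N)
  limit-+ {a} {b} {M} {N} a↑ b↑ supA supB = upper , least
    where
    upper : UpperBound _ (M + N)
    upper _ (k , refl) = +-mono-≤ (proj₁ supA _ (k , refl)) (proj₁ supB _ (k , refl))
    least : ∀ v → UpperBound _ v → M + N ≤ v
    least v bound = sup-+-≤ N supA λ { _ (j , refl) → subst (_≤ v) (+-comm N (a j))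
        (sup-+-≤ (a j) supB λ { _ (k , refl) →
      subst (_≤ v) (+-comm (a j) (b k))
        (≤-trans (+-mono-≤ (a↑ (ℕ.m≤m⊔n j k)) (b↑ (ℕ.m≤n⊔m j k))) (bound _ (j ℕ.⊔ k , refl))) }) }

  -- Linearity of expectation in the form used later: a bound on the finite-step sums, uniform in
  -- the number of steps, passes to the sum of the limits.
  ∑-limits : ∀ {A : Set} {a : A → ℕ → Carrier} {M : A → Carrier} →
             (∀ x → Increasing (a x)) → (∀ x → Limit (a x) (M x)) →
             ∀ xs {B} → (∀ k → ∑ (map (λ x → a x k) xs) ≤ B) → ∑ (map M xs) ≤ B
  ∑-limits {A} {a} {M} a↑ supA xs {B} bound = subst (_≤ B) (+-identityˡ _)
    (go xs (λ _ → ≤-refl) ((λ { _ (_ , refl) → ≤-refl }) , λ v bound → bound 0# (0 , refl))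
      λ k → subst (_≤ B) (sym (+-identityˡ _)) (bound k))
    where
    -- `b` is the sum of the sequences already treated, initially constantly zero.
    go : ∀ xs {b β} → Increasing b → Limit b β → (∀ k → b k + ∑ (map (λ x → a x k) xs) ≤ B) → β + ∑ (map M xs) ≤ B
    go []       b↑ supB bound = sup-+-≤ 0# supB λ { _ (k , refl) → bound k }
    go (x ∷ xs) {b} {β} b↑ supB bound = subst (_≤ B) (+-assoc β (M x) _)
      (go xs (λ j≤k → +-mono-≤ (b↑ j≤k) (a↑ x j≤k)) (limit-+ b↑ (a↑ x) supB (supA x))
        λ k → subst (_≤ B) (sym (+-assoc (b k) (a x k) _)) (bound k))

-- Expected charges of a machine, and the charge for telling two graphs apart.

module Expectation (ℝ : Reals) where
  open Reals ℝ
  open Model ℝ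
  open OrderedField ℝ
  open Suprema ℝ

  -- A charge for each query. Charging 1 for everything counts the queries, and charging 1 for
  -- revealing a given edge counts its revelations; both expectations are values of `cost`.
  Price : Kind → ℕ → Set
  Price κ n = ∀ {f} → Query κ n f → Carrier

  private
    0≤1-p : ∀ {p} → p ≤ 1# → 0# ≤ 1# - p
    0≤1-p {p} p≤1 = subst (_≤ 1# - p) (-‿inverseʳ p) (+-monoˡ-≤ (- p) p≤1)

    p+[1-p] : ∀ p → p + (1# - p) ≡ 1#
    p+[1-p] p = trans (+-comm p _) (trans (+-assoc 1# (- p) p) (trans (cong (1# +_) (-‿inverseˡ p)) (+-identityʳ 1#)))

  mix : Carrier → Carrier → Carrier → Carrier
  mix p x y = p * x + (1# - p) * y

  mix-mono-≤ : ∀ {p x y x′ y′} → 0# ≤ p → p ≤ 1# → x ≤ x′ → y ≤ y′ → mix p x y ≤ mix p x′ y′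
  mix-mono-≤ 0≤p p≤1 x≤x′ y≤y′ = +-mono-≤ (*-monoˡ-≤ 0≤p x≤x′) (*-monoˡ-≤ (0≤1-p p≤1) y≤y′)

  mix-idem : ∀ p x → mix p x x ≡ x
  mix-idem p x = trans (sym (distribʳ x p (1# - p))) (trans (cong (_* x) (p+[1-p] p)) (*-identityˡ x))

  mix-+ : ∀ p x y x′ y′ → mix p (x + x′) (y + y′) ≡ mix p x y + mix p x′ y′
  mix-+ p = solve 6 (λ p q x y x′ y′ → p :* (x :+ x′) :+ q :* (y :+ y′)
      := (p :* x :+ q :* y) :+ (p :* x′ :+ q :* y′)) refl p (1# - p)

  mix-* : ∀ p z x y → mix p (z * x) (z * y) ≡ z * mix p x y
  mix-* p = solve 5 (λ p q z x y → p :* (z :* x) :+ q :* (z :* y) := z :* (p :* x :+ q :* y)) refl p (1# - p)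

  module _ {κ n} (G : Graph κ n) (M : Machine κ n) where
    open Machine M

    module _ (c : Price κ n) where
      mutual
        cost : ℕ → State → Carrier
        cost zero    x = 0#
        cost (suc k) x = costFrom k (next x)

        costFrom : ℕ → Action κ n State → Carrier
        costFrom k (return _)       = 0#
        costFrom k (ask q f)        = c q + cost k (f (answer G q))
        costFrom k (flip p _ _ x y) = mix p (cost k x) (cost k y)

    module _ {c d : Price κ n} (c≤d : ∀ {f} (q : Query κ n f) → c q ≤ d q) where
      mutual
        cost-mono-≤ : ∀ k x → cost c k x ≤ cost d k x
        cost-mono-≤ zero    x = ≤-refl
        cost-mono-≤ (suc k) x = costFrom-mono-≤ k (next x)

        costFrom-mono-≤ : ∀ k a → costFrom c k a ≤ costFrom d k a
        costFrom-mono-≤ k (return _)           = ≤-refl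
        costFrom-mono-≤ k (ask q f)            = +-mono-≤ (c≤d q) (cost-mono-≤ k _)
        costFrom-mono-≤ k (flip p 0≤p p≤1 x y) = mix-mono-≤ 0≤p p≤1 (cost-mono-≤ k x) (cost-mono-≤ k y)

    module _ (c d : Price κ n) where
      mutual
        cost-+ : ∀ k x → cost (λ q → c q + d q) k x ≡ cost c k x + cost d k x
        cost-+ zero    x = sym (+-identityˡ 0#)
        cost-+ (suc k) x = costFrom-+ k (next x)

        costFrom-+ : ∀ k a → costFrom (λ q → c q + d q) k a ≡ costFrom c k a + costFrom d k a
        costFrom-+ k (return _) = sym (+-identityˡ 0#)
        costFrom-+ k (ask q f)  = trans (cong ((c q + d q) +_) (cost-+ k _))
          (solve 4 (λ a b x y → (a :+ b) :+ (x :+ y) := (a :+ x) :+ (b :+ y)) refl (c q) (d q) _ _)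
        costFrom-+ k (flip p _ _ x y) = trans (cong₂ (mix p) (cost-+ k x) (cost-+ k y)) (mix-+ p _ _ _ _)

    module _ (z : Carrier) where
      mutual
        cost-const : ∀ k x → cost (λ _ → z) k x ≡ z * queries G M k x
        cost-const zero    x = sym (zeroʳ z)
        cost-const (suc k) x = costFrom-const k (next x)

        costFrom-const : ∀ k a → costFrom (λ _ → z) k a ≡ z * queriesFrom G M k a
        costFrom-const k (return _) = sym (zeroʳ z)
        costFrom-const k (ask q f)  = trans (cong₂ _+_ (sym (*-identityʳ z)) (cost-const k _)) (sym (distribˡ z 1# _))
        costFrom-const k (flip p _ _ x y) = trans (cong₂ (mix p) (cost-const k x) (cost-const k y)) (mix-* p z _ _)

    ∑-cost : ∀ {A : Set} (c : A → Price κ n) es k x →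
             ∑ (map (λ e → cost (c e) k x) es) ≡ cost (λ q → ∑ (map (λ e → c e q) es)) k x
    ∑-cost c []       k x = sym (trans (cost-const 0# k x) (zeroˡ _))
    ∑-cost c (e ∷ es) k x = trans (cong (cost (c e) k x +_) (∑-cost c es k x))
      (sym (cost-+ (c e) (λ q → ∑ (map (λ e → c e q) es)) k x))

    module _ {c : Price κ n} (0≤c : ∀ {f} (q : Query κ n f) → 0# ≤ c q) where

      cost-nonneg : ∀ k x → 0# ≤ cost c k x
      cost-nonneg k x = subst (_≤ cost c k x) (trans (cost-const 0# k x) (zeroˡ _)) (cost-mono-≤ 0≤c k x)

      mutual
        cost-step : ∀ k x → cost c k x ≤ cost c (suc k) x
        cost-step zero    x = cost-nonneg 1 x
        cost-step (suc k) x = costFrom-step k (next x)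

        costFrom-step : ∀ k a → costFrom c k a ≤ costFrom c (suc k) a
        costFrom-step k (return _)           = ≤-refl
        costFrom-step k (ask q f)            = +-monoʳ-≤ _ (cost-step k _)
        costFrom-step k (flip p 0≤p p≤1 x y) = mix-mono-≤ 0≤p p≤1 (cost-step k x) (cost-step k y)

      cost-increasing : ∀ x → Increasing (λ k → cost c k x)
      cost-increasing x = increasing (λ k → cost-step k x)

    module _ {E : Output → Set} where
      mutual
        returns-≤1 : ∀ {k x r} → Returns G M E k x r → r ≤ 1#
        returns-≤1 timeout    = 0≤1
        returns-≤1 (within ρ) = returnsFrom-≤1 ρ

        returnsFrom-≤1 : ∀ {k a r} → ReturnsFrom G M E k a r → r ≤ 1#
        returnsFrom-≤1 (hit _)  = ≤-refl
        returnsFrom-≤1 (miss _) = 0≤1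
        returnsFrom-≤1 (ask ρ)  = returns-≤1 ρ
        returnsFrom-≤1 (flip {p} {0≤p} {p≤1} {r = r} {r′} ρ ρ′) =
          subst (mix p r r′ ≤_) (mix-idem p 1#) (mix-mono-≤ 0≤p p≤1 (returns-≤1 ρ) (returns-≤1 ρ′))

  -- A run that never pays cannot tell the two graphs from G, and the two
  -- events are disjoint; c is at least the probability of paying.
  module Distinguishing {κ n} (G G₁ G₂ : Graph κ n) (M : Machine κ n) {E₁ E₂ : Output → Set}
    (disjoint : ∀ o → E₁ o → ¬ E₂ o)
    (c : ∀ {f} → Query κ n f → Reals.Carrier ℝ)
    (0≤c : ∀ {f} (q : Query κ n f) → Reals._≤_ ℝ (Reals.0# ℝ) (c q))
    (paid : ∀ {f} (q : Query κ n f) →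
      (answer G₁ q ≡ answer G q × answer G₂ q ≡ answer G q) ⊎ Reals._≤_ ℝ (Reals.1# ℝ) (c q))
    where
    open Machine M

    private
      0≤cost : ∀ k x → 0# ≤ cost G M c k x
      0≤cost = cost-nonneg G M 0≤c

    mutual
      -- The three runs share states and coins as long as all answers agree, and then end with one
      -- common output, which lies in at most one event. After a query with charge at least 1 the
      -- trivial bound 2 suffices. The time limits `j` and `k` differ because the two probabilities
      -- are separate suprema; `l` dominates both.
      returns-≤1+cost : ∀ {j k l x r₁ r₂} → j ℕ.≤ l → k ℕ.≤ l →
        Returns G₁ M E₁ j x r₁ → Returns G₂ M E₂ k x r₂ → r₁ + r₂ ≤ 1# + cost G M c l x
      returns-≤1+cost {l = l} {x} _ _ timeout ρ₂ =
        subst (_≤ 1# + cost G M c l x) (+-comm _ 0#) (+-mono-≤ (returns-≤1 G₂ M ρ₂) (0≤cost l x))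
      returns-≤1+cost {l = l} {x} _ _ (within ρ₁) timeout =
        +-mono-≤ (returns-≤1 G₁ M (within ρ₁)) (0≤cost l x)
      returns-≤1+cost (s≤s j≤l) (s≤s k≤l) (within ρ₁) (within ρ₂) = returnsFrom-≤1+cost j≤l k≤l ρ₁ ρ₂

      returnsFrom-≤1+cost : ∀ {j k l a r₁ r₂} → j ℕ.≤ l → k ℕ.≤ l →
        ReturnsFrom G₁ M E₁ j a r₁ → ReturnsFrom G₂ M E₂ k a r₂ → r₁ + r₂ ≤ 1# + costFrom G M c l a
      returnsFrom-≤1+cost _ _ (hit e₁)  (hit e₂) = contradiction e₂ (disjoint _ e₁)
      returnsFrom-≤1+cost _ _ (hit _)   (miss _) = ≤-refl
      returnsFrom-≤1+cost _ _ (miss _)  (hit _)  = ≤-reflexive (+-comm 0# 1#)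
      returnsFrom-≤1+cost _ _ (miss _)  (miss _) = +-monoˡ-≤ 0# 0≤1
      returnsFrom-≤1+cost {l = l} j≤l k≤l (ask {q = q} {g = g} ρ₁) (ask ρ₂) with paid q
      ... | inj₂ 1≤c = +-mono-≤ (returns-≤1 G₁ M ρ₁)
                         (≤-trans (returns-≤1 G₂ M ρ₂) (≤-trans 1≤c (x≤x+y (c q) (0≤cost l _))))
      ... | inj₁ (same₁ , same₂) rewrite same₁ | same₂ =
        ≤-trans (returns-≤1+cost j≤l k≤l ρ₁ ρ₂) (+-monoʳ-≤ 1# (x≤y+x _ (0≤c q)))
      returnsFrom-≤1+cost {l = l} j≤l k≤l (flip {p} {0≤p} {p≤1} {x} {y} {r} {r′} ρ₁ ρ₁′)
          (flip {r = s} {s′} ρ₂ ρ₂′) = begin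
        mix p r r′ + mix p s s′                                     ≡⟨ mix-+ p r r′ s s′ ⟨
        mix p (r + s) (r′ + s′)                                     ≤⟨ mix-mono-≤ 0≤p p≤1 (returns-≤1+cost j≤l k≤l ρ₁ ρ₂) (returns-≤1+cost j≤l k≤l ρ₁′ ρ₂′) ⟩
        mix p (1# + cost G M c l x) (1# + cost G M c l y)           ≡⟨ mix-+ p 1# 1# _ _ ⟩
        mix p 1# 1# + mix p (cost G M c l x) (cost G M c l y)       ≡⟨ cong (_+ mix p (cost G M c l x) (cost G M c l y)) (mix-idem p 1#) ⟩
        1# + mix p (cost G M c l x) (cost G M c l y)                ∎

    probability-≤1+cost : ∀ {P₁ P₂ B} → Probability G₁ M E₁ P₁ → Probability G₂ M E₂ P₂ →
                          (∀ k → cost G M c k start ≤ B) → P₁ + P₂ ≤ 1# + B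
    probability-≤1+cost {P₁} {P₂} {B} sup₁ sup₂ cost≤B =
      sup-+-≤ P₂ sup₁ λ { r₁ (j , ρ₁) → subst (_≤ 1# + B) (+-comm P₂ r₁)
        (sup-+-≤ r₁ sup₂ λ { r₂ (k , ρ₂) → subst (_≤ 1# + B) (+-comm r₁ r₂)
          (≤-trans (returns-≤1+cost (ℕ.m≤m⊔n j k) (ℕ.m≤n⊔m j k) ρ₁ ρ₂) (+-monoʳ-≤ 1# (cost≤B (j ℕ.⊔ k)))) }) }

-- The permutation that exchanges two elements.

module Transposition {A : Set} (_≟_ : DecidableEquality A) (x y : A) where

  private
    exchange : A → A
    exchange z with z ≟ x | z ≟ y
    ... | yes _ | _     = y
    ... | no _  | yes _ = x
    ... | no _  | no _  = z

  exchange-x : exchange x ≡ y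
  exchange-x with x ≟ x | x ≟ y
  ... | yes _  | _ = refl
  ... | no x≢x | _ = contradiction refl x≢x

  exchange-y : exchange y ≡ x
  exchange-y with y ≟ x | y ≟ y
  ... | yes y≡x | _      = y≡x
  ... | no _    | yes _  = refl
  ... | no _    | no y≢y = contradiction refl y≢y

  exchange-other : ∀ {z} → z ≢ x → z ≢ y → exchange z ≡ z
  exchange-other {z} z≢x z≢y with z ≟ x | z ≟ y
  ... | yes z≡x | _       = contradiction z≡x z≢x
  ... | no _    | yes z≡y = contradiction z≡y z≢y
  ... | no _    | no _    = refl

  private
    involutive : ∀ z → exchange (exchange z) ≡ z
    involutive z with z ≟ x | z ≟ y
    ... | yes refl | _        = exchange-y
    ... | no _     | yes refl = exchange-x
    ... | no z≢x   | no z≢y   = exchange-other z≢x z≢y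

  transposition : A ↔ A
  transposition = mk↔ₛ′ exchange exchange involutive involutive

-- Edges as the queries show them.

module Links (ℝ : Reals) where
  open Reals ℝ
  open Model ℝ
  open OrderedField ℝ

  private
    variable
      κ : Kind
      n : ℕ

  -- An edge identified by its name, so that edges of two different graphs can be compared without
  -- identifying their edge types.
  Link : Graph κ n → Fin n → ℕ → Carrier → Fin n → Set
  Link G u k w v = ∃ λ e → name G e ≡ k × weight G e ≡ w × Joins G u e v

  name-injective : ∀ (G : Graph κ n) {e e′} → name G e ≡ name G e′ → e ≡ e′
  name-injective {directed}   G = toℕ-injective
  name-injective {undirected} G = toℕ-injective

  link-positive : ∀ (G : Graph κ n) {u k w v} → Link G u k w v → 0# < w
  link-positive {directed}   G (e , _ , refl , _) = DirectedGraph.positive G e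
  link-positive {undirected} G (e , _ , refl , _) = UndirectedGraph.positive G e

  link-weight : ∀ (G : Graph κ n) {u k w v u′ w′ v′} → Link G u k w v → Link G u′ k w′ v′ → w ≡ w′
  link-weight G (e , refl , refl , _) (e′ , k≡k′ , refl , _) = cong (weight G) (name-injective G (sym k≡k′))

  private
    ends-agree : ∀ (G : UndirectedGraph n) e b c → let open UndirectedGraph G using (endpoint) in
                 endpoint e b ≡ endpoint e c ⊎ endpoint e b ≡ endpoint e (not c)
    ends-agree G e false false = inj₁ refl
    ends-agree G e false true  = inj₂ refl
    ends-agree G e true  false = inj₂ refl
    ends-agree G e true  true  = inj₁ refl

  -- In an undirected graph a name fixes only the unordered pair of ends, and a link may be read
  -- from either end; hence the disjunctions.
  link-ends : ∀ (G : Graph κ n) {x k w y x′ w′ y′} → Link G x k w y → Link G x′ k w′ y′ →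
              (x′ ≡ x ⊎ x′ ≡ y) × (y′ ≡ x ⊎ y′ ≡ y)
  link-ends {directed} G (e , k≡ , _ , refl , refl) (e′ , k≡′ , _ , refl , refl)
    with refl ← toℕ-injective (trans k≡′ (sym k≡)) = inj₁ refl , inj₂ refl
  link-ends {undirected} G (e , k≡ , _ , b , refl , refl) (e′ , k≡′ , _ , b′ , refl , refl)
    with refl ← toℕ-injective (trans k≡′ (sym k≡)) = ends-agree G e b′ b , ends-agree G e (not b′) b

  -- The edges that an execution in direction `δ` relaxes at `u`, so that both executions can be
  -- treated at once.
  Arc : Graph κ n → Direction → Fin n → ℕ → Carrier → Fin n → Set
  Arc G forward  u k w v = Link G u k w v
  Arc G backward u k w v = Link G v k w u

  arc-flip : ∀ (G : Graph κ n) δ {u k w v} → Arc G δ u k w v → Arc G (opposite δ) v k w u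
  arc-flip G forward  a = a
  arc-flip G backward a = a

  arc-positive : ∀ (G : Graph κ n) δ {u k w v} → Arc G δ u k w v → 0# < w
  arc-positive G forward  = link-positive G
  arc-positive G backward = link-positive G

  arc-head : ∀ (G : Graph κ n) δ {x k w y x′ w′ y′} → Arc G δ x k w y → Arc G δ x′ k w′ y′ → y′ ≡ x ⊎ y′ ≡ y
  arc-head G forward  a a′ = proj₂ (link-ends G a a′)
  arc-head G backward a a′ = Sum.swap (proj₁ (link-ends G a a′))

  degreeAt : Graph κ n → Direction → Fin n → ℕ
  degreeAt {κ} G δ u = answer G (degreeQuery κ δ u)

  slot : Graph κ n → Direction → Fin n → ℕ → EdgeAnswer n
  slot {κ} G δ u j = answer G (edgeQuery κ δ u j)

  private
    atPosition-< : ∀ {d j} (f : Fin d → ℕ × Carrier × Fin n) (j<d : j ℕ.< d) →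
        atPosition d j f ≡ just (f (fromℕ< j<d))
    atPosition-< {d = d} {j} f j<d with j ℕ.<? d
    ... | yes _  = refl
    ... | no j≮d = contradiction j<d j≮d

    atPosition-toℕ : ∀ {d} (f : Fin d → ℕ × Carrier × Fin n) p → atPosition d (toℕ p) f ≡ just (f p)
    atPosition-toℕ f p = trans (atPosition-< f (toℕ<n p)) (cong (just ∘ f) (fromℕ<-toℕ p (toℕ<n p)))

    atPosition-just : ∀ {d} j (f : Fin d → ℕ × Carrier × Fin n) {a} → atPosition d j f ≡ just a →
                      ∃ λ p → toℕ p ≡ j × f p ≡ a
    atPosition-just {d = d} j f eq with j ℕ.<? d
    atPosition-just j f refl | yes j<d = fromℕ< j<d , toℕ-fromℕ< j<d , refl

  slot-< : ∀ (G : Graph κ n) δ u {j} → j ℕ.< degreeAt G δ u → ∃ λ a → slot G δ u j ≡ just a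
  slot-< {directed}   G forward  u j<d = _ , atPosition-< _ j<d
  slot-< {directed}   G backward u j<d = _ , atPosition-< _ j<d
  slot-< {undirected} G forward  u j<d = _ , atPosition-< _ j<d
  slot-< {undirected} G backward u j<d = _ , atPosition-< _ j<d

  slot⇒arc : ∀ (G : Graph κ n) δ u {j k w v} → slot G δ u j ≡ just (k , w , v) → Arc G δ u k w v
  slot⇒arc {directed} G forward u {j} eq with (p , _ , refl) ← atPosition-just j _ eq =
    _ , refl , refl , cong proj₁ (Inverse.strictlyInverseˡ out (u , p)) , refl
    where open DirectedGraph G using (out; inn; source; target)
  slot⇒arc {directed} G backward u {j} eq with (p , _ , refl) ← atPosition-just j _ eq =
    _ , refl , refl , refl , cong proj₁ (Inverse.strictlyInverseˡ inn (u , p))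
    where open DirectedGraph G using (out; inn; source; target)
  slot⇒arc {undirected} G forward u {j} eq with (p , _ , refl) ← atPosition-just j _ eq =
    _ , refl , refl , _ , cong proj₁ (Inverse.strictlyInverseˡ ends (u , p)) , refl
    where open UndirectedGraph G using (deg; ends; endpoint)
  slot⇒arc {undirected} G backward u {j} eq with (p , _ , refl) ← atPosition-just j _ eq =
    _ , refl , refl , not _ , refl , trans (cong (endpoint _) (not-involutive _))
        (cong proj₁ (Inverse.strictlyInverseˡ ends (u , p)))
    where open UndirectedGraph G using (deg; ends; endpoint)

  private
    undirected-slot : ∀ (G : UndirectedGraph n) e b → let open UndirectedGraph G using (deg; endpoint) in
      ∃ λ j → j ℕ.< deg (endpoint e b)
        × slot {undirected} G forward (endpoint e b) j ≡ just (toℕ e , weight {undirected} G e , endpoint e (not b))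
    undirected-slot G e b = toℕ p , toℕ<n p , trans (atPosition-toℕ _ p)
      (cong (λ (e , b) → just (toℕ e , weight {undirected} G e , endpoint e (not b))) (Inverse.strictlyInverseʳ ends
          (e , b)))
      where
      open UndirectedGraph G using (deg; ends; endpoint)
      p : Fin (deg (endpoint e b))
      p = proj₂ (Inverse.to ends (e , b))

  arc⇒slot : ∀ (G : Graph κ n) δ u {k w v} → Arc G δ u k w v →
             ∃ λ j → j ℕ.< degreeAt G δ u × slot G δ u j ≡ just (k , w , v)
  arc⇒slot {directed} G forward _ (e , refl , refl , refl , refl) = toℕ p , toℕ<n p , trans (atPosition-toℕ _ p)
    (cong (λ e → just (toℕ e , weight {directed} G e , target e)) (Inverse.strictlyInverseʳ out e))
    where
    open DirectedGraph G using (out; inn; source; target)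
    p = proj₂ (Inverse.to out e)
  arc⇒slot {directed} G backward _ (e , refl , refl , refl , refl) = toℕ p , toℕ<n p , trans (atPosition-toℕ _ p)
    (cong (λ e → just (toℕ e , weight {directed} G e , source e)) (Inverse.strictlyInverseʳ inn e))
    where
    open DirectedGraph G using (out; inn; source; target)
    p = proj₂ (Inverse.to inn e)
  arc⇒slot {undirected} G forward _ (e , refl , refl , b , refl , refl) = undirected-slot G e b
  arc⇒slot {undirected} G backward _ (e , refl , refl , b , refl , refl)
    with (j , j<d , eq) ← undirected-slot G e (not b) = j , j<d ,
    trans eq (cong (λ b → just (toℕ e , weight {undirected} G e , endpoint e b)) (not-involutive b))
    where open UndirectedGraph G using (deg; ends; endpoint)

  -- An edge occupies at most two slots in each direction: two for undirected
  -- edges, told apart by the mark.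

  mark : Graph κ n → Fin n → ℕ → Bool
  mark {directed}   G u j = true
  mark {undirected} G u j with j ℕ.<? UndirectedGraph.deg G u
  ... | yes j<d = proj₂ (Inverse.from (UndirectedGraph.ends G) (u , fromℕ< j<d))
  ... | no _    = true

  private
    from-injective : ∀ {A B : Set} (f : A ↔ B) {x y} → Inverse.from f x ≡ Inverse.from f y → x ≡ y
    from-injective f {x} {y} eq = trans (sym (Inverse.strictlyInverseˡ f x)) (trans (cong (Inverse.to f) eq)
        (Inverse.strictlyInverseˡ f y))

    untag : ∀ {d : Fin n → ℕ} {u u′ : Fin n} {p : Fin (d u)} {p′ : Fin (d u′)} → (u , p) ≡ (u′ , p′) →
        (u , toℕ p) ≡ (u′ , toℕ p′)
    untag refl = refl

    mark-toℕ : ∀ (G : UndirectedGraph n) u p →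
               mark {undirected} G u (toℕ p) ≡ proj₂ (Inverse.from (UndirectedGraph.ends G) (u , p))
    mark-toℕ G u p with toℕ p ℕ.<? UndirectedGraph.deg G u
    ... | yes j<d = cong (λ p → proj₂ (Inverse.from (UndirectedGraph.ends G) (u , p))) (fromℕ<-toℕ p j<d)
    ... | no j≮d  = contradiction (toℕ<n p) j≮d

    undirected-slot-injective : ∀ (G : UndirectedGraph n) {u u′ j j′ k w v w′ v′} →
      slot {undirected} G forward u j ≡ just (k , w , v) → slot {undirected} G forward u′ j′ ≡ just (k , w′ , v′) →
      mark {undirected} G u j ≡ mark {undirected} G u′ j′ → (u , j) ≡ (u′ , j′)
    undirected-slot-injective G {u} {u′} {j} {j′} eq eq′ same
      with (p , refl , q) ← atPosition-just j _ eq | (p′ , refl , q′) ← atPosition-just j′ _ eq′ =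
      untag (from-injective (UndirectedGraph.ends G)
          (cong₂ _,_ (toℕ-injective (trans (cong proj₁ q) (sym (cong proj₁ q′))))
        (trans (sym (mark-toℕ G u p)) (trans same (mark-toℕ G u′ p′)))))

  slot-injective : ∀ (G : Graph κ n) δ {u u′ j j′ k w v w′ v′} →
    slot G δ u j ≡ just (k , w , v) → slot G δ u′ j′ ≡ just (k , w′ , v′) →
    mark G u j ≡ mark G u′ j′ → (u , j) ≡ (u′ , j′)
  slot-injective {directed} G forward {j = j} {j′} eq eq′ _
    with (p , refl , q) ← atPosition-just j _ eq | (p′ , refl , q′) ← atPosition-just j′ _ eq′ =
    untag (from-injective (DirectedGraph.out G) (toℕ-injective (trans (cong proj₁ q) (sym (cong proj₁ q′)))))
  slot-injective {directed} G backward {j = j} {j′} eq eq′ _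
    with (p , refl , q) ← atPosition-just j _ eq | (p′ , refl , q′) ← atPosition-just j′ _ eq′ =
    untag (from-injective (DirectedGraph.inn G) (toℕ-injective (trans (cong proj₁ q) (sym (cong proj₁ q′)))))
  slot-injective {undirected} G forward  = undirected-slot-injective G
  slot-injective {undirected} G backward = undirected-slot-injective G

  -- A degree query reveals nothing, because rewiring preserves all degrees.
  revealed : ∀ {f} → Graph κ n → Query κ n f → Maybe ℕ
  revealed {f = degreeForm} G q = nothing
  revealed {f = edgeForm}   G q = Maybe.map proj₁ (answer G q)

-- Rewiring two edges into a short and a long one.

module Rewiring (ℝ : Reals) where
  open Reals ℝ
  open Model ℝ
  open OrderedField ℝ
  open Links ℝ

  -- The interface between the construction and the argument about lengths. The long edge is
  -- described by its weight, which alone will keep it off shortest paths.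
  record Rewired {κ n} (G G′ : Graph κ n) (u v : Fin n) (short long : ℕ) (ε W : Carrier) : Set where
    field
      shortcut : Link G′ u short ε v
      detour   : ∀ {x w y} → Link G′ x long w y → w ≡ W
      restore  : ∀ {x k w y} → k ≢ short → k ≢ long → Link G′ x k w y → Link G x k w y
      retain   : ∀ {x k w y} → k ≢ short → k ≢ long → Link G x k w y → Link G′ x k w y
      agree    : ∀ {f} (q : Query κ n f) →
                 answer G′ q ≡ answer G q ⊎ revealed G q ≡ just short ⊎ revealed G q ≡ just long

  private
    atPosition-agree : ∀ {n d} j (f f′ : Fin d → ℕ × Carrier × Fin n) {a b} →
      (∀ p → f′ p ≡ f p ⊎ proj₁ (f p) ≡ a ⊎ proj₁ (f p) ≡ b) →
      atPosition d j f′ ≡ atPosition d j f ⊎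
      Maybe.map proj₁ (atPosition d j f) ≡ just a ⊎ Maybe.map proj₁ (atPosition d j f) ≡ just b
    atPosition-agree {d = d} j f f′ same with j ℕ.<? d
    ... | yes j<d = Sum.map (cong just) (Sum.map (cong just) (cong just)) (same (fromℕ< j<d))
    ... | no _    = inj₁ refl

    module Reweighing {m} (w : Fin m → Carrier) (short long : Fin m) (short≢long : short ≢ long) (ε W : Carrier) where

      reweigh : Fin m → Carrier
      reweigh g with g Fin.≟ short | g Fin.≟ long
      ... | yes _ | _     = ε
      ... | no _  | yes _ = W
      ... | no _  | no _  = w g

      reweigh-short : reweigh short ≡ ε
      reweigh-short with short Fin.≟ short | short Fin.≟ long
      ... | yes _  | _ = refl
      ... | no s≢s | _ = contradiction refl s≢s

      reweigh-long : reweigh long ≡ W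
      reweigh-long with long Fin.≟ short | long Fin.≟ long
      ... | yes l≡s | _      = contradiction (sym l≡s) short≢long
      ... | no _    | yes _  = refl
      ... | no _    | no l≢l = contradiction refl l≢l

      reweigh-other : ∀ {g} → g ≢ short → g ≢ long → reweigh g ≡ w g
      reweigh-other {g} g≢s g≢l with g Fin.≟ short | g Fin.≟ long
      ... | yes g≡s | _       = contradiction g≡s g≢s
      ... | no _    | yes g≡l = contradiction g≡l g≢l
      ... | no _    | no _    = refl

      reweigh-positive : (∀ g → 0# < w g) → 0# < ε → 0# < W → ∀ g → 0# < reweigh g
      reweigh-positive 0<w 0<ε 0<W g with g Fin.≟ short | g Fin.≟ long
      ... | yes _ | _     = 0<ε
      ... | no _  | yes _ = 0<W
      ... | no _  | no _  = 0<w g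

    from-fixed : ∀ {A : Set} (π : A ↔ A) {x} → Inverse.to π x ≡ x → Inverse.from π x ≡ x
    from-fixed π eq = trans (cong (Inverse.from π) (sym eq)) (Inverse.strictlyInverseʳ π _)

    reply : ∀ {m n} → (Fin m → Carrier) → (Fin m → Fin n) → Fin m → ℕ × Carrier × Fin n
    reply w end g = toℕ g , w g , end g

    reply′ : ∀ {m n} → (Fin m → Carrier) → (Fin m → Bool → Fin n) → Fin m × Bool → ℕ × Carrier × Fin n
    reply′ w end (g , b) = toℕ g , w g , end g (not b)

    distinct : ∀ {m k} {g h : Fin m} → toℕ g ≡ k → k ≢ toℕ h → g ≢ h
    distinct refl k≢h refl = k≢h refl

    module _ {n} (G : DirectedGraph n) (short long : Fin (DirectedGraph.m G)) (short≢long : short ≢ long)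
             (π ρ : Fin (DirectedGraph.m G) ↔ Fin (DirectedGraph.m G))
             (π-fixes : ∀ g → g ≢ short → g ≢ long → Inverse.to π g ≡ g)
             (ρ-fixes : ∀ g → g ≢ short → g ≢ long → Inverse.to ρ g ≡ g)
             {ε W : Reals.Carrier ℝ} (0<ε : Reals._<_ ℝ (Reals.0# ℝ) ε) (0<W : Reals._<_ ℝ (Reals.0# ℝ) W) where
      open DirectedGraph G using (out; inn; source; target; positive)
      open Reweighing (DirectedGraph.weight G) short long short≢long ε W

      -- `π` permutes the tails among the edges and `ρ` the heads. Composing them with `out` and
      -- `inn` leaves the set of slots as it is, so degrees are kept and only the slots of `short`
      -- and `long` change their answers.
      directedRewiring : DirectedGraph n
      directedRewiring = record
        { out      = ↔-trans π out
        ; inn      = ↔-trans ρ inn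
        ; weight   = reweigh
        ; positive = reweigh-positive positive 0<ε 0<W
        }

      private
        G′ : DirectedGraph n
        G′ = directedRewiring

        source-other : ∀ g → g ≢ short → g ≢ long → DirectedGraph.source G′ g ≡ source g
        source-other g g≢s g≢l = cong source (π-fixes g g≢s g≢l)

        target-other : ∀ g → g ≢ short → g ≢ long → DirectedGraph.target G′ g ≡ target g
        target-other g g≢s g≢l = cong target (ρ-fixes g g≢s g≢l)

        agree : ∀ {f} (q : Query directed n f) → answer {directed} G′ q ≡ answer {directed} G q ⊎
                revealed {directed} G q ≡ just (toℕ short) ⊎ revealed {directed} G q ≡ just (toℕ long)
        agree (outdegree i) = inj₁ refl
        agree (indegree i)  = inj₁ refl
        agree (outedge i j) = atPosition-agree j _ _ (λ p → same (Inverse.from out (i , p)))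
          where
          same : ∀ g → reply reweigh (DirectedGraph.target G′) (Inverse.from π g) ≡ reply (DirectedGraph.weight G)
              target g
                 ⊎ toℕ g ≡ toℕ short ⊎ toℕ g ≡ toℕ long
          same g with g Fin.≟ short | g Fin.≟ long
          ... | yes refl | _        = inj₂ (inj₁ refl)
          ... | no _     | yes refl = inj₂ (inj₂ refl)
          ... | no g≢s   | no g≢l rewrite from-fixed π (π-fixes g g≢s g≢l) =
            inj₁ (cong (toℕ g ,_) (cong₂ _,_ (reweigh-other g≢s g≢l) (target-other g g≢s g≢l)))
        agree (inedge i j) = atPosition-agree j _ _ (λ p → same (Inverse.from inn (i , p)))
          where
          same : ∀ g → reply reweigh (DirectedGraph.source G′) (Inverse.from ρ g) ≡ reply (DirectedGraph.weight G)
              source g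
                 ⊎ toℕ g ≡ toℕ short ⊎ toℕ g ≡ toℕ long
          same g with g Fin.≟ short | g Fin.≟ long
          ... | yes refl | _        = inj₂ (inj₁ refl)
          ... | no _     | yes refl = inj₂ (inj₂ refl)
          ... | no g≢s   | no g≢l rewrite from-fixed ρ (ρ-fixes g g≢s g≢l) =
            inj₁ (cong (toℕ g ,_) (cong₂ _,_ (reweigh-other g≢s g≢l) (source-other g g≢s g≢l)))

      directedRewired : ∀ {u v} → source (Inverse.to π short) ≡ u → target (Inverse.to ρ short) ≡ v →
                        Rewired {directed} G G′ u v (toℕ short) (toℕ long) ε W
      directedRewired u≡ v≡ = record
        { shortcut = short , refl , reweigh-short , u≡ , v≡
        ; detour   = λ { (g , g≡ , refl , _) → trans (cong reweigh (toℕ-injective g≡)) reweigh-long }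
        ; restore  = λ { k≢s k≢l (g , g≡ , refl , refl , refl) → let g≢s = distinct g≡ k≢s; g≢l = distinct g≡ k≢l in
            g , g≡ , sym (reweigh-other g≢s g≢l) , sym (source-other g g≢s g≢l) , sym (target-other g g≢s g≢l) }
        ; retain   = λ { k≢s k≢l (g , g≡ , refl , refl , refl) → let g≢s = distinct g≡ k≢s; g≢l = distinct g≡ k≢l in
            g , g≡ , reweigh-other g≢s g≢l , source-other g g≢s g≢l , target-other g g≢s g≢l }
        ; agree    = agree
        }

    module _ {n} (G : UndirectedGraph n) (short long : Fin (UndirectedGraph.m G)) (short≢long : short ≢ long)
             (π : (Fin (UndirectedGraph.m G) × Bool) ↔ (Fin (UndirectedGraph.m G) × Bool))
             (π-fixes : ∀ g b → g ≢ short → g ≢ long → Inverse.to π (g , b) ≡ (g , b))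
             {ε W : Reals.Carrier ℝ} (0<ε : Reals._<_ ℝ (Reals.0# ℝ) ε) (0<W : Reals._<_ ℝ (Reals.0# ℝ) W) where
      open UndirectedGraph G using (ends; endpoint; positive)
      open Reweighing (UndirectedGraph.weight G) short long short≢long ε W

      undirectedRewiring : UndirectedGraph n
      undirectedRewiring = record
        { ends     = ↔-trans π ends
        ; weight   = reweigh
        ; positive = reweigh-positive positive 0<ε 0<W
        }

      private
        G′ : UndirectedGraph n
        G′ = undirectedRewiring

        endpoint-other : ∀ g b → g ≢ short → g ≢ long → UndirectedGraph.endpoint G′ g b ≡ endpoint g b
        endpoint-other g b g≢s g≢l = cong (proj₁ ∘ Inverse.to ends) (π-fixes g b g≢s g≢l)

        agree : ∀ {f} (q : Query undirected n f) → answer {undirected} G′ q ≡ answer {undirected} G q ⊎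
                revealed {undirected} G q ≡ just (toℕ short) ⊎ revealed {undirected} G q ≡ just (toℕ long)
        agree (degree i) = inj₁ refl
        agree (edge i j) = atPosition-agree j _ _ (λ p → same (Inverse.from ends (i , p)))
          where
          same : ∀ end → reply′ reweigh (UndirectedGraph.endpoint G′) (Inverse.from π end) ≡ reply′
              (UndirectedGraph.weight G) endpoint end
                 ⊎ toℕ (proj₁ end) ≡ toℕ short ⊎ toℕ (proj₁ end) ≡ toℕ long
          same (g , b) with g Fin.≟ short | g Fin.≟ long
          ... | yes refl | _        = inj₂ (inj₁ refl)
          ... | no _     | yes refl = inj₂ (inj₂ refl)
          ... | no g≢s   | no g≢l rewrite from-fixed π (π-fixes g b g≢s g≢l) =
            inj₁ (cong (toℕ g ,_) (cong₂ _,_ (reweigh-other g≢s g≢l) (endpoint-other g (not b) g≢s g≢l)))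

      undirectedRewired : ∀ {u v} b → proj₁ (Inverse.to ends (Inverse.to π (short , b))) ≡ u →
                          proj₁ (Inverse.to ends (Inverse.to π (short , not b))) ≡ v →
                          Rewired {undirected} G G′ u v (toℕ short) (toℕ long) ε W
      undirectedRewired b u≡ v≡ = record
        { shortcut = short , refl , reweigh-short , b , u≡ , v≡
        ; detour   = λ { (g , g≡ , refl , _) → trans (cong reweigh (toℕ-injective g≡)) reweigh-long }
        ; restore  = λ { k≢s k≢l (g , g≡ , refl , b , refl , refl) → let g≢s = distinct g≡ k≢s; g≢l = distinct g≡ k≢l in
            g , g≡ , sym (reweigh-other g≢s g≢l) , b , sym (endpoint-other g b g≢s g≢l) , sym
                (endpoint-other g (not b) g≢s g≢l) }
        ; retain   = λ { k≢s k≢l (g , g≡ , refl , b , refl , refl) → let g≢s = distinct g≡ k≢s; g≢l = distinct g≡ k≢l in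
            g , g≡ , reweigh-other g≢s g≢l , b , endpoint-other g b g≢s g≢l , endpoint-other g (not b) g≢s g≢l }
        ; agree    = agree
        }

  -- Exchanging the two tails turns f into an edge from u to v; exchanging the
  -- two heads does the same with e.
  rewire : ∀ {κ n} (G : Graph κ n) {u e w x y f w′ v ε W} → Link G u e w x → Link G y f w′ v → e ≢ f →
           0# < ε → 0# < W →
           (∃ λ G₁ → Rewired G G₁ u v f e ε W) × (∃ λ G₂ → Rewired G G₂ u v e f ε W)
  rewire {directed} G (e , refl , _ , refl , _) (f , refl , _ , _ , refl) e≢f 0<ε 0<W =
    (_ , directedRewired G f e f≢e′ transposition ↔-refl
           (λ g g≢f g≢e → exchange-other g≢e g≢f) (λ _ _ _ → refl) 0<ε 0<W (cong source exchange-y) refl) ,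
    (_ , directedRewired G e f e≢f′ ↔-refl transposition
           (λ _ _ _ → refl) (λ g g≢e g≢f → exchange-other g≢e g≢f) 0<ε 0<W refl (cong target exchange-x))
    where
    open DirectedGraph G using (source; target)
    open Transposition Fin._≟_ e f
    e≢f′ : e ≢ f
    e≢f′ refl = e≢f refl
    f≢e′ : f ≢ e
    f≢e′ refl = e≢f refl
  rewire {undirected} G (e , refl , _ , b , refl , _) (f , refl , _ , c , _ , refl) e≢f 0<ε 0<W =
    (_ , undirectedRewired G f e f≢e′ Tails.transposition (λ g d g≢f g≢e → Tails.exchange-other (g≢e ∘ cong proj₁)
        (g≢f ∘ cong proj₁)) 0<ε 0<W
           c (cong (proj₁ ∘ Inverse.to ends) Tails.exchange-y)
           (cong (proj₁ ∘ Inverse.to ends) (Tails.exchange-other (f≢e′ ∘ cong proj₁) (Bool.not-¬ refl ∘ sym ∘ cong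
               proj₂)))) ,
    (_ , undirectedRewired G e f e≢f′ Heads.transposition (λ g d g≢e g≢f → Heads.exchange-other (g≢e ∘ cong proj₁)
        (g≢f ∘ cong proj₁)) 0<ε 0<W
           b (cong (proj₁ ∘ Inverse.to ends) (Heads.exchange-other (Bool.not-¬ refl ∘ cong proj₂)
               (e≢f′ ∘ cong proj₁)))
           (cong (proj₁ ∘ Inverse.to ends) Heads.exchange-x))
    where
    open UndirectedGraph G using (ends)
    -- The given links decide which ends of the undirected edges count as tails: `b` for `e` and `c`
    -- for `f`.
    module Tails = Transposition (≡-dec Fin._≟_ Bool._≟_) (e , b) (f , c)
    module Heads = Transposition (≡-dec Fin._≟_ Bool._≟_) (e , not b) (f , not c)
    e≢f′ : e ≢ f
    e≢f′ refl = e≢f refl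
    f≢e′ : f ≢ e
    f≢e′ refl = e≢f refl

  -- A graph in which `t` is unreachable from `s`, but both have an edge to rewire. Its two
  -- rewirings show that a correct algorithm cannot do without queries.
  loops : ∀ κ n → Graph κ n
  loops directed   n = record
    { m        = n
    ; outdeg   = const 1
    ; indeg    = const 1
    ; out      = at-0
    ; inn      = at-0
    ; weight   = const 1#
    ; positive = const 0<1
    }
    where
    at-0 : Fin n ↔ Σ (Fin n) (λ _ → Fin 1)
    at-0 = mk↔ₛ′ (_, zero) proj₁ (λ { (i , zero) → refl }) (λ _ → refl)
  loops undirected n = record
    { m        = n
    ; deg      = const 2
    ; ends     = mk↔ₛ′ (λ (i , b) → i , Inverse.from 2↔Bool b) (λ (i , p) → i , Inverse.to 2↔Bool p)
                   (λ (i , p) → cong (i ,_) (Inverse.strictlyInverseʳ 2↔Bool p))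
                   (λ (i , b) → cong (i ,_) (Inverse.strictlyInverseˡ 2↔Bool b))
    ; weight   = const 1#
    ; positive = const 0<1
    }

  loop : ∀ κ {n} (i : Fin n) → Link (loops κ n) i (toℕ i) 1# i
  loop directed   i = i , refl , refl , refl , refl
  loop undirected i = i , refl , refl , true , refl , refl

  loops-link : ∀ κ {n} {u k w v} → Link (loops κ n) u k w v → u ≡ v
  loops-link directed   (_ , _ , _ , refl , refl)     = refl
  loops-link undirected (_ , _ , _ , _ , refl , refl) = refl

-- Walks by names and lengths, and their relation to shortest paths.

module Trails (ℝ : Reals) where
  open Reals ℝ
  open Model ℝ
  open OrderedField ℝ
  open Links ℝ

  infixr 5 _∷_

  -- Vertices and edges may repeat, despite the usual meaning of the word, so that concatenating and
  -- cutting need no care. Recording names lets a trail be carried over to a rewired graph.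
  data Trail {κ n} (G : Graph κ n) (δ : Direction) : Fin n → List ℕ → Carrier → Fin n → Set where
    []  : ∀ {u} → Trail G δ u [] 0# u
    _∷_ : ∀ {u k w v ks ℓ z} → Arc G δ u k w v → Trail G δ v ks ℓ z → Trail G δ u (k ∷ ks) (w + ℓ) z

  module _ {κ n} {G : Graph κ n} where

    infixr 5 _▹_

    trail-nonneg : ∀ {δ u ks ℓ v} → Trail G δ u ks ℓ v → 0# ≤ ℓ
    trail-nonneg []      = ≤-refl
    trail-nonneg (a ∷ T) = +-nonneg (<⇒≤ (arc-positive G _ a)) (trail-nonneg T)

    _▹_ : ∀ {δ u ks a v ls b z} → Trail G δ u ks a v → Trail G δ v ls b z → Trail G δ u (ks ++ ls) (a + b) z
    []      ▹ T = subst (λ ℓ → Trail G _ _ _ ℓ _) (sym (+-identityˡ _)) T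
    (a ∷ S) ▹ T = subst (λ ℓ → Trail G _ _ _ ℓ _) (sym (+-assoc _ _ _)) (a ∷ (S ▹ T))

    snoc : ∀ {δ u ks ℓ v k w z} → Trail G δ u ks ℓ v → Arc G δ v k w z → Trail G δ u (ks ∷ʳ k) (ℓ + w) z
    snoc T a = subst (λ ℓ → Trail G _ _ _ (_ + ℓ) _) (+-identityʳ _) (T ▹ (a ∷ []))

    mirror : ∀ {δ u ks ℓ v} → Trail G δ u ks ℓ v →
             ∃ λ ls → Trail G (opposite δ) v ls ℓ u × (∀ {k} → k ∈ ls → k ∈ ks)
    mirror [] = [] , [] , λ ()
    mirror {δ} {u} (_∷_ {k = k} {w} {ks = ks} {ℓ} a T) with (ls , T′ , ls⊆) ← mirror T =
      ls ∷ʳ k , subst (λ ℓ → Trail G (opposite δ) _ _ ℓ u) (+-comm ℓ w) (snoc T′ (arc-flip G δ a)) , λ k∈ → case ∈-++⁻ ls k∈ of λ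
        { (inj₁ k∈ls) → there (ls⊆ k∈ls) ; (inj₂ (here k≡)) → here k≡ }

    -- The cut is before the first use of `k`, or at the end if there is none. In an undirected
    -- graph that first use may start from the other end of `k`, so the vertex `u′` at which the arc
    -- leaves is returned anew.
    cut : ∀ {δ r ks ℓ u k w x} → Trail G δ r ks ℓ u → Arc G δ u k w x →
          ∃ λ u′ → ∃ λ ls → ∃ λ ℓ′ → ∃ λ x′ → Trail G δ r ls ℓ′ u′ × k ∉ ls × ℓ′ ≤ ℓ × Arc G δ u′ k w x′
    cut [] a = _ , [] , 0# , _ , [] , (λ ()) , ≤-refl , a
    cut {δ} {r} {k = k} {w} (_∷_ {k = k′} {w = w′} b T) a with k ℕ.≟ k′
    ... | yes refl = r , [] , 0# , _ , [] , (λ ()) , trail-nonneg (b ∷ T) , subst (λ w → Arc G δ r k w _)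
        (arc-weight δ b a) b
      where
      arc-weight : ∀ δ {u k w v u′ w′ v′} → Arc G δ u k w v → Arc G δ u′ k w′ v′ → w ≡ w′
      arc-weight forward  = link-weight G
      arc-weight backward = link-weight G
    ... | no k≢k′ with (u′ , ls , ℓ′ , x′ , T′ , k∉ls , ℓ′≤ℓ , a′) ← cut T a =
      u′ , k′ ∷ ls , w′ + ℓ′ , x′ , b ∷ T′ , (λ { (here k≡k′) → k≢k′ k≡k′ ; (there k∈ls) → k∉ls k∈ls }) , +-monoʳ-≤
          w′ ℓ′≤ℓ , a′

    -- However the trail traverses `k`, the vertex `v` is an end of that edge, so the trail can be
    -- stopped at `v` just before or just after it.
    visit : ∀ {δ r ks ℓ u k w y v} → Trail G δ r ks ℓ u → k ∈ ks → Arc G δ y k w v →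
            ∃ λ ls → ∃ λ ℓ′ → Trail G δ r ls ℓ′ v × ℓ′ ≤ ℓ
    visit {δ} (_∷_ {w = w′} b T) (here refl) a with arc-head G δ b a
    ... | inj₁ refl = [] , 0# , [] , trail-nonneg (b ∷ T)
    ... | inj₂ refl = _ , w′ + 0# , b ∷ [] , +-monoʳ-≤ w′ (trail-nonneg T)
    visit (_∷_ {w = w′} b T) (there k∈ks) a with (ls , ℓ′ , T′ , ℓ′≤ℓ) ← visit T k∈ks a =
      _ , _ , b ∷ T′ , +-monoʳ-≤ w′ ℓ′≤ℓ

    weight-≤ : ∀ {u ks ℓ v k W} → Trail G forward u ks ℓ v → k ∈ ks → (∀ {x w y} → Link G x k w y → w ≡ W) → W ≤ ℓ
    weight-≤ (_∷_ {w = w} {ℓ = ℓ} a T) (here refl) w≡W = subst (_≤ w + ℓ) (w≡W a) (x≤x+y w (trail-nonneg T))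
    weight-≤ (a ∷ T) (there k∈ks) w≡W = ≤-trans (weight-≤ T k∈ks w≡W) (x≤y+x _ (<⇒≤ (link-positive G a)))

    walk⇒trail : ∀ {u es vs v} → Walk G u es vs v → Trail G forward u (map (name G) es) (pathLength G es) v
    walk⇒trail stop       = []
    walk⇒trail (step j W) = (_ , refl , refl , j) ∷ walk⇒trail W

    trail⇒walk : ∀ {u ks ℓ v} → Trail G forward u ks ℓ v →
                 ∃ λ es → ∃ λ vs → ks ≡ map (name G) es × ℓ ≡ pathLength G es × Walk G u es vs v
    trail⇒walk [] = [] , _ , refl , refl , stop
    trail⇒walk ((e , refl , refl , j) ∷ T) with (es , vs , refl , refl , W) ← trail⇒walk T =
      e ∷ es , _ , refl , refl , step j W

    private
      open DecMembership {A = Fin n} Fin._≟_ using (_∈?_)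

      suffix : ∀ {u es vs v x} → Walk G u es vs v → Unique vs → x ∈ vs →
               ∃ λ es′ → Path G x es′ v × pathLength G es′ ≤ pathLength G es
      suffix stop       ! (here refl) = [] , (_ , stop , !) , ≤-refl
      suffix (step j W) ! (here refl) = _ , (_ , step j W , !) , ≤-refl
      suffix (step {e = e} j W) (_ ∷ !) (there x∈vs) with (es′ , P , ≤es) ← suffix W ! x∈vs =
        es′ , P , ≤-trans ≤es (x≤y+x _ (<⇒≤ (link-positive G (e , refl , refl , j))))

      -- The second alternative is strict since dropping a closed part saves a positive weight.
      -- Hence a walk of least length is itself a path, and its own list of edges is a correct
      -- output.
      simplify : ∀ {u es vs v} → Walk G u es vs v →
                 Unique vs ⊎ ∃ λ es′ → Path G u es′ v × pathLength G es′ < pathLength G es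
      simplify stop = inj₁ ([] ∷ [])
      simplify {u} (step {e = e} {es = es} {vs = vs} j W) with simplify W
      ... | inj₁ ! with u ∈? vs
      ...   | no u∉vs  = inj₁ (¬Any⇒All¬ vs u∉vs ∷ !)
      ...   | yes u∈vs with (es′ , P , ≤es) ← suffix W ! u∈vs =
        inj₂ (es′ , P , ≤-<-trans ≤es (x<y+x (pathLength G es) (link-positive G (e , refl , refl , j))))
      simplify {u} (step {e = e} {es = es} {vs = vs} j W) | inj₂ (es′ , (vs′ , W′ , !) , <es) with u ∈? vs′
      ...   | no u∉vs′  = inj₂ (e ∷ es′ , (_ , step j W′ , ¬Any⇒All¬ vs′ u∉vs′ ∷ !) , +-monoʳ-< (weight G e) <es)
      ...   | yes u∈vs′ with (es″ , P , ≤es′) ← suffix W′ ! u∈vs′ =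
        inj₂ (es″ , P , ≤-<-trans ≤es′
            (≤-<-trans (<⇒≤ <es) (x<y+x (pathLength G es) (link-positive G (e , refl , refl , j)))))

    trail⇒path : ∀ {u ks ℓ v} → Trail G forward u ks ℓ v → ∃ λ es → Path G u es v × pathLength G es ≤ ℓ
    trail⇒path T with trail⇒walk T
    ... | (es , vs , _ , refl , W) with simplify W
    ...   | inj₁ !               = es , (vs , W , !) , ≤-refl
    ...   | inj₂ (es′ , P , <es) = es′ , P , <⇒≤ <es

    no-trail⇒solves : ∀ {s t} → (∀ {ks ℓ} → ¬ Trail G forward s ks ℓ t) → Solves G s t nothing
    no-trail⇒solves none es (vs , W , _) = none (walk⇒trail W)

    minimal⇒solves : ∀ {s ks ℓ t} → Trail G forward s ks ℓ t → (∀ {ls m} → Trail G forward s ls m t → ℓ ≤ m) →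
                     Solves G s t (just ks)
    minimal⇒solves T minimal with trail⇒walk T
    ... | (es , vs , refl , refl , W) with simplify W
    ...   | inj₁ ! = es , refl , (vs , W , !) , λ _ (_ , W′ , _) → minimal (walk⇒trail W′)
    ...   | inj₂ (es′ , (_ , W′ , _) , <es) = contradiction (minimal (walk⇒trail W′)) (<⇒≱ <es)

    solves⇒no-trail : ∀ {s t} → Solves G s t nothing → ∀ {ks ℓ} → ¬ Trail G forward s ks ℓ t
    solves⇒no-trail none T = none _ (proj₁ (proj₂ (trail⇒path T)))

    solves⇒minimal : ∀ {s ks t} → Solves G s t (just ks) →
                     ∃ λ ℓ → Trail G forward s ks ℓ t × (∀ {ls m} → Trail G forward s ls m t → ℓ ≤ m)
    solves⇒minimal (es , refl , (_ , W , _) , shortest) = _ , walk⇒trail W , λ T →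
      let (es′ , P , es′≤) = trail⇒path T in ≤-trans (shortest es′ P) es′≤

  transfer : ∀ {κ n} {G G′ : Graph κ n} {u ks ℓ v} →
             (∀ {x k w y} → k ∈ ks → Link G x k w y → Link G′ x k w y) →
             Trail G forward u ks ℓ v → Trail G′ forward u ks ℓ v
  transfer keep []      = []
  transfer keep (a ∷ T) = keep (here refl) a ∷ transfer (keep ∘ there) T

-- Two rewired graphs without a common correct output.

module Crossings (ℝ : Reals) where
  open Reals ℝ
  open Model ℝ
  open OrderedField ℝ
  open Links ℝ
  open Rewiring ℝ
  open Trails ℝ

  private
    avoids : ∀ {k : ℕ} {ks l} → k ∈ ks → l ∉ ks → k ≢ l
    avoids k∈ks l∉ks refl = l∉ks k∈ks

    module _ {κ n} {G G′ : Graph κ n} {s t u v : Fin n} {short long ks ls a b ε}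
             (S : Trail G forward s ks a u) (T : Trail G forward v ls b t)
             (∉S : short ∉ ks × long ∉ ks) (∉T : short ∉ ls × long ∉ ls)
             (gap : ∀ {ms ℓ} → Trail G forward s ms ℓ t → a + (ε + b) < ℓ)
             (rewired : Rewired G G′ u v short long ε (1# + (a + (ε + b)))) where
      open Rewired rewired

      private
        new : Trail G′ forward s (ks ++ short ∷ ls) (a + (ε + b)) t
        new = transfer (λ k∈ → retain (avoids k∈ (proj₁ ∉S)) (avoids k∈ (proj₂ ∉S))) S
            ▹ (shortcut ∷ transfer (λ k∈ → retain (avoids k∈ (proj₁ ∉T)) (avoids k∈ (proj₂ ∉T))) T)

      -- The route through the short edge is shorter than the long edge alone, so a shortest path
      -- omits `long`. If it also omitted `short`, it would exist in `G`, where every trail from `s`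
      -- to `t` is longer than the new route.
      shortcut-taken : ∀ o → Solves G′ s t o → ∃ λ ms → o ≡ just ms × short ∈ ms × long ∉ ms
      shortcut-taken nothing   σ = contradiction new (solves⇒no-trail σ)
      shortcut-taken (just ms) σ with (ℓ , R , minimal) ← solves⇒minimal σ = ms , refl , short∈ms , long∉ms
        where
        long∉ms : long ∉ ms
        long∉ms long∈ = <⇒≱ (x<y+x (a + (ε + b)) 0<1) (≤-trans (weight-≤ R long∈ detour) (minimal new))
        short∈ms : short ∈ ms
        short∈ms with short ∈ℕ? ms
        ... | yes short∈ = short∈
        ... | no short∉  = contradiction (minimal new)
          (<⇒≱ (gap (transfer (λ k∈ → restore (avoids k∈ short∉) (avoids k∈ long∉ms)) R)))

  record Crossing {κ n} (G : Graph κ n) (s t : Fin n) (e f : ℕ) : Set where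
    field
      G₁ G₂    : Graph κ n
      disjoint : ∀ o → Solves G₁ s t o → ¬ Solves G₂ s t o
      agree    : ∀ {φ} (q : Query κ n φ) → (answer G₁ q ≡ answer G q × answer G₂ q ≡ answer G q)
                 ⊎ revealed G q ≡ just e ⊎ revealed G q ≡ just f

  -- Cutting S before its first e and T after its last f leaves trails that
  -- avoid both edges: otherwise they would combine to a trail from s to t
  -- that is shorter than D.
  crossing : ∀ {κ n} {G : Graph κ n} {s t u v : Fin n} {e w x y f w′ ks ls a b} →
    Link G u e w x → Link G y f w′ v → e ≢ f →
    Trail G forward s ks a u → Trail G forward v ls b t →
    ∀ D → [ a + b ] <⁺ D → (∀ {ms ℓ} → Trail G forward s ms ℓ t → D ≤⁺ [ ℓ ]) →
    Crossing G s t e f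
  crossing {G = G} {s} {t} {e = e} {f = f} {a = a} {b = b} Lₑ L_f e≢f S T D a+b<D D≤
    with (u₁ , ks₁ , a₁ , x₁ , S₁ , e∉S₁ , a₁≤a , Lₑ₁) ← cut S Lₑ
       | (_ , T⁻ , _) ← mirror T
    -- Mirroring makes the last `f` of `T` the first one, so that `cut` applies to both sides.
    with (v₁ , ls₁ , b₁ , y₁ , T₁ , f∉T₁ , b₁≤b , L_f₁) ← cut T⁻ L_f
    with (ls₂ , T₂ , ls₂⊆ls₁) ← mirror T₁ = record
      { G₁ = proj₁ (proj₁ rewirings)
      ; G₂ = proj₁ (proj₂ rewirings)
      ; disjoint = λ o σ₁ σ₂ →
          let (_ , o≡₁ , _ , e∉) = shortcut-taken S₁ T₂ (f∉S₁ , e∉S₁) (f∉T₂ , e∉T₂) wide (proj₂ (proj₁ rewirings)) o σ₁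
              (_ , o≡₂ , e∈ , _) = shortcut-taken S₁ T₂ (e∉S₁ , f∉S₁) (e∉T₂ , f∉T₂) wide (proj₂ (proj₂ rewirings)) o
                  σ₂
          in e∉ (subst (e ∈_) (just-injective (trans (sym o≡₂) o≡₁)) e∈)
      ; agree = λ q → both (Rewired.agree (proj₂ (proj₁ rewirings)) q) (Rewired.agree (proj₂ (proj₂ rewirings)) q)
      }
    where
    both : ∀ {A B P Q : Set} → A ⊎ P ⊎ Q → B ⊎ Q ⊎ P → (A × B) ⊎ Q ⊎ P
    both (inj₁ a)    (inj₁ b)    = inj₁ (a , b)
    both (inj₂ seen) _           = inj₂ (Sum.swap seen)
    both (inj₁ _)    (inj₂ seen) = inj₂ seen

    gap : ∀ {ms ℓ} → Trail G forward s ms ℓ t → a + b < ℓ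
    gap R = case Strict⁺.<⁺-transˡ _<_ <-≤-trans a+b<D (D≤ R) of λ { [ p ] → p }

    -- `f` enters `v₁`, so a trail through `f` could stop there and continue along `T₂`.
    f∉S₁ : f ∉ ks₁
    f∉S₁ f∈ with (_ , a₂ , S₂ , a₂≤a₁) ← visit S₁ f∈ L_f₁ =
      <⇒≱ (gap (S₂ ▹ T₂)) (+-mono-≤ (≤-trans a₂≤a₁ a₁≤a) b₁≤b)

    e∉T₁ : e ∉ ls₁
    e∉T₁ e∈ with (_ , b₂ , T₃ , b₂≤b₁) ← visit T₁ e∈ Lₑ₁ with (_ , T₄ , _) ← mirror T₃ =
      <⇒≱ (gap (S₁ ▹ T₄)) (+-mono-≤ a₁≤a (≤-trans b₂≤b₁ b₁≤b))

    e∉T₂ : e ∉ ls₂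
    e∉T₂ = e∉T₁ ∘ ls₂⊆ls₁

    f∉T₂ : f ∉ ls₂
    f∉T₂ = f∉T₁ ∘ ls₂⊆ls₁

    -- The room left below `D` is used for the length of the short edge. If `D` is infinite there is
    -- no trail to compare with, and 1 will do.
    slack : ∀ D → [ a + b ] <⁺ D → (∀ {ms ℓ} → Trail G forward s ms ℓ t → D ≤⁺ [ ℓ ]) →
            ∃ λ ε → 0# < ε × (∀ {ms ℓ} → Trail G forward s ms ℓ t → (a + b) + ε < ℓ)
    slack [ m ] [ a+b<m ] D≤ with (ε , 0<ε , p) ← room a+b<m =
      ε , 0<ε , λ R → case D≤ R of λ { [ m≤ℓ ] → <-≤-trans p m≤ℓ }
    slack ⊤⁺ _ D≤ = 1# , 0<1 , λ R → case D≤ R of λ ()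

    ε : Carrier
    ε = proj₁ (slack D a+b<D D≤)

    0<ε : 0# < ε
    0<ε = proj₁ (proj₂ (slack D a+b<D D≤))

    wide : ∀ {ms ℓ} → Trail G forward s ms ℓ t → a₁ + (ε + b₁) < ℓ
    wide R = ≤-<-trans (subst (a₁ + (ε + b₁) ≤_) (solve 3 (λ a b ε → a :+ (ε :+ b) := (a :+ b) :+ ε) refl a b ε)
      (+-mono-≤ a₁≤a (+-monoʳ-≤ ε b₁≤b))) (proj₂ (proj₂ (slack D a+b<D D≤)) R)

    0<W : 0# < 1# + (a₁ + (ε + b₁))
    0<W = <-≤-trans 0<1 (x≤x+y 1# (+-nonneg (trail-nonneg S₁) (+-nonneg (<⇒≤ 0<ε) (trail-nonneg T₂))))

    rewirings = rewire G Lₑ₁ L_f₁ e≢f 0<ε 0<W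

-- Sums and order with an infinite element.

module Extended (ℝ : Reals) where
  open Reals ℝ
  open OrderedField ℝ

  ≤⁺-refl : ∀ {x} → x ≤⁺ x
  ≤⁺-refl = NonStrict⁺.≤⁺-reflexive-≡ _≤_ ≤-reflexive refl

  ≤⁺-reflexive : ∀ {x y} → x ≡ y → x ≤⁺ y
  ≤⁺-reflexive = NonStrict⁺.≤⁺-reflexive-≡ _≤_ ≤-reflexive

  ≤⁺-trans : ∀ {x y z} → x ≤⁺ y → y ≤⁺ z → x ≤⁺ z
  ≤⁺-trans = NonStrict⁺.≤⁺-trans _≤_ ≤-trans

  <⁺-≤⁺-trans : ∀ {x y z} → x <⁺ y → y ≤⁺ z → x <⁺ z
  <⁺-≤⁺-trans = Strict⁺.<⁺-transˡ _<_ <-≤-trans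

  ≤⁺-<⁺-trans : ∀ {x y z} → x ≤⁺ y → y <⁺ z → x <⁺ z
  ≤⁺-<⁺-trans = Strict⁺.<⁺-transʳ _<_ ≤-<-trans

  <⁺-irrefl : ∀ {x} → ¬ x <⁺ x
  <⁺-irrefl [ x<x ] = <-irrefl x<x

  <⁺⇒≤⁺ : ∀ {x y} → x <⁺ y → x ≤⁺ y
  <⁺⇒≤⁺ [ x<y ]   = [ <⇒≤ x<y ]
  <⁺⇒≤⁺ [ x ]<⊤⁺ = [ x ] ≤⊤⁺

  ≰⁺⇒>⁺ : ∀ {x y} → ¬ x ≤⁺ y → y <⁺ x
  ≰⁺⇒>⁺ {x}     {⊤⁺}    x≰y = contradiction (x ≤⊤⁺) x≰y
  ≰⁺⇒>⁺ {⊤⁺}    {[ y ]} x≰y = [ y ]<⊤⁺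
  ≰⁺⇒>⁺ {[ x ]} {[ y ]} x≰y = [ ≰⇒> (x≰y ∘ [_]) ]

  ≮⁺⇒≥⁺ : ∀ {x y} → ¬ x <⁺ y → y ≤⁺ x
  ≮⁺⇒≥⁺ {x} {y} x≮y with y ≤⁺? x
  ... | yes y≤x = y≤x
  ... | no y≰x  = contradiction (≰⁺⇒>⁺ y≰x) x≮y

  +⁺-mono-≤⁺ : ∀ {x y u v} → x ≤⁺ y → u ≤⁺ v → x +⁺ u ≤⁺ y +⁺ v
  +⁺-mono-≤⁺ [ x≤y ]    [ u≤v ]    = [ +-mono-≤ x≤y u≤v ]
  +⁺-mono-≤⁺ [ x≤y ]    (u ≤⊤⁺)    = _ ≤⊤⁺
  +⁺-mono-≤⁺ (x ≤⊤⁺)    u≤v        = _ ≤⊤⁺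

  +⁺-comm : ∀ x y → x +⁺ y ≡ y +⁺ x
  +⁺-comm [ x ] [ y ] = cong [_] (+-comm x y)
  +⁺-comm [ x ] ⊤⁺    = refl
  +⁺-comm ⊤⁺    [ y ] = refl
  +⁺-comm ⊤⁺    ⊤⁺    = refl

  x≤⁺x+w : ∀ x {w} → 0# ≤ w → x ≤⁺ x +⁺ [ w ]
  x≤⁺x+w [ x ] 0≤w = [ x≤x+y x 0≤w ]
  x≤⁺x+w ⊤⁺    0≤w = ⊤⁺ ≤⊤⁺

  ≤⁺-finite : ∀ {x y} → x ≤⁺ [ y ] → ∃ λ z → x ≡ [ z ] × z ≤ y
  ≤⁺-finite [ x≤y ] = _ , refl , x≤y

  +⁺-finite : ∀ x {w ℓ} → x +⁺ [ w ] ≡ [ ℓ ] → ∃ λ z → x ≡ [ z ] × z + w ≡ ℓ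
  +⁺-finite [ x ] refl = x , refl , refl

  +⁺-finiteʳ : ∀ x {y z} → x +⁺ y <⁺ z → ∃ λ a → y ≡ [ a ]
  +⁺-finiteʳ [ x ] {[ y ]} _  = y , refl

-- Invariants of a single execution.

module Executions (ℝ : Reals) where
  open Reals ℝ
  open Model ℝ
  open OrderedField ℝ
  open Extended ℝ
  open Links ℝ
  open Trails ℝ
  open Execution

  module _ {κ n} (G : Graph κ n) where

    -- Routes are listed from `s` to `t` in both executions. The backward case is therefore a
    -- forward trail into the root, not a backward trail out of it, which would list the edges in
    -- reverse.
    Connects : Direction → Fin n → List ℕ → Carrier → Fin n → Set
    Connects forward  r ks ℓ v = Trail G forward r ks ℓ v
    Connects backward r ks ℓ v = Trail G forward v ks ℓ r

    connects-flip : ∀ δ {u ks ℓ v} → Connects δ u ks ℓ v → Connects (opposite δ) v ks ℓ u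
    connects-flip forward  T = T
    connects-flip backward T = T

    connects⇒trail : ∀ δ {u ks ℓ v} → Connects δ u ks ℓ v → ∃ λ ls → Trail G δ u ls ℓ v
    connects⇒trail forward  T = _ , T
    connects⇒trail backward T = _ , proj₁ (proj₂ (mirror T))

    connects-root : ∀ δ r → Connects δ r [] 0# r
    connects-root forward  r = []
    connects-root backward r = []

    connects-extend : ∀ δ {r ks ℓ u k w v} → Connects δ r ks ℓ u → Arc G δ u k w v →
                      Connects δ r (extend δ ks k) (ℓ + w) v
    connects-extend forward  T a = snoc T a
    connects-extend backward {ℓ = ℓ} {w = w} T a = subst (λ ℓ → Trail G forward _ _ ℓ _) (+-comm w ℓ) (a ∷ T)

    -- By `below` and `above`, the distance of the current vertex separates closed vertices from the
    -- others. `settled` exempts the slots of the current vertex that are still to be relaxed.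
    -- `busy` and `size` are conditional because at the beginning the current vertex is the root,
    -- which is open and whose degree has not been asked.
    record Sound (δ : Direction) (r : Fin n) (x : Execution n) : Set where
      field
        root    : dist x r ≤⁺ [ 0# ]
        routed  : ∀ v {d} → dist x v ≡ [ d ] → Connects δ r (route x v) d v
        reached : ∀ v → status x v ≢ unvisited → ∃ λ d → dist x v ≡ [ d ]
        unseen  : ∀ v → status x v ≡ unvisited → dist x v ≡ ⊤⁺
        below   : ∀ v → status x v ≡ closed → dist x v ≤⁺ dist x (current x)
        above   : ∀ v → status x v ≢ closed → dist x (current x) ≤⁺ dist x v
        settled : ∀ u {j k w v} → status x u ≡ closed → slot G δ u j ≡ just (k , w , v) →
                  (u ≡ current x → j ℕ.< relaxed x) → dist x v ≤⁺ dist x u +⁺ [ w ]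
        busy    : Pending x → status x (current x) ≡ closed
        size    : status x (current x) ≡ closed → total x ≡ degreeAt G δ (current x)

    -- The case analysis of `improve` at one vertex, made once for all the invariants.
    data Change (δ : Direction) (x : Execution n) (k : ℕ) (v : Fin n) (d : Carrier ⁺) (x′ : Execution n) (u : Fin n) : Set where
      unchanged : (u ≡ v → status x u ≡ closed) → status x′ u ≡ status x u →
                  dist x′ u ≡ dist x u → route x′ u ≡ route x u → Change δ x k v d x′ u
      opened    : u ≡ v → status x u ≢ closed → status x′ u ≡ isOpen → dist x u ≤⁺ d →
                  dist x′ u ≡ dist x u → route x′ u ≡ route x u → Change δ x k v d x′ u
      improved  : u ≡ v → status x u ≢ closed → status x′ u ≡ isOpen → d <⁺ dist x u →
                  dist x′ u ≡ d → route x′ u ≡ extend δ (route x (current x)) k → Change δ x k v d x′ u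

    record Improvement (δ : Direction) (x : Execution n) (k : ℕ) (v : Fin n) (d : Carrier ⁺) (x′ : Execution n) : Set where
      field
        current≡ : current x′ ≡ current x
        relaxed≡ : relaxed x′ ≡ relaxed x
        total≡   : total x′ ≡ total x
        change   : ∀ u → Change δ x k v d x′ u

    private
      module _ (δ : Direction) (x : Execution n) (k : ℕ) (v : Fin n) (d : Carrier ⁺) (v-open : status x v ≢ closed) where

        y z : Execution n
        y = record x { status = updateAt (status x) v (const isOpen) }
        z = record y { dist  = updateAt (dist x) v (const d)
                     ; route = updateAt (route x) v (const (extend δ (route x (current x)) k)) }

        opening : ¬ d <⁺ dist x v → Improvement δ x k v d y
        opening d≮ = record { current≡ = refl ; relaxed≡ = refl ; total≡ = refl ; change = change }
          where
          change : ∀ u → Change δ x k v d y u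
          change u with u Fin.≟ v
          ... | yes refl = opened refl v-open (updateAt-updates v (status x)) (≮⁺⇒≥⁺ d≮) refl refl
          ... | no u≢v   = unchanged (λ u≡v → contradiction u≡v u≢v) (updateAt-minimal u v (status x) u≢v) refl refl

        improving : d <⁺ dist x v → Improvement δ x k v d z
        improving d< = record { current≡ = refl ; relaxed≡ = refl ; total≡ = refl ; change = change }
          where
          change : ∀ u → Change δ x k v d z u
          change u with u Fin.≟ v
          ... | yes refl = improved refl v-open (updateAt-updates v (status x)) d<
                             (updateAt-updates v (dist x)) (updateAt-updates v (route x))
          ... | no u≢v   = unchanged (λ u≡v → contradiction u≡v u≢v) (updateAt-minimal u v (status x) u≢v)
                             (updateAt-minimal u v (dist x) u≢v) (updateAt-minimal u v (route x) u≢v)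

    improvement : ∀ δ x k v d → Improvement δ x k v d (improve δ x k v d)
    improvement δ x k v d with status x v in eq
    ... | closed = record { current≡ = refl ; relaxed≡ = refl ; total≡ = refl
                          ; change = λ u → unchanged (λ { refl → eq }) refl refl refl }
    ... | unvisited with d <⁺? dist x v
    ...   | yes d< = improving δ x k v d (λ p → case trans (sym eq) p of λ ()) d<
    ...   | no d≮  = opening δ x k v d (λ p → case trans (sym eq) p of λ ()) d≮
    improvement δ x k v d | isOpen with d <⁺? dist x v
    ...   | yes d< = improving δ x k v d (λ p → case trans (sym eq) p of λ ()) d<
    ...   | no d≮  = opening δ x k v d (λ p → case trans (sym eq) p of λ ()) d≮

    tick : Execution n → Execution n
    tick x = record x { relaxed = suc (relaxed x) }

    module _ {δ x k v d x′} (I : Improvement δ x k v d x′) where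
      open Improvement I

      dist-decreases : ∀ u → dist x′ u ≤⁺ dist x u
      dist-decreases u with change u
      ... | unchanged _ _ eq _    = ≤⁺-reflexive eq
      ... | opened _ _ _ _ eq _   = ≤⁺-reflexive eq
      ... | improved _ _ _ d< eq _ = ≤⁺-trans (≤⁺-reflexive eq) (<⁺⇒≤⁺ d<)

      closed-before : ∀ {u} → status x′ u ≡ closed → status x u ≡ closed
      closed-before {u} c with change u
      ... | unchanged _ eq _ _      = trans (sym eq) c
      ... | opened _ _ eq _ _ _     = case trans (sym eq) c of λ ()
      ... | improved _ _ eq _ _ _   = case trans (sym eq) c of λ ()

      closed-after : ∀ {u} → status x u ≡ closed → status x′ u ≡ closed × dist x′ u ≡ dist x u
      closed-after {u} c with change u
      ... | unchanged _ eq eq′ _     = trans eq c , eq′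
      ... | opened _ ≢c _ _ _ _      = contradiction c ≢c
      ... | improved _ ≢c _ _ _ _    = contradiction c ≢c

      dist-target : (status x v ≡ closed → dist x v ≤⁺ d) → dist x′ v ≤⁺ d
      dist-target closed⇒ with change v
      ... | unchanged c _ eq _      = ≤⁺-trans (≤⁺-reflexive eq) (closed⇒ (c refl))
      ... | opened _ _ _ ≤d eq _    = ≤⁺-trans (≤⁺-reflexive eq) ≤d
      ... | improved _ _ _ _ eq _   = ≤⁺-reflexive eq

    module _ {δ r x k w v x′} (sound : Sound δ r x) (pending : Pending x)
             (answered : slot G δ (current x) (relaxed x) ≡ just (k , w , v))
             (I : Improvement δ x k v (dist x (current x) +⁺ [ w ]) x′) where
      open Sound sound
      open Improvement I

      private
        arc : Arc G δ (current x) k w v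
        arc = slot⇒arc G δ (current x) answered

        0≤w : 0# ≤ w
        0≤w = <⇒≤ (arc-positive G δ arc)

        current-closed : status x (current x) ≡ closed
        current-closed = busy pending

        target : dist x′ v ≤⁺ dist x (current x) +⁺ [ w ]
        -- A closed `v` is not updated, but by `below` it is no farther than the current vertex, and
        -- the weight is positive.
        target = dist-target I (λ c → ≤⁺-trans (below v c) (x≤⁺x+w _ 0≤w))

        current-dist : dist x′ (current x′) ≡ dist x (current x)
        current-dist = trans (cong (dist x′) current≡) (proj₂ (closed-after I current-closed))

        finite : ∃ λ d → dist x (current x) ≡ [ d ]
        finite = reached (current x) (λ u → case trans (sym current-closed) u of λ ())

      improvement-sound : Sound δ r (tick x′)
      improvement-sound = record
        { root    = ≤⁺-trans (dist-decreases I r) root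
        ; routed  = routed′
        ; reached = reached′
        ; unseen  = unseen′
        ; below   = λ u c → let c′ = closed-before I c in
            subst₂ _≤⁺_ (sym (proj₂ (closed-after I c′))) (sym current-dist) (below u c′)
        ; above   = λ u ¬c → subst (_≤⁺ dist x′ u) (sym current-dist) (above′ u ¬c)
        ; settled = settled′
        ; busy    = λ _ → trans (cong (status x′) current≡) (proj₁ (closed-after I current-closed))
        ; size    = λ _ → trans total≡ (trans (size current-closed) (cong (degreeAt G δ) (sym current≡)))
        }
        where
        routed′ : ∀ u {d} → dist x′ u ≡ [ d ] → Connects δ r (route x′ u) d u
        routed′ u eq with change u
        ... | unchanged _ _ deq req rewrite req = routed u (trans (sym deq) eq)
        ... | opened _ _ _ _ deq req rewrite req = routed u (trans (sym deq) eq)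
        ... | improved refl _ _ _ deq req rewrite req with (d₀ , d₀≡ , refl) ← +⁺-finite (dist x (current x))
            (trans (sym deq) eq) =
          connects-extend δ (routed (current x) d₀≡) arc
        reached′ : ∀ u → status x′ u ≢ unvisited → ∃ λ d → dist x′ u ≡ [ d ]
        reached′ u seen with change u
        ... | unchanged _ seq deq _ = let (d , d≡) = reached u (λ p → seen (trans seq p)) in d , trans deq d≡
        ... | opened refl _ _ _ deq _ = let (d , d≡ , _) = ≤⁺-finite (≤⁺-trans target (≤⁺-reflexive (cong (_+⁺ [ w ]) (proj₂ finite)))) in d , d≡
        ... | improved _ _ _ _ deq _ = _ , trans deq (cong (_+⁺ [ w ]) (proj₂ finite))
        unseen′ : ∀ u → status x′ u ≡ unvisited → dist x′ u ≡ ⊤⁺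
        unseen′ u p with change u
        ... | unchanged _ seq deq _   = trans deq (unseen u (trans (sym seq) p))
        ... | opened _ _ seq _ _ _    = case trans (sym seq) p of λ ()
        ... | improved _ _ seq _ _ _  = case trans (sym seq) p of λ ()
        above′ : ∀ u → status x′ u ≢ closed → dist x (current x) ≤⁺ dist x′ u
        above′ u ¬c with change u
        ... | unchanged _ seq deq _     = subst (_ ≤⁺_) (sym deq) (above u (λ c → ¬c (trans seq c)))
        ... | opened _ ¬c′ _ _ deq _    = subst (_ ≤⁺_) (sym deq) (above u ¬c′)
        ... | improved _ _ _ _ deq _    = subst (_ ≤⁺_) (sym deq) (x≤⁺x+w _ 0≤w)
        settled′ : ∀ u {j k w v} → status x′ u ≡ closed → slot G δ u j ≡ just (k , w , v) →
                   (u ≡ current x′ → j ℕ.< suc (relaxed x′)) → dist x′ v ≤⁺ dist x′ u +⁺ [ w ]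
        settled′ u {j} {w = w′} {v′} c eq j< with closed-before I c
        ... | c′ rewrite proj₂ (closed-after I c′) with u Fin.≟ current x | j ℕ.≟ relaxed x
        ...   | yes refl | yes refl with refl ← trans (sym eq) answered = target
        ...   | no u≢    | _        = ≤⁺-trans (dist-decreases I v′) (settled u c′ eq (λ u≡ → contradiction u≡ u≢))
        ...   | yes refl | no j≢    = ≤⁺-trans (dist-decreases I v′) (settled u c′ eq λ _ →
          ℕ.≤∧≢⇒< (subst (j ℕ.≤_) relaxed≡ (ℕ.s≤s⁻¹ (j< (sym current≡)))) j≢)

    module _ {δ r x} (sound : Sound δ r x) (idle : ¬ Pending x) where
      open Sound sound

      settled-idle : ∀ {u k w v} → status x u ≡ closed → Arc G δ u k w v → dist x v ≤⁺ dist x u +⁺ [ w ]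
      settled-idle {u} c a with (j , j<d , eq) ← arc⇒slot G δ u a =
        settled u c eq λ { refl → ℕ.<-≤-trans j<d (subst (ℕ._≤ relaxed x) (size c) (ℕ.≮⇒≥ idle)) }

      -- A vertex with finite distance has been visited and, nothing being open, is closed; so every
      -- arc along the trail has been relaxed.
      exhausted : ¬ ∃ (Open x) → ∀ {u ks ℓ v p} → Trail G δ u ks ℓ v → dist x u ≤⁺ [ p ] → dist x v ≤⁺ [ p + ℓ ]
      exhausted none {p = p} [] u≤p = subst (λ ℓ → dist x _ ≤⁺ [ ℓ ]) (sym (+-identityʳ p)) u≤p
      exhausted none {u} {p = p} (_∷_ {w = w} {ℓ = ℓ} a T) u≤p with status x u in eq
      ... | unvisited = case subst (_≤⁺ [ p ]) (unseen u eq) u≤p of λ ()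
      ... | isOpen    = contradiction (u , eq) none
      ... | closed    = subst (λ ℓ → dist x _ ≤⁺ [ ℓ ]) (+-assoc p w ℓ)
        (exhausted none T (≤⁺-trans (settled-idle eq a) (+⁺-mono-≤⁺ u≤p ≤⁺-refl)))

      module _ {u} (u-open : Open x u) (u-min : ∀ v → Open x v → dist x u ≤⁺ dist x v) where

        nearest : ∀ v → status x v ≢ closed → dist x u ≤⁺ dist x v
        nearest v ¬c with status x v in eq
        ... | unvisited = subst (dist x u ≤⁺_) (sym (unseen v eq)) (_ ≤⊤⁺)
        ... | isOpen    = u-min v eq
        ... | closed    = contradiction refl ¬c

        private
          x′ : Execution n
          x′ = record x { status = updateAt (status x) u (const closed) ; current = u ; relaxed = 0 ; total =
              degreeAt G δ u }

          u-closed : status x′ u ≡ closed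
          u-closed = updateAt-updates u (status x)

          status-other : ∀ {v} → v ≢ u → status x′ v ≡ status x v
          status-other {v} v≢u = updateAt-minimal v u (status x) v≢u

        -- The closed vertices are no farther than the old current vertex, and that one is no
        -- farther than `u`, which was not closed. The old current vertex has all its slots relaxed,
        -- as the execution is idle, and `u` has none.
        closing-sound : Sound δ r x′
        closing-sound = record
          { root    = root
          ; routed  = routed
          ; reached = reached′
          ; unseen  = unseen′
          ; below   = below′
          ; above   = above′
          ; settled = settled′
          ; busy    = λ _ → u-closed
          ; size    = λ _ → refl
          }
          where
          reached′ : ∀ v → status x′ v ≢ unvisited → ∃ λ d → dist x v ≡ [ d ]
          reached′ v seen with v Fin.≟ u
          ... | yes refl = reached v (λ p → case trans (sym u-open) p of λ ())
          ... | no v≢u   = reached v (λ p → seen (trans (status-other v≢u) p))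
          unseen′ : ∀ v → status x′ v ≡ unvisited → dist x v ≡ ⊤⁺
          unseen′ v p with v Fin.≟ u
          ... | yes refl = case trans (sym u-closed) p of λ ()
          ... | no v≢u   = unseen v (trans (sym (status-other v≢u)) p)
          below′ : ∀ v → status x′ v ≡ closed → dist x v ≤⁺ dist x u
          below′ v p with v Fin.≟ u
          ... | yes refl = ≤⁺-refl
          ... | no v≢u   = ≤⁺-trans (below v (trans (sym (status-other v≢u)) p))
              (above u (λ q → case trans (sym u-open) q of λ ()))
          above′ : ∀ v → status x′ v ≢ closed → dist x u ≤⁺ dist x v
          above′ v ¬c with v Fin.≟ u
          ... | yes refl = ≤⁺-refl
          ... | no v≢u   = nearest v (λ p → ¬c (trans (status-other v≢u) p))
          settled′ : ∀ y {j k w v} → status x′ y ≡ closed → slot G δ y j ≡ just (k , w , v) →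
                     (y ≡ u → j ℕ.< 0) → dist x v ≤⁺ dist x y +⁺ [ w ]
          settled′ y c eq j< with y Fin.≟ u
          ... | yes refl = case j< refl of λ ()
          ... | no y≢u   = settled-idle (trans (sym (status-other y≢u)) c) (slot⇒arc G δ y eq)

    -- Walking back from the root, distances below that of the current vertex
    -- occur only at closed vertices, whose edges are all relaxed.
    near : ∀ {δ r x} → Sound (opposite δ) r x → ∀ {u ks ℓ} → Trail G δ u ks ℓ r →
           [ ℓ ] ≤⁺ dist x (current x) → dist x u ≤⁺ [ ℓ ]
    near sound [] _ = Sound.root sound
    near {δ} {r} {x} sound {u} (_∷_ {w = w} {v = v} {ℓ = ℓ} a T) ≤cur = goal
      where
      open Sound sound
      ℓ<cur : [ ℓ ] <⁺ dist x (current x)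
      ℓ<cur = <⁺-≤⁺-trans [ x<y+x ℓ (arc-positive G δ a) ] ≤cur
      v≤ℓ : dist x v ≤⁺ [ ℓ ]
      v≤ℓ = near sound T (<⁺⇒≤⁺ ℓ<cur)
      v<cur : dist x v <⁺ dist x (current x)
      v<cur = ≤⁺-<⁺-trans v≤ℓ ℓ<cur
      v-closed : status x v ≡ closed
      v-closed with status x v in eq
      ... | closed    = refl
      ... | unvisited = contradiction (<⁺-≤⁺-trans v<cur (above v (λ p → case trans (sym eq) p of λ ()))) <⁺-irrefl
      ... | isOpen    = contradiction (<⁺-≤⁺-trans v<cur (above v (λ p → case trans (sym eq) p of λ ()))) <⁺-irrefl
      goal : dist x u ≤⁺ [ w + ℓ ]
      -- The execution may be in the midst of relaxing the arcs of its current vertex; `v` is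
      -- strictly nearer, hence a different vertex.
      goal with (j , _ , eq) ← arc⇒slot G (opposite δ) v (arc-flip G δ a) =
        ≤⁺-trans (settled v v-closed eq λ { refl → contradiction v<cur <⁺-irrefl })
          (≤⁺-trans (+⁺-mono-≤⁺ v≤ℓ ≤⁺-refl) (≤⁺-reflexive (cong [_] (+-comm ℓ w))))

    opening-sound : ∀ δ r → Sound δ r (open-at r)
    opening-sound δ r = record
      { root    = ≤⁺-reflexive dist-root
      ; routed  = routed
      ; reached = reached
      ; unseen  = λ v p → dist-other v (λ { refl → case trans (sym status-root) p of λ () })
      ; below   = λ v c → contradiction c (not-closed v)
      ; above   = above
      ; settled = λ u c → contradiction c (not-closed u)
      ; busy    = λ ()
      ; size    = λ c → contradiction c (not-closed r)
      }
      where
      x : Execution n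
      x = open-at r
      dist-root : dist x r ≡ [ 0# ]
      dist-root = updateAt-updates r (const ⊤⁺)
      dist-other : ∀ v → v ≢ r → dist x v ≡ ⊤⁺
      dist-other v v≢r = updateAt-minimal v r (const ⊤⁺) v≢r
      status-root : status x r ≡ isOpen
      status-root = updateAt-updates r (const unvisited)
      status-other : ∀ v → v ≢ r → status x v ≡ unvisited
      status-other v v≢r = updateAt-minimal v r (const unvisited) v≢r
      not-closed : ∀ v → status x v ≢ closed
      not-closed v c with v Fin.≟ r
      ... | yes refl = case trans (sym status-root) c of λ ()
      ... | no v≢r   = case trans (sym (status-other v v≢r)) c of λ ()
      routed : ∀ v {d} → dist x v ≡ [ d ] → Connects δ r [] d v
      routed v eq with v Fin.≟ r
      ... | yes refl with refl ← trans (sym dist-root) eq = connects-root δ r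
      ... | no v≢r   = case trans (sym (dist-other v v≢r)) eq of λ ()
      reached : ∀ v → status x v ≢ unvisited → ∃ λ d → dist x v ≡ [ d ]
      reached v seen with v Fin.≟ r
      ... | yes refl = 0# , dist-root
      ... | no v≢r   = contradiction (status-other v v≢r) seen
      above : ∀ v → status x v ≢ closed → dist x r ≤⁺ dist x v
      above v _ with v Fin.≟ r
      ... | yes refl = ≤⁺-refl
      ... | no v≢r   = subst (dist x r ≤⁺_) (sym (dist-other v v≢r)) (_ ≤⊤⁺)

-- Joint invariants of the two executions.

module Configurations (ℝ : Reals) where
  open Reals ℝ
  open Model ℝ
  open OrderedField ℝ
  open Extended ℝ
  open Links ℝ
  open Trails ℝ
  open Executions ℝ
  open Execution
  open Configuration

  module _ {κ n} (G : Graph κ n) where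

    -- mid is kept in the orientation from s to t, whence the use of orient.
    data Meeting (c : Configuration n) : Set where
      unmet : mid c ≡ nothing → μ c ≡ ⊤⁺ → Meeting c
      met   : ∀ {u k w v a b} → mid c ≡ just (orient (turn c) u k v) → Arc G (turn c) u k w v →
              dist (active c) u ≡ [ a ] → dist (passive c) v ≡ [ b ] → [ a + (w + b) ] ≤⁺ μ c → Meeting c

    -- `apart` is the condition under which all pairs of explored edges can be rewired; quantifying
    -- over the connecting trails avoids naming d(s,t), which may be infinite. `meeting` keeps only
    -- an inequality with `μ`, since a tentative distance at an end of `mid` may still decrease.
    record Invariant (rₐ rₚ : Fin n) (c : Configuration n) : Set where
      field
        soundₐ  : Sound G (turn c) rₐ (active c)
        soundₚ  : Sound G (opposite (turn c)) rₚ (passive c)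
        μ-≤     : ∀ v → μ c ≤⁺ dist (active c) v +⁺ dist (passive c) v
        meeting : Meeting c
        apart   : ∀ {u v ks ℓ} → status (active c) u ≡ closed → status (passive c) v ≡ closed →
                  Connects G (turn c) rₐ ks ℓ rₚ → dist (active c) u +⁺ dist (passive c) v <⁺ [ ℓ ]

    Optimal : Fin n → Fin n → Configuration n → Set
    Optimal rₐ rₚ c = ∀ {ks ℓ} → Connects G (turn c) rₐ ks ℓ rₚ → μ c ≤⁺ [ ℓ ]

    private
      opposite-involutive : ∀ δ → opposite (opposite δ) ≡ δ
      opposite-involutive forward  = refl
      opposite-involutive backward = refl

      orient-flip : ∀ δ (u : Fin n) k v → orient δ u k v ≡ orient (opposite δ) v k u
      orient-flip forward  u k v = refl
      orient-flip backward u k v = refl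

      connects-flip′ : ∀ δ {u ks ℓ v} → Connects G (opposite δ) u ks ℓ v → Connects G δ v ks ℓ u
      connects-flip′ forward  T = T
      connects-flip′ backward T = T

    module _ {rₐ rₚ c} (inv : Invariant rₐ rₚ c) where
      open Invariant inv

      -- The distance of the exhausted execution at the opposite root is at most the length of any
      -- connecting trail, so `μ-≤` is applied at that root.
      exhaustedₐ : ¬ Pending (active c) → ¬ ∃ (Open (active c)) → Optimal rₐ rₚ c
      exhaustedₐ idle none T = ≤⁺-trans (μ-≤ rₚ) (≤⁺-trans
        (+⁺-mono-≤⁺ (exhausted G soundₐ idle none (proj₂ (connects⇒trail G (turn c) T)) (Sound.root soundₐ))
            (Sound.root soundₚ))
        (≤⁺-reflexive (cong [_] (trans (+-identityʳ _) (+-identityˡ _)))))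

      exhaustedₚ : ¬ Pending (passive c) → ¬ ∃ (Open (passive c)) → Optimal rₐ rₚ c
      exhaustedₚ idle none T = ≤⁺-trans (μ-≤ rₐ) (≤⁺-trans
        (+⁺-mono-≤⁺ (Sound.root soundₐ) (exhausted G soundₚ idle none
          (proj₂ (connects⇒trail G (opposite (turn c)) (connects-flip G (turn c) T))) (Sound.root soundₚ)))
        (≤⁺-reflexive (cong [_] (trans (+-identityˡ _) (+-identityˡ _)))))

      module _ (idle : ¬ Pending (active c)) {u} (u-open : Open (active c) u)
               (u-min : ∀ v → Open (active c) v → dist (active c) u ≤⁺ dist (active c) v) where

        private
          horizon : Carrier ⁺
          horizon = dist (active c) u +⁺ dist (passive c) (current (passive c))

          -- The first vertex of the trail not closed by the active execution
          -- has been reached by the passive one.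
          bridge : ∀ {v ks ℓ p} → Trail G (turn c) v ks ℓ rₚ → dist (active c) v ≤⁺ [ p ] → [ p + ℓ ] ≤⁺ horizon →
              μ c ≤⁺ [ p + ℓ ]
          bridge-open : ∀ {v ks ℓ p} → status (active c) v ≢ closed → Trail G (turn c) v ks ℓ rₚ →
              dist (active c) v ≤⁺ [ p ] →
                        [ p + ℓ ] ≤⁺ horizon → μ c ≤⁺ [ p + ℓ ]
          bridge [] v≤p _ = ≤⁺-trans (μ-≤ rₚ) (+⁺-mono-≤⁺ v≤p (Sound.root soundₚ))
          bridge {v} {p = p} (_∷_ {w = w} {ℓ = ℓ} a T) v≤p ≤h with status (active c) v in eq
          ... | unvisited = bridge-open (λ q → case trans (sym eq) q of λ ()) (a ∷ T) v≤p ≤h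
          ... | isOpen    = bridge-open (λ q → case trans (sym eq) q of λ ()) (a ∷ T) v≤p ≤h
          ... | closed    = subst (λ ℓ → μ c ≤⁺ [ ℓ ]) (+-assoc p w ℓ)
            (bridge T (≤⁺-trans (settled-idle G soundₐ idle eq a) (+⁺-mono-≤⁺ v≤p ≤⁺-refl))
              (subst (λ ℓ → [ ℓ ] ≤⁺ horizon) (sym (+-assoc p w ℓ)) ≤h))
          bridge-open {v} {ℓ = ℓ} {p} ¬c T v≤p ≤h =
            ≤⁺-trans (μ-≤ v)
                (+⁺-mono-≤⁺ v≤p (near G soundₚ T (rest (≤⁺-trans (nearest G soundₐ idle u-open u-min v ¬c) v≤p) ≤h)))
            where
            -- No unclosed vertex is nearer than `u`, so `dist (active c) u` is at most `p`; the
            -- length left from `v` is then at most the distance of the passive current vertex, as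
            -- `near` demands.
            rest : ∀ {A B : Carrier ⁺} → A ≤⁺ [ p ] → [ p + ℓ ] ≤⁺ A +⁺ B → [ ℓ ] ≤⁺ B
            rest {B = ⊤⁺}    _       _         = _ ≤⊤⁺
            rest {B = [ b ]} [ a≤p ] [ p+ℓ≤ ] = [ +-cancelˡ-≤ p (≤-trans p+ℓ≤ (+-monoˡ-≤ b a≤p)) ]

        horizon-optimal : ∀ {ks ℓ} → Connects G (turn c) rₐ ks ℓ rₚ → [ ℓ ] ≤⁺ horizon → μ c ≤⁺ [ ℓ ]
        horizon-optimal T ℓ≤h = subst (λ ℓ → μ c ≤⁺ [ ℓ ]) (+-identityˡ _)
          (bridge (proj₂ (connects⇒trail G (turn c) T)) (Sound.root soundₐ) (subst (λ ℓ → [ ℓ ] ≤⁺ horizon)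
              (sym (+-identityˡ _)) ℓ≤h))

        -- Trails within the horizon are covered by `horizon-optimal`; a longer one exceeds `μ` by
        -- the stopping test.
        stopping-optimal : μ c ≤⁺ horizon → Optimal rₐ rₚ c
        stopping-optimal μ≤h {ℓ = ℓ} T with [ ℓ ] ≤⁺? horizon
        ... | yes ℓ≤h = horizon-optimal T ℓ≤h
        ... | no ℓ≰h  = ≤⁺-trans μ≤h (<⁺⇒≤⁺ (≰⁺⇒>⁺ ℓ≰h))

        processing-invariant : ¬ μ c ≤⁺ horizon → Invariant rₐ rₚ (scan (close c u) (degreeAt G (turn c) u))
        processing-invariant μ≰h = record
          { soundₐ  = closing-sound G soundₐ idle u-open u-min
          ; soundₚ  = soundₚ
          ; μ-≤     = μ-≤
          ; meeting = meeting′ meeting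
          ; apart   = apart′
          }
          where
          meeting′ : Meeting c → Meeting (scan (close c u) (degreeAt G (turn c) u))
          meeting′ (unmet m≡ μ≡)       = unmet m≡ μ≡
          meeting′ (met m≡ a d≡ d′≡ ≤μ) = met m≡ a d≡ d′≡ ≤μ
          apart′ : ∀ {x v ks ℓ} → updateAt (status (active c)) u (const closed) x ≡ closed →
              status (passive c) v ≡ closed →
                   Connects G (turn c) rₐ ks ℓ rₚ → dist (active c) x +⁺ dist (passive c) v <⁺ [ ℓ ]
          apart′ {x} {v} p q T with x Fin.≟ u
          ... | no x≢u   = apart (trans (sym (updateAt-minimal x u (status (active c)) x≢u)) p) q T
          -- By `below` the passive current vertex is the worst case, and a connecting trail within
          -- the horizon would force `μ` below the horizon, against the failed test.
          ... | yes refl = ≤⁺-<⁺-trans (+⁺-mono-≤⁺ ≤⁺-refl (Sound.below soundₚ v q))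
            (≰⁺⇒>⁺ λ ℓ≤h → μ≰h (≤⁺-trans (horizon-optimal T ℓ≤h) ℓ≤h))

      module _ (pending : Pending (active c)) {k w v}
               (answered : slot G (turn c) (current (active c)) (relaxed (active c)) ≡ just (k , w , v)) where
        private
          x x′ y : Execution n
          x = active c
          y = passive c
          d : Carrier ⁺
          d = dist x (current x) +⁺ [ w ]
          x′ = improve (turn c) x k v d
          I : Improvement G (turn c) x k v d x′
          I = improvement G (turn c) x k v d
          arc : Arc G (turn c) (current x) k w v
          arc = slot⇒arc G (turn c) (current x) answered
          c₁ : Configuration n
          c₁ = record c { active = x′ }

          apart₁ : ∀ {u z ks ℓ} → status x′ u ≡ closed → status y z ≡ closed →
                   Connects G (turn c) rₐ ks ℓ rₚ → dist x′ u +⁺ dist y z <⁺ [ ℓ ]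
          apart₁ {z = z} {ℓ = ℓ} p q T = let p′ = closed-before G I p in
            subst (λ a → a +⁺ dist y z <⁺ [ ℓ ]) (sym (proj₂ (closed-after G I p′))) (apart p′ q T)

          current-finite : ∃ λ a → dist x (current x) ≡ [ a ]
          current-finite = Sound.reached soundₐ (current x) λ p → case trans (sym (Sound.busy soundₐ pending)) p of
              λ ()

          meeting₁ : Meeting c₁
          meeting₁ with meeting
          ... | unmet m≡ μ≡ = unmet m≡ μ≡
          ... | met {u} {w = w} {b = b} m≡ a d≡ d′≡ ≤μ with (a′ , a′≡ , a′≤) ← ≤⁺-finite
              (≤⁺-trans (dist-decreases G I u) (≤⁺-reflexive d≡)) =
            met m≡ a a′≡ d′≡ (≤⁺-trans [ +-monoˡ-≤ (w + b) a′≤ ] ≤μ)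

          -- Relaxing can lower the sum of the two distances at `v` only, and there to
          -- `d +⁺ dist y v`, the very value that is compared with `μ`. This lemma serves the case
          -- that `μ` stays, and `μ-≤-new` the case that it takes that value.
          μ-≤-other : ∀ u → (u ≢ v ⊎ μ c ≤⁺ d +⁺ dist y v) → μ c ≤⁺ dist x′ u +⁺ dist y u
          μ-≤-other u case₁ with Improvement.change I u
          ... | unchanged _ _ deq _ = subst (λ a → μ c ≤⁺ a +⁺ dist y u) (sym deq) (μ-≤ u)
          ... | opened _ _ _ _ deq _ = subst (λ a → μ c ≤⁺ a +⁺ dist y u) (sym deq) (μ-≤ u)
          ... | improved refl _ _ _ deq _ with case₁
          ...   | inj₁ u≢v = contradiction refl u≢v
          ...   | inj₂ ≤d  = subst (λ a → μ c ≤⁺ a +⁺ dist y u) (sym deq) ≤d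

          μ-≤-new : ∀ u → d +⁺ dist y v <⁺ μ c → d +⁺ dist y v ≤⁺ dist x′ u +⁺ dist y u
          μ-≤-new u d<μ with Improvement.change I u
          ... | unchanged _ _ deq _ = subst (λ a → _ ≤⁺ a +⁺ dist y u) (sym deq) (≤⁺-trans (<⁺⇒≤⁺ d<μ) (μ-≤ u))
          ... | opened _ _ _ _ deq _ = subst (λ a → _ ≤⁺ a +⁺ dist y u) (sym deq) (≤⁺-trans (<⁺⇒≤⁺ d<μ) (μ-≤ u))
          ... | improved refl _ _ _ deq _ = subst (λ a → _ ≤⁺ a +⁺ dist y u) (sym deq) ≤⁺-refl

          pass-meeting : ∀ {c} → Meeting c → Meeting (pass c)
          pass-meeting (unmet m≡ μ≡) = unmet m≡ μ≡
          pass-meeting {c} (met {u} {k} {w} {v} {a} {b} m≡ arc d≡ d′≡ ≤μ) =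
            met (trans m≡ (cong just (orient-flip (turn c) u k v))) (arc-flip G (turn c) arc) d′≡ d≡
              (subst (λ ℓ → [ ℓ ] ≤⁺ μ c) (solve 3 (λ a w b → a :+ (w :+ b) := b :+ (w :+ a)) refl a w b) ≤μ)

          pass-invariant : ∀ {c′} → turn c′ ≡ turn c → active c′ ≡ x′ → passive c′ ≡ y →
                           (∀ u → μ c′ ≤⁺ dist x′ u +⁺ dist y u) → Meeting c′ → Invariant rₚ rₐ (pass c′)
          pass-invariant {c′} refl refl refl μ-≤′ m = record
            { soundₐ  = soundₚ
            ; soundₚ  = subst (λ δ → Sound G δ rₐ (tick G x′)) (sym (opposite-involutive (turn c)))
                (improvement-sound G soundₐ pending answered I)
            ; μ-≤     = λ u → subst (μ c′ ≤⁺_) (+⁺-comm (dist x′ u) (dist y u)) (μ-≤′ u)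
            ; meeting = pass-meeting m
            ; apart   = λ {u} {z} {ℓ = ℓ} p q T → subst (_<⁺ [ ℓ ]) (+⁺-comm (dist x′ z) (dist y u))
                (apart₁ q p (connects-flip′ (turn c) T))
            }

        relaxing-invariant : Invariant rₚ rₐ (relax c (just (k , w , v)))
        relaxing-invariant with (d +⁺ dist y v) <⁺? μ c
        ... | no d≮μ  = pass-invariant refl refl refl (λ u → μ-≤-other u (inj₂ (≮⁺⇒≥⁺ d≮μ))) meeting₁
        ... | yes d<μ = pass-invariant refl refl refl (λ u → μ-≤-new u d<μ)
          (let (a , a≡) = current-finite ; (b , b≡) = +⁺-finiteʳ d d<μ in
           met refl arc (trans (proj₂ (closed-after G I (Sound.busy soundₐ pending))) a≡) b≡
             (≤⁺-reflexive (trans (cong [_] (sym (+-assoc a w b))) (sym (cong₂ _+⁺_ (cong (_+⁺ [ w ]) a≡) b≡)))))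

        relax-shape : active (relax c (just (k , w , v))) ≡ y × passive (relax c (just (k , w , v))) ≡ tick G x′
        relax-shape with (d +⁺ dist y v) <⁺? μ c
        ... | no _  = refl , refl
        ... | yes _ = refl , refl

    initial-invariant : ∀ {s t} → s ≢ t → Invariant s t (initial s t)
    initial-invariant {s} {t} s≢t = record
      { soundₐ  = opening-sound G forward s
      ; soundₚ  = opening-sound G backward t
      ; μ-≤     = λ v → ≤⁺-reflexive (sym (infinite v))
      ; meeting = unmet refl refl
      ; apart   = λ {u} p _ _ → contradiction p (not-closed u)
      }
      where
      not-closed : ∀ u → updateAt (const unvisited) s (const isOpen) u ≢ closed
      not-closed u c with u Fin.≟ s
      ... | yes refl = case trans (sym (updateAt-updates s (const unvisited))) c of λ ()
      ... | no u≢s   = case trans (sym (updateAt-minimal u s (const unvisited) u≢s)) c of λ ()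
      -- As `s` and `t` differ, at least one of the two distances of a vertex is infinite.
      infinite : ∀ v → dist (open-at s) v +⁺ dist (open-at t) v ≡ ⊤⁺
      infinite v with v Fin.≟ s
      ... | no v≢s   = cong (_+⁺ dist (open-at t) v) (updateAt-minimal v s (const ⊤⁺) v≢s)
      ... | yes refl = trans (cong (dist (open-at s) v +⁺_) (updateAt-minimal v t (const ⊤⁺) s≢t))
          (trans (+⁺-comm (dist (open-at s) v) ⊤⁺) refl)

-- Counting with natural numbers.

module Counting where
  open Data.Nat.Solver.+-*-Solver

  total-of : ∀ {n} → (Fin n → ℕ) → ℕ
  total-of {zero}  f = 0
  total-of {suc n} f = f zero ℕ.+ total-of (f ∘ suc)

  -- The old weight is added on the left, as subtraction of natural numbers would truncate.
  total-of-update : ∀ {A : Set} (f : A → ℕ) {n} (s : Fin n → A) u a →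
    total-of (f ∘ updateAt s u (const a)) ℕ.+ f (s u) ≡ total-of (f ∘ s) ℕ.+ f a
  total-of-update f s zero a = solve 3 (λ x y z → (x :+ y) :+ z := (z :+ y) :+ x) refl (f a)
      (total-of (f ∘ s ∘ suc)) (f (s zero))
  total-of-update f s (suc u) a = trans (ℕ.+-assoc (f (s zero)) _ _)
      (trans (cong (f (s zero) ℕ.+_) (total-of-update f (s ∘ suc) u a))
    (sym (ℕ.+-assoc (f (s zero)) _ _)))

  -- The executions are exchanged after an edge query of the first one.
  asked-exchange : ∀ q q′ l l′ → suc ((q ℕ.+ l) ℕ.+ (q′ ℕ.+ l′)) ≡ (q′ ℕ.+ l′) ℕ.+ (q ℕ.+ suc l)
  asked-exchange = solve 4 (λ q q′ l l′ → con 1 :+ ((q :+ l) :+ (q′ :+ l′)) := (q′ :+ l′) :+ (q :+ (con 1 :+ l))) refl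

  -- The origin of the two 4s: there is at most one degree query more than relaxations in each
  -- execution, and the other execution is ahead by at most one relaxation. So the four counts are
  -- at most `l + 1`, `l`, `l + 2` and `l + 1`.
  asked-≤ : ∀ {q o q′ o′ l l′} → q ℕ.+ o ℕ.≤ suc l → q′ ℕ.+ o′ ℕ.≤ suc l′ → l′ ℕ.≤ suc l →
            (q ℕ.+ l) ℕ.+ (q′ ℕ.+ l′) ℕ.≤ 4 ℕ.+ 4 ℕ.* l
  asked-≤ {q} {o} {q′} {o′} {l} {l′} q≤ q′≤ l′≤ = ℕ.≤-trans
    (ℕ.+-mono-≤ (ℕ.+-monoˡ-≤ l (ℕ.m+n≤o⇒m≤o q q≤)) (ℕ.+-mono-≤ (ℕ.≤-trans (ℕ.m+n≤o⇒m≤o q′ q′≤) (s≤s l′≤)) l′≤))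
    (ℕ.≤-reflexive (solve 1 (λ l → ((con 1 :+ l) :+ l) :+ ((con 2 :+ l) :+ (con 1 :+ l)) := con 4 :+ con 4 :* l)
        refl l))

-- Runs of the algorithm: number of queries and termination.

module Runs (ℝ : Reals) where
  open Reals ℝ
  open Model ℝ
  open OrderedField ℝ
  open Extended ℝ
  open Links ℝ
  open Trails ℝ
  open Executions ℝ
  open Configurations ℝ
  open Counting
  open Execution
  open Configuration

  open-weight unclosed-weight : Status → ℕ
  open-weight isOpen = 1
  open-weight _      = 0
  unclosed-weight closed = 0
  unclosed-weight _      = 1

  opens unclosed remaining : ∀ {n} → Execution n → ℕ
  opens x     = total-of (open-weight ∘ status x)
  unclosed x  = total-of (unclosed-weight ∘ status x)
  remaining x = total x ℕ.∸ relaxed x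

  private
    unclosed-weight-open : ∀ {s} → s ≢ closed → unclosed-weight s ≡ 1
    unclosed-weight-open {unvisited} _  = refl
    unclosed-weight-open {isOpen}    _  = refl
    unclosed-weight-open {closed}    ≢c = contradiction refl ≢c

    improve-status : ∀ {n} δ (x : Execution n) k v d → status (improve δ x k v d) ≡ status x ⊎
      (status x v ≢ closed × status (improve δ x k v d) ≡ updateAt (status x) v (const isOpen))
    improve-status δ x k v d with status x v in eq
    ... | closed    = inj₁ refl
    ... | unvisited with d <⁺? dist x v
    ...   | yes _ = inj₂ ((λ ()) , refl)
    ...   | no _  = inj₂ ((λ ()) , refl)
    improve-status δ x k v d | isOpen with d <⁺? dist x v
    ...   | yes _ = inj₂ ((λ ()) , refl)
    ...   | no _  = inj₂ ((λ ()) , refl)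

    improve-opens : ∀ {n} δ (x : Execution n) k v d → opens (improve δ x k v d) ℕ.≤ suc (opens x)
    improve-opens δ x k v d with improve-status δ x k v d
    ... | inj₁ eq       rewrite eq = ℕ.n≤1+n _
    ... | inj₂ (_ , eq) rewrite eq = ℕ.≤-trans (ℕ.m≤m+n _ _)
      (ℕ.≤-reflexive (trans (total-of-update open-weight (status x) v isOpen) (ℕ.+-comm _ 1)))

    improve-unclosed : ∀ {n} δ (x : Execution n) k v d → unclosed (improve δ x k v d) ≡ unclosed x
    improve-unclosed δ x k v d with improve-status δ x k v d
    ... | inj₁ eq        rewrite eq = refl
    ... | inj₂ (≢c , eq) rewrite eq = ℕ.+-cancelʳ-≡ 1 _ _
      (trans (cong (total-of (unclosed-weight ∘ updateAt (status x) v (const isOpen)) ℕ.+_)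
          (sym (unclosed-weight-open ≢c)))
        (total-of-update unclosed-weight (status x) v isOpen))

    relax-turn : ∀ {n} (c : Configuration n) a → turn (relax c a) ≡ opposite (turn c)
    relax-turn c nothing = refl
    relax-turn c (just (k , w , v))
      with does (((dist (active c) (current (active c)) +⁺ [ w ]) +⁺ dist (passive c) v) <⁺? μ c)
    ... | true  = refl
    ... | false = refl

  module _ {κ n} (G : Graph κ n) where

    -- The ghost state of an execution: L lists the slots relaxed so far and
    -- q counts the degree queries.
    record Tally (δ : Direction) (x : Execution n) (L : List (Fin n × ℕ)) (q : ℕ) : Set where
      field
        slots  : ∀ {u j} → (u , j) ∈ L → status x u ≡ closed × j ℕ.< degreeAt G δ u × (u ≡ current x →
            j ℕ.< relaxed x)
        unique : Unique L
        budget : q ℕ.+ opens x ℕ.≤ suc (length L)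

    private
      opening-tally : ∀ δ r → Tally δ (open-at r) [] 0
      opening-tally δ r = record
        { slots  = λ ()
        ; unique = []
        ; budget = ℕ.≤-trans (ℕ.m≤m+n _ _) (ℕ.≤-reflexive
            (trans (total-of-update open-weight {n} (const unvisited) r isOpen) (cong (ℕ._+ 1) (none n))))
        }
        where
        none : ∀ n → total-of {n} (open-weight ∘ const unvisited) ≡ 0
        none zero    = refl
        none (suc n) = none n

      -- A newly opened vertex is paid for by the new slot of `L`. This slot is indeed new, since at
      -- the current vertex `L` has only positions below `relaxed x`.
      relaxing-tally : ∀ {δ r x L q k v w} → Sound G δ r x → Pending x → Tally δ x L q →
        Tally δ (tick G (improve δ x k v (dist x (current x) +⁺ [ w ]))) ((current x , relaxed x) ∷ L) q
      relaxing-tally {δ} {x = x} {L} {q} {k} {v} {w} sound pending tally = record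
        { slots  = slots′
        ; unique = ¬Any⇒All¬ L (λ ∈L → ℕ.<-irrefl refl (proj₂ (proj₂ (slots ∈L)) refl)) ∷ unique
        ; budget = ℕ.≤-trans (ℕ.+-monoʳ-≤ q (improve-opens δ x k v d)) (subst (ℕ._≤ suc (suc (length L)))
            (sym (ℕ.+-suc q _)) (s≤s budget))
        }
        where
        open Tally tally
        d : Carrier ⁺
        d = dist x (current x) +⁺ [ w ]
        x′ : Execution n
        x′ = improve δ x k v d
        I : Improvement G δ x k v d x′
        I = improvement G δ x k v d
        open Improvement I
        current-closed : status x (current x) ≡ closed
        current-closed = Sound.busy sound pending
        slots′ : ∀ {u j} → (u , j) ∈ ((current x , relaxed x) ∷ L) →
                 status x′ u ≡ closed × j ℕ.< degreeAt G δ u × (u ≡ current x′ → j ℕ.< suc (relaxed x′))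
        slots′ (here refl) = proj₁ (closed-after G I current-closed) ,
          subst (relaxed x ℕ.<_) (Sound.size sound current-closed) pending , λ _ → s≤s (ℕ.≤-reflexive (sym relaxed≡))
        slots′ (there ∈L) with (c , j< , j<r) ← slots ∈L = proj₁ (closed-after G I c) , j< ,
          λ u≡ → ℕ.m<n⇒m<1+n (subst (_ ℕ.<_) (sym relaxed≡) (j<r (trans u≡ current≡)))

      -- The degree query is paid for by the open vertex that disappears. The root, which no
      -- relaxation has opened, accounts for the 1 in `budget`.
      closing-tally : ∀ {δ x L q u d} → Open x u → Tally δ x L q →
        Tally δ (record x { status = updateAt (status x) u (const closed) ; current = u ; relaxed = 0 ; total = d })
            L (suc q)
      closing-tally {δ} {x} {L} {q} {u} u-open tally = record
        { slots  = slots′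
        ; unique = unique
        ; budget = ℕ.≤-trans (ℕ.≤-reflexive (trans (sym (ℕ.+-suc q _)) (cong (q ℕ.+_) fewer))) budget
        }
        where
        open Tally tally
        fewer : suc (total-of (open-weight ∘ updateAt (status x) u (const closed))) ≡ opens x
        fewer = trans (ℕ.+-comm 1 _)
            (trans (cong (λ s → total-of (open-weight ∘ updateAt (status x) u (const closed)) ℕ.+ open-weight s)
            (sym u-open))
          (trans (total-of-update open-weight (status x) u closed) (ℕ.+-identityʳ _)))
        slots′ : ∀ {v j} → (v , j) ∈ L → updateAt (status x) u (const closed) v ≡ closed × j ℕ.< degreeAt G δ v
            × (v ≡ u → j ℕ.< 0)
        slots′ {v} ∈L with slots ∈L | v Fin.≟ u
        ... | (c , j< , _) | yes refl = case trans (sym u-open) c of λ ()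
        ... | (c , j< , _) | no v≢u   = trans (updateAt-minimal v u (status x) v≢u) c , j< , λ v≡u →
            contradiction v≡u v≢u

      closing-unclosed : ∀ {x : Execution n} {u} → Open x u →
          suc (total-of (unclosed-weight ∘ updateAt (status x) u (const closed))) ≡ unclosed x
      closing-unclosed {x} {u} u-open = trans (ℕ.+-comm 1 _)
        (trans (cong (λ s → total-of (unclosed-weight ∘ updateAt (status x) u (const closed)) ℕ.+ unclosed-weight s)
            (sym u-open))
        (trans (total-of-update unclosed-weight (status x) u closed) (ℕ.+-identityʳ _)))

    Oriented : Fin n → Fin n → Direction → Fin n → Fin n → Set
    Oriented s t δ rₐ rₚ = (δ ≡ forward × rₐ ≡ s × rₚ ≡ t) ⊎ (δ ≡ backward × rₐ ≡ t × rₚ ≡ s)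

    -- The ghost state is indexed by active and passive, and trades places with the executions. By
    -- `behind` and `ahead`, which express the alternation, the passive execution has relaxed as
    -- many edges as the active one or one more.
    record Run (s t : Fin n) (c : Configuration n) (N : ℕ) : Set where
      field
        rₐ rₚ     : Fin n
        oriented  : Oriented s t (turn c) rₐ rₚ
        invariant : Invariant G rₐ rₚ c
        Lₐ Lₚ     : List (Fin n × ℕ)
        qₐ qₚ     : ℕ
        tallyₐ    : Tally (turn c) (active c) Lₐ qₐ
        tallyₚ    : Tally (opposite (turn c)) (passive c) Lₚ qₚ
        behind    : length Lₐ ℕ.≤ length Lₚ
        ahead     : length Lₚ ℕ.≤ suc (length Lₐ)
        asked     : N ≡ (qₐ ℕ.+ length Lₐ) ℕ.+ (qₚ ℕ.+ length Lₚ)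

    -- A lexicographic termination measure: closing a vertex lowers `height` and may raise `width`,
    -- while relaxing keeps `height` and lowers `width`.
    height width : Configuration n → ℕ
    height c = unclosed (active c) ℕ.+ unclosed (passive c)
    width  c = remaining (active c) ℕ.+ remaining (passive c)

    module _ {s t c N} (R : Run s t c N) where
      open Run R
      open Invariant invariant

      relaxing-run : Pending (active c) → let c′ = relax c (slot G (turn c) (current (active c)) (relaxed (active c))) in
                     Run s t c′ (suc N) × height c′ ≡ height c × width c′ ℕ.< width c
      relaxing-run pending
        with ((k , w , v) , eq) ← slot-< G (turn c) (current (active c))
               (subst (relaxed (active c) ℕ.<_) (Sound.size soundₐ (Sound.busy soundₐ pending)) pending)
        rewrite eq = record
          { rₐ = rₚ
          ; rₚ = rₐ
          ; oriented = subst (λ δ → Oriented s t δ rₚ rₐ) (sym turn≡) (flip-oriented (turn c) oriented)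
          ; invariant = relaxing-invariant G invariant pending eq
          ; Lₐ = Lₚ
          ; Lₚ = (current (active c) , relaxed (active c)) ∷ Lₐ
          ; qₐ = qₚ
          ; qₚ = qₐ
          ; tallyₐ = subst₂ (λ δ x → Tally δ x Lₚ qₚ) (sym turn≡) (sym active≡) tallyₚ
          ; tallyₚ = subst₂ (λ δ x → Tally δ x ((current (active c) , relaxed (active c)) ∷ Lₐ) qₐ)
              (sym (trans (cong opposite turn≡) (opposite-involutive (turn c)))) (sym passive≡)
                       (relaxing-tally soundₐ pending tallyₐ)
          ; behind = ahead
          ; ahead  = s≤s behind
          ; asked  = trans (cong suc asked) (asked-exchange qₐ qₚ (length Lₐ) (length Lₚ))
          }
        , trans (cong₂ ℕ._+_ (cong unclosed active≡) (trans (cong unclosed passive≡)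
            (improve-unclosed (turn c) (active c) k v _)))
            (ℕ.+-comm (unclosed (passive c)) _)
        , subst₂ ℕ._<_ (sym (cong₂ ℕ._+_ (cong remaining active≡) (cong remaining passive≡)))
            (ℕ.+-comm (remaining (passive c)) _)
            (ℕ.+-monoʳ-< (remaining (passive c)) shorter)
        where
        c′ : Configuration n
        c′ = relax c (just (k , w , v))
        I : Improvement G (turn c) (active c) k v _ _
        I = improvement G (turn c) (active c) k v (dist (active c) (current (active c)) +⁺ [ w ])
        active≡ : active c′ ≡ passive c
        active≡ = proj₁ (relax-shape G invariant pending eq)
        passive≡ : passive c′ ≡ tick G (improve (turn c) (active c) k v (dist (active c) (current (active c)) +⁺ [ w
            ]))
        passive≡ = proj₂ (relax-shape G invariant pending eq)
        turn≡ : turn c′ ≡ opposite (turn c)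
        turn≡ = relax-turn c (just (k , w , v))
        opposite-involutive : ∀ δ → opposite (opposite δ) ≡ δ
        opposite-involutive forward  = refl
        opposite-involutive backward = refl
        flip-oriented : ∀ δ → Oriented s t δ rₐ rₚ → Oriented s t (opposite δ) rₚ rₐ
        flip-oriented forward  (inj₁ (_ , p , q)) = inj₂ (refl , q , p)
        flip-oriented backward (inj₂ (_ , p , q)) = inj₁ (refl , q , p)
        shorter : remaining (tick G (improve (turn c) (active c) k v (dist (active c) (current (active c)) +⁺ [ w
            ]))) ℕ.< remaining (active c)
        shorter rewrite Improvement.relaxed≡ I | Improvement.total≡ I = ℕ.∸-monoʳ-< (ℕ.n<1+n (relaxed (active c)))
            pending

      module _ (idle : ¬ Pending (active c)) {u} (u-open : Open (active c) u)
               (u-min : ∀ v → Open (active c) v → dist (active c) u ≤⁺ dist (active c) v)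
               (μ≰ : ¬ μ c ≤⁺ (dist (active c) u +⁺ dist (passive c) (current (passive c)))) where

        processing-run : let c′ = scan (close c u) (degreeAt G (turn c) u) in Run s t c′ (suc N) × height c′ ℕ.< height c
        processing-run = record
          { rₐ = rₐ
          ; rₚ = rₚ
          ; oriented  = oriented
          ; invariant = processing-invariant G invariant idle u-open u-min μ≰
          ; Lₐ = Lₐ
          ; Lₚ = Lₚ
          ; qₐ = suc qₐ
          ; qₚ = qₚ
          ; tallyₐ = closing-tally u-open tallyₐ
          ; tallyₚ = tallyₚ
          ; behind = behind
          ; ahead  = ahead
          ; asked  = cong suc asked
          } , ℕ.+-monoˡ-< (unclosed (passive c)) (ℕ.≤-reflexive (closing-unclosed {active c} u-open))

    initial-run : ∀ {s t} → s ≢ t → Run s t (initial s t) 0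
    initial-run {s} {t} s≢t = record
      { rₐ = s
      ; rₚ = t
      ; oriented  = inj₁ (refl , refl , refl)
      ; invariant = initial-invariant G s≢t
      ; Lₐ = []
      ; Lₚ = []
      ; qₐ = 0
      ; qₚ = 0
      ; tallyₐ = opening-tally forward s
      ; tallyₚ = opening-tally backward t
      ; behind = z≤n
      ; ahead  = z≤n
      ; asked  = refl
      }

    module _ (select : Selection) where

      -- The outcomes of `advance` with the evidence from its tests, so that the nested tests are
      -- analysed only once.
      data View (c : Configuration n) : Action κ n (Configuration n) → Set where
        exhausted-passive : ¬ Pending (passive c) → ¬ ∃ (Open (passive c)) → View c (return (result c))
        exhausted-active  : ¬ Pending (active c) → ¬ ∃ (Open (active c)) → View c (return (result c))
        relaxing          : Pending (active c) →
                            View c (ask (edgeQuery κ (turn c) (current (active c)) (relaxed (active c))) (relax c))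
        stopping          : ∀ {u} → ¬ Pending (active c) → Open (active c) u →
                            (∀ v → Open (active c) v → dist (active c) u ≤⁺ dist (active c) v) →
                            μ c ≤⁺ (dist (active c) u +⁺ dist (passive c) (current (passive c))) →
                                View c (return (result c))
        processing        : ∀ {u} → ¬ Pending (active c) → Open (active c) u →
                            (∀ v → Open (active c) v → dist (active c) u ≤⁺ dist (active c) v) →
                            ¬ μ c ≤⁺ (dist (active c) u +⁺ dist (passive c) (current (passive c))) →
                            View c (ask (degreeQuery κ (turn c) u) (scan (close c u)))

      view-process : ∀ c {u} → ¬ Pending (active c) → Open (active c) u →
                     (∀ v → Open (active c) v → dist (active c) u ≤⁺ dist (active c) v) → View c (process c u)
      view-process c {u} idle u-open u-min with μ c ≤⁺? (dist (active c) u +⁺ dist (passive c) (current (passive c)))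
      ... | yes μ≤ = stopping idle u-open u-min μ≤
      ... | no μ≰  = processing idle u-open u-min μ≰

      view : ∀ c → View c (advance select {κ} c)
      view c with pending? (passive c) | open? (passive c)
      ... | no p | no o = exhausted-passive p o
      ... | yes _ | _ with pending? (active c) | open? (active c)
      ...   | yes p | _     = relaxing p
      ...   | no p  | no o  = exhausted-active p o
      ...   | no p  | yes o = let (_ , u-open , u-min) = select (active c) o in view-process c p u-open u-min
      view c | no _ | yes _ with pending? (active c) | open? (active c)
      ...   | yes p | _     = relaxing p
      ...   | no p  | no o  = exhausted-active p o
      ...   | no p  | yes o = let (_ , u-open , u-min) = select (active c) o in view-process c p u-open u-min

      -- The algorithm flips no coins, so its run on `G` is a single chain of queries, whose length
      -- is the expected number.
      data Halts (c : Configuration n) : ℕ → Configuration n → Set where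
        done : advance select {κ} c ≡ return (result c) → Halts c 0 c
        more : ∀ {f} {q : Query κ n f} {g j c′} → advance select {κ} c ≡ ask q g → Halts (g (answer G q)) j c′ →
            Halts c (suc j) c′

      module _ {s t : Fin n} where

        private
          B : Machine κ n
          B = bidirectionalDijkstra select n s t

        halts-queries-≤ : ∀ {c j c′} → Halts c j c′ → ∀ k → queries G B k c ≤ fromℕ j
        halts-queries-≤ {j = j} _ zero = fromℕ-nonneg j
        halts-queries-≤ (done eq)   (suc k) = subst (λ a → queriesFrom G B k a ≤ 0#) (sym eq) ≤-refl
        halts-queries-≤ {j = suc j} (more eq h) (suc k) =
          subst (λ a → queriesFrom G B k a ≤ fromℕ (suc j)) (sym eq) (+-monoʳ-≤ 1# (halts-queries-≤ h k))

        halts-queries : ∀ {c j c′} → Halts c j c′ → queries G B (suc j) c ≡ fromℕ j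
        halts-queries (done eq)           = cong (queriesFrom G B 0) eq
        halts-queries {j = suc j} (more eq h) = trans (cong (queriesFrom G B (suc j)) eq)
            (cong (1# +_) (halts-queries h))

        halts-returns : ∀ {E : Output → Set} {c j c′} → Halts c j c′ → E (result c′) → Returns G B E (suc j) c 1#
        halts-returns (done eq)   e = within (subst (λ a → ReturnsFrom G B _ _ a 1#) (sym eq) (hit e))
        halts-returns (more eq h) e =
            within (subst (λ a → ReturnsFrom G B _ _ a 1#) (sym eq) (ask (halts-returns h e)))

      record Finished (s t : Fin n) (c : Configuration n) (N : ℕ) : Set where
        constructor finished
        field
          run     : Run s t c N
          optimal : Optimal G (Run.rₐ run) (Run.rₚ run) c

      mutual
        -- `h` and `w` are strict bounds on `height` and `width`, which makes the recursion
        -- structural in the lexicographic order.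
        finish : ∀ h w {s t c N} → Run s t c N → height c ℕ.< h → width c ℕ.< w →
                 ∃ λ j → ∃ λ c′ → Halts c j c′ × Finished s t c′ (j ℕ.+ N)
        finish h w {c = c} = finishFrom h w refl (view c)

        finishFrom : ∀ h w {s t c N a} → advance select {κ} c ≡ a → View c a → Run s t c N → height c ℕ.< h →
            width c ℕ.< w →
                     ∃ λ j → ∃ λ c′ → Halts c j c′ × Finished s t c′ (j ℕ.+ N)
        finishFrom h w eq (exhausted-passive p o) R _ _ =
          0 , _ , done eq , finished R (exhaustedₚ G (Run.invariant R) p o)
        finishFrom h w eq (exhausted-active p o) R _ _ =
          0 , _ , done eq , finished R (exhaustedₐ G (Run.invariant R) p o)
        finishFrom h w eq (stopping p u-open u-min μ≤) R _ _ =
          0 , _ , done eq , finished R (stopping-optimal G (Run.invariant R) p u-open u-min μ≤)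
        finishFrom h (suc w) {N = N} eq (relaxing p) R c<h c<w
          with (R′ , same , less) ← relaxing-run R p
          with (j , c′ , H , F) ← finish h w R′ (subst (ℕ._< h) (sym same) c<h) (ℕ.<-≤-trans less (ℕ.s≤s⁻¹ c<w)) =
          suc j , c′ , more eq H , subst (Finished _ _ c′) (ℕ.+-suc j N) F
        finishFrom (suc h) w {N = N} eq (processing p u-open u-min μ≰) R c<h _
          with (R′ , less) ← processing-run R p u-open u-min μ≰
          -- The degree just learnt may be large, so the bound on the width is chosen afresh.
          with (j , c′ , H , F) ← finish h _ R′ (ℕ.<-≤-trans less (ℕ.s≤s⁻¹ c<h)) (ℕ.n<1+n _) =
          suc j , c′ , more eq H , subst (Finished _ _ c′) (ℕ.+-suc j N) F

-- The outcome of a finished run.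

module Explorations (ℝ : Reals) where
  open Reals ℝ
  open Model ℝ
  open OrderedField ℝ
  open Extended ℝ
  open Links ℝ
  open Trails ℝ
  open Executions ℝ
  open Configurations ℝ
  open Counting
  open Runs ℝ
  open Execution
  open Configuration

  module _ {κ n} (G : Graph κ n) where

    -- All that the lower bound needs of a run, with the executions distinguished as forward and
    -- backward instead of active and passive. `D` will be the final `μ`.
    record Exploration (s t : Fin n) (N : ℕ) (F H : List (Fin n × ℕ)) : Set where
      field
        D        : Carrier ⁺
        D-≤      : ∀ {ks ℓ} → Trail G forward s ks ℓ t → D ≤⁺ [ ℓ ]
        uniqueF  : Unique F
        uniqueH  : Unique H
        slotsF   : ∀ {u i} → (u , i) ∈ F → i ℕ.< degreeAt G forward u
        slotsH   : ∀ {v j} → (v , j) ∈ H → j ℕ.< degreeAt G backward v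
        gap      : ∀ {u i v j} → (u , i) ∈ F → (v , j) ∈ H → ∃ λ ks → ∃ λ a → ∃ λ ls → ∃ λ b →
                   Trail G forward s ks a u × Trail G forward v ls b t × [ a + b ] <⁺ D
        N-≤F     : N ℕ.≤ 4 ℕ.+ 4 ℕ.* length F
        N-≤H     : N ℕ.≤ 4 ℕ.+ 4 ℕ.* length H

    private
      oriented-connects : ∀ {s t δ rₐ rₚ} → Oriented G s t δ rₐ rₚ → ∀ {ks ℓ} → Trail G forward s ks ℓ t →
          Connects G δ rₐ ks ℓ rₚ
      oriented-connects (inj₁ (refl , refl , refl)) T = T
      oriented-connects (inj₂ (refl , refl , refl)) T = T

      assemble : Direction → List ℕ → ℕ → List ℕ → List ℕ
      assemble forward  p k q = p ++ k ∷ q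
      assemble backward p k q = q ++ k ∷ p

      assembled : ∀ {s t δ rₐ rₚ p a u k w v q b} → Oriented G s t δ rₐ rₚ → Connects G δ rₐ p a u → Arc G δ u k w v →
                  Connects G (opposite δ) rₚ q b v → Trail G forward s (assemble δ p k q) (a + (w + b)) t
      assembled (inj₁ (refl , refl , refl)) S e T = S ▹ (e ∷ T)
      assembled {a = a} {w = w} {b = b} (inj₂ (refl , refl , refl)) S e T =
        subst (λ ℓ → Trail G forward _ _ ℓ _) (solve 3 (λ a w b → b :+ (w :+ a) := a :+ (w :+ b)) refl a w b)
            (T ▹ (e ∷ S))

      result-unmet : ∀ (c : Configuration n) → mid c ≡ nothing → result c ≡ nothing
      result-unmet record { turn = forward  ; mid = nothing } refl = refl
      result-unmet record { turn = backward ; mid = nothing } refl = refl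

      result-met : ∀ (c : Configuration n) {u k v} → mid c ≡ just (orient (turn c) u k v) →
                   result c ≡ just (assemble (turn c) (route (active c) u) k (route (passive c) v))
      result-met record { turn = forward  ; mid = just _ } refl = refl
      result-met record { turn = backward ; mid = just _ } refl = refl

    module _ (select : Selection) {s t c N} (F : Finished G select s t c N) where
      open Finished F
      open Run run
      open Invariant invariant

      private
        μ-optimal : ∀ {ks ℓ} → Trail G forward s ks ℓ t → μ c ≤⁺ [ ℓ ]
        μ-optimal T = optimal (oriented-connects oriented T)

        through : ∀ {u k w v a b} → Arc G (turn c) u k w v → dist (active c) u ≡ [ a ] → dist (passive c) v ≡ [ b ] →
                  Trail G forward s (assemble (turn c) (route (active c) u) k (route (passive c) v)) (a + (w + b)) t
        through e a≡ b≡ = assembled oriented (Sound.routed soundₐ _ a≡) e (Sound.routed soundₚ _ b≡)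

        closed-finite : ∀ {δ r x u} → Sound G δ r x → status x u ≡ closed → ∃ λ d → dist x u ≡ [ d ]
        closed-finite sound p = Sound.reached sound _ λ q → case trans (sym p) q of λ ()

        -- `apart` bounds by lengths of existing trails. It is applied to the route through `mid`,
        -- whose length is at most `μ`; without such a route `μ` is infinite.
        closed-apart : ∀ {u v a b} → status (active c) u ≡ closed → status (passive c) v ≡ closed →
                       dist (active c) u ≡ [ a ] → dist (passive c) v ≡ [ b ] → [ a + b ] <⁺ μ c
        closed-apart {a = a} {b} p q a≡ b≡ with meeting
        ... | unmet _ μ≡       = subst ([ a + b ] <⁺_) (sym μ≡) [ a + b ]<⊤⁺
        ... | met _ e d≡ d′≡ ≤μ = <⁺-≤⁺-trans (subst (_<⁺ _) (cong₂ _+⁺_ a≡ b≡)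
          (apart p q (oriented-connects oriented (through e d≡ d′≡)))) ≤μ

        N-≤ : N ℕ.≤ 4 ℕ.+ 4 ℕ.* length Lₐ
        N-≤ = subst (ℕ._≤ _) (sym asked) (asked-≤ {qₐ} {q′ = qₚ} (Tally.budget tallyₐ) (Tally.budget tallyₚ) ahead)

        N-≤′ : N ℕ.≤ 4 ℕ.+ 4 ℕ.* length Lₚ
        N-≤′ = ℕ.≤-trans N-≤ (ℕ.+-monoʳ-≤ 4 (ℕ.*-monoʳ-≤ 4 behind))

      finished-solves : Solves G s t (result c)
      finished-solves with meeting
      ... | unmet m≡ μ≡ = subst (Solves G s t) (sym (result-unmet c m≡))
        (no-trail⇒solves λ T → case subst (_≤⁺ [ _ ]) μ≡ (μ-optimal T) of λ ())
      ... | met m≡ e a≡ b≡ ≤μ = subst (Solves G s t) (sym (result-met c m≡))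
        (minimal⇒solves (through e a≡ b≡) λ T → case ≤⁺-trans ≤μ (μ-optimal T) of λ { [ p ] → p })

      exploration : ∃ λ F → ∃ λ H → Exploration s t N F H
      exploration = split oriented (tallyₐ) (tallyₚ)
        where
        ends : ∀ {u i v j} → (u , i) ∈ Lₐ → (v , j) ∈ Lₚ → ∃ λ a → ∃ λ b →
               Connects G (turn c) rₐ (route (active c) u) a u × Connects G (opposite (turn c)) rₚ
                   (route (passive c) v) b v × [ a + b ] <⁺ μ c
        ends ∈Lₐ ∈Lₚ =
          let p = proj₁ (Tally.slots tallyₐ ∈Lₐ) ; q = proj₁ (Tally.slots tallyₚ ∈Lₚ)
              (a , a≡) = closed-finite soundₐ p ; (b , b≡) = closed-finite soundₚ q
          in a , b , Sound.routed soundₐ _ a≡ , Sound.routed soundₚ _ b≡ , closed-apart p q a≡ b≡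
        gap : ∀ {δ} → turn c ≡ δ → ∀ {u i v j} → (u , i) ∈ Lₐ → (v , j) ∈ Lₚ → ∃ λ ks → ∃ λ a → ∃ λ ls → ∃ λ b →
               Connects G δ rₐ ks a u × Connects G (opposite δ) rₚ ls b v × [ a + b ] <⁺ μ c
        gap refl p q = let (a , b , S , T , <μ) = ends p q in _ , a , _ , b , S , T , <μ
        split : Oriented G s t (turn c) rₐ rₚ → Tally G (turn c) (active c) Lₐ qₐ →
            Tally G (opposite (turn c)) (passive c) Lₚ qₚ →
                ∃ λ F → ∃ λ H → Exploration s t N F H
        split (inj₁ (δ≡ , refl , refl)) tₐ tₚ = Lₐ , Lₚ , record
          { D = μ c
          ; D-≤ = μ-optimal
          ; uniqueF = Tally.unique tₐ
          ; uniqueH = Tally.unique tₚ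
          ; slotsF = λ p → subst (λ δ → _ ℕ.< degreeAt G δ _) δ≡ (proj₁ (proj₂ (Tally.slots tₐ p)))
          ; slotsH = λ p → subst (λ δ → _ ℕ.< degreeAt G (opposite δ) _) δ≡ (proj₁ (proj₂ (Tally.slots tₚ p)))
          ; gap = gap δ≡
          ; N-≤F = N-≤
          ; N-≤H = N-≤′
          }
        split (inj₂ (δ≡ , refl , refl)) tₐ tₚ = Lₚ , Lₐ , record
          { D = μ c
          ; D-≤ = μ-optimal
          ; uniqueF = Tally.unique tₚ
          ; uniqueH = Tally.unique tₐ
          ; slotsF = λ p → subst (λ δ → _ ℕ.< degreeAt G (opposite δ) _) δ≡ (proj₁ (proj₂ (Tally.slots tₚ p)))
          ; slotsH = λ p → subst (λ δ → _ ℕ.< degreeAt G δ _) δ≡ (proj₁ (proj₂ (Tally.slots tₐ p)))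
          ; gap = λ p q → let (ks , a , ls , b , S , T , <μ) = gap δ≡ q p in
              ls , b , ks , a , T , S , subst (λ ℓ → [ ℓ ] <⁺ μ c) (+-comm a b) <μ
          ; N-≤F = N-≤′
          ; N-≤H = N-≤
          }

-- Charging the explored edges to the queries of a correct algorithm.

module LowerBound (ℝ : Reals) where
  open Reals ℝ
  open Model ℝ
  open OrderedField ℝ
  open Suprema ℝ
  open Expectation ℝ
  open Links ℝ
  open Rewiring ℝ
  open Trails ℝ
  open Crossings ℝ
  open Explorations ℝ

  private
    indicator : ∀ {P : Set} → Dec P → ℕ
    indicator (yes _) = 1
    indicator (no _)  = 0

    match : Maybe ℕ → ℕ → ℕ
    match nothing  k = 0
    match (just z) k = indicator (z ℕ.≟ k)

    match-refl : ∀ k → match (just k) k ≡ 1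
    match-refl k with k ℕ.≟ k
    ... | yes _  = refl
    ... | no k≢k = contradiction refl k≢k

    occurrences : Maybe ℕ → List ℕ → ℕ
    occurrences z ks = sum (map (match z) ks)

    occurrences-filter : ∀ {A : Set} z (f : A → ℕ) xs → occurrences (just z) (map f xs) ≡ length
        (filter (λ x → z ℕ.≟ f x) xs)
    occurrences-filter z f []       = refl
    occurrences-filter z f (x ∷ xs) with z ℕ.≟ f x
    ... | yes z≡ = trans (cong suc (occurrences-filter z f xs))
        (cong length (sym (filter-accept (λ x → z ℕ.≟ f x) z≡)))
    ... | no z≢  = trans (occurrences-filter z f xs) (cong length (sym (filter-reject (λ x → z ℕ.≟ f x) z≢)))

    pigeonhole : ∀ {A : Set} (f : A → Bool) {xs} → (∀ {x y} → x ∈ xs → y ∈ xs → f x ≡ f y → x ≡ y) → Unique xs →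
        length xs ℕ.≤ 2
    pigeonhole f {[]}        inj ! = z≤n
    pigeonhole f {_ ∷ []}    inj ! = s≤s z≤n
    pigeonhole f {_ ∷ _ ∷ []} inj ! = s≤s (s≤s z≤n)
    pigeonhole f {x ∷ y ∷ z ∷ _} inj ((x≢y ∷ x≢z ∷ _) ∷ (y≢z ∷ _) ∷ _) with f x Bool.≟ f y | f x Bool.≟ f z | f y
        Bool.≟ f z
    ... | yes p | _     | _     = contradiction (inj (here refl) (there (here refl)) p) x≢y
    ... | no _  | yes p | _     = contradiction (inj (here refl) (there (there (here refl))) p) x≢z
    ... | no _  | no _  | yes p = contradiction (inj (there (here refl)) (there (there (here refl))) p) y≢z
    ... | no p  | no q  | no r  = contradiction (trans (Bool.¬-not q) (sym (Bool.¬-not r))) p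

    ∑-mono-≤ : ∀ {A : Set} {f g : A → Carrier} xs → (∀ {x} → x ∈ xs → f x ≤ g x) → ∑ (map f xs) ≤ ∑ (map g xs)
    ∑-mono-≤ []       f≤g = ≤-refl
    ∑-mono-≤ (x ∷ xs) f≤g = +-mono-≤ (f≤g (here refl)) (∑-mono-≤ xs (f≤g ∘ there))

    ∑-const : ∀ {A : Set} k (xs : List A) → ∑ (map (λ _ → fromℕ k) xs) ≡ fromℕ (k ℕ.* length xs)
    ∑-const k []       = cong fromℕ (sym (ℕ.*-zeroʳ k))
    ∑-const k (x ∷ xs) = trans (cong (fromℕ k +_) (∑-const k xs))
        (trans (sym (fromℕ-+ k _)) (cong fromℕ (sym (ℕ.*-suc k (length xs)))))

    ∑-+ : ∀ {A : Set} (f g : A → Carrier) xs → ∑ (map (λ x → f x + g x) xs) ≡ ∑ (map f xs) + ∑ (map g xs)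
    ∑-+ f g []       = sym (+-identityˡ 0#)
    ∑-+ f g (x ∷ xs) = trans (cong ((f x + g x) +_) (∑-+ f g xs))
      (solve 4 (λ a b x y → (a :+ b) :+ (x :+ y) := (a :+ x) :+ (b :+ y)) refl (f x) (g x) _ _)

    ∑-* : ∀ {A : Set} z (f : A → Carrier) xs → ∑ (map (λ x → z * f x) xs) ≡ z * ∑ (map f xs)
    ∑-* z f []       = sym (zeroʳ z)
    ∑-* z f (x ∷ xs) = trans (cong (z * f x +_) (∑-* z f xs)) (sym (distribˡ z (f x) _))

    ∑-fromℕ : ∀ {A : Set} (f : A → ℕ) xs → ∑ (map (fromℕ ∘ f) xs) ≡ fromℕ (sum (map f xs))
    ∑-fromℕ f []       = refl
    ∑-fromℕ f (x ∷ xs) = trans (cong (fromℕ (f x) +_) (∑-fromℕ f xs)) (sym (fromℕ-+ (f x) _))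

  module _ {κ n} (G : Graph κ n) where

    -- The default 0 does not arise at explored slots, whose positions are in range.
    named : Direction → Fin n × ℕ → ℕ
    named δ (u , j) = Maybe.maybe′ proj₁ 0 (slot G δ u j)

    -- Slots of `L` with the same name are told apart by their marks. Consequently one query is
    -- charged at most twice when prices are summed over `L`.
    occurrences-≤ : ∀ δ {L} → Unique L → (∀ {u j} → (u , j) ∈ L → j ℕ.< degreeAt G δ u) →
                    ∀ z → occurrences z (map (named δ) L) ℕ.≤ 2
    occurrences-≤ δ {L} ! slots nothing  = ℕ.≤-trans (ℕ.≤-reflexive (none (map (named δ) L))) z≤n
      where
      none : ∀ ks → occurrences nothing ks ≡ 0
      none []       = refl
      none (_ ∷ ks) = none ks
    occurrences-≤ δ {L} ! slots (just z) = ℕ.≤-trans (ℕ.≤-reflexive (occurrences-filter z (named δ) L))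
      (pigeonhole (λ (u , j) → mark G u j) injective (Unique.filter⁺ (λ x → z ℕ.≟ named δ x) !))
      where
      answered : ∀ {u j} → (u , j) ∈ filter (λ x → z ℕ.≟ named δ x) L → ∃ λ w → ∃ λ v →
          slot G δ u j ≡ just (z , w , v)
      answered {u} {j} ∈L with (∈L′ , z≡) ← ∈-filter⁻ (λ x → z ℕ.≟ named δ x) {xs = L} ∈L
                          with ((k , w , v) , eq) ← slot-< G δ u (slots ∈L′) =
        w , v , trans eq (cong (λ k → just (k , w , v)) (sym (trans z≡ (cong (Maybe.maybe′ proj₁ 0) eq))))
      injective : ∀ {x y} → x ∈ filter (λ x → z ℕ.≟ named δ x) L → y ∈ filter (λ x → z ℕ.≟ named δ x) L →
                  mark G (proj₁ x) (proj₂ x) ≡ mark G (proj₁ y) (proj₂ y) → x ≡ y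
      injective ∈x ∈y same = slot-injective G δ (proj₂ (proj₂ (answered ∈x))) (proj₂ (proj₂ (answered ∈y))) same

    named-arc : ∀ δ {u j} → j ℕ.< degreeAt G δ u → ∃ λ w → ∃ λ v → Arc G δ u (named δ (u , j)) w v
    named-arc δ {u} {j} j<d with ((k , w , v) , eq) ← slot-< G δ u j<d =
      w , v , slot⇒arc G δ u (trans eq (cong (λ k → just (k , w , v)) (sym (cong (Maybe.maybe′ proj₁ 0) eq))))

    crossings : ∀ {s t N F H} → Exploration G s t N F H → ∀ {e f} → e ∈ map (named forward) F →
        f ∈ map (named backward) H → e ≢ f →
                Crossing G s t e f
    crossings E e∈ f∈ e≢f
      with (_ , x∈ , refl) ← ∈-map⁻ (named forward) e∈ | (_ , y∈ , refl) ← ∈-map⁻ (named backward) f∈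
      with (_ , _ , Lₑ) ← named-arc forward (Exploration.slotsF E x∈) | (_ , _ , L_f) ← named-arc backward
          (Exploration.slotsH E y∈)
      with (_ , _ , _ , _ , S , T , <D) ← Exploration.gap E x∈ y∈ =
      crossing Lₑ L_f e≢f S T (Exploration.D E) <D (Exploration.D-≤ E)

    -- Its expected total is at least the probability that `k` is revealed.
    price : ℕ → Price κ n
    price k q = fromℕ (match (revealed G q) k)

    module _ {A : Algorithm κ} (correct : Correct A) {s t : Fin n} (s≢t : s ≢ t) {T : Carrier} (expected : ExpectedQueries G (A n s t) T) where
      private
        M : Machine κ n
        M = A n s t
        open Machine M using (start)

        queries-≤ : ∀ k → queries G M k start ≤ T
        queries-≤ k = proj₁ expected _ (k , refl)

        const-≤ : ∀ z → 0# ≤ z → ∀ k → cost G M (λ _ → z) k start ≤ z * T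
        const-≤ z 0≤z k = subst (_≤ z * T) (sym (cost-const G M z k start)) (*-monoˡ-≤ 0≤z (queries-≤ k))

        -- 2 · 0.9 - 1 = 0.8.
        separation : ∀ (G₁ G₂ : Graph κ n) → (∀ o → Solves G₁ s t o → ¬ Solves G₂ s t o) →
                     (c : Price κ n) → (∀ {f} (q : Query κ n f) → 0# ≤ c q) →
                     (∀ {f} (q : Query κ n f) → (answer G₁ q ≡ answer G q × answer G₂ q ≡ answer G q) ⊎ 1# ≤ c q) →
                     ∀ {B} → (∀ k → cost G M c k start ≤ B) → fromℕ 8 ≤ fromℕ 10 * B
        separation G₁ G₂ disjoint c 0≤c paid {B} cost≤
          with (P₁ , prob₁ , 9≤₁) ← correct n G₁ s t s≢t | (P₂ , prob₂ , 9≤₂) ← correct n G₂ s t s≢t =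
          +-cancelˡ-≤ (fromℕ 10) (begin
            fromℕ 10 + fromℕ 8               ≡⟨ solve 0 (numeral 10 :+ numeral 8 := numeral 9 :+ numeral 9) refl ⟩
            fromℕ 9 + fromℕ 9                ≤⟨ +-mono-≤ 9≤₁ 9≤₂ ⟩
            fromℕ 10 * P₁ + fromℕ 10 * P₂    ≡⟨ distribˡ (fromℕ 10) P₁ P₂ ⟨
            fromℕ 10 * (P₁ + P₂)             ≤⟨ *-monoˡ-≤ (fromℕ-nonneg 10) (Distinguishing.probability-≤1+cost G G₁ G₂ M disjoint c 0≤c paid prob₁ prob₂ cost≤) ⟩
            fromℕ 10 * (1# + B)              ≡⟨ trans (distribˡ (fromℕ 10) 1# B) (cong (_+ fromℕ 10 * B) (*-identityʳ (fromℕ 10))) ⟩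
            fromℕ 10 + fromℕ 10 * B          ∎)

        price-nonneg : ∀ k {f} (q : Query κ n f) → 0# ≤ price k q
        price-nonneg k q = fromℕ-nonneg (match (revealed G q) k)

        price-hit : ∀ k {f} (q : Query κ n f) → revealed G q ≡ just k → 1# ≤ price k q
        price-hit k q eq =
            ≤-reflexive (trans (sym (+-identityʳ 1#))
            (sym (cong fromℕ (trans (cong (λ m → match m k) eq) (match-refl k)))))

        price-≤1 : ∀ k {f} (q : Query κ n f) → price k q ≤ 1#
        price-≤1 k q = subst (price k q ≤_) (+-identityʳ 1#) (fromℕ-mono (match-≤1 (revealed G q)))
          where
          match-≤1 : ∀ m → match m k ℕ.≤ 1
          match-≤1 nothing  = z≤n
          match-≤1 (just z) with z ℕ.≟ k
          ... | yes _ = s≤s z≤n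
          ... | no _  = z≤n

        expectation : ∀ k → ∃ (Limit (λ j → cost G M (price k) j start))
        expectation k = complete _ (_ , 0 , refl) (1# * T , λ { _ (j , refl) →
          ≤-trans (cost-mono-≤ G M (price-≤1 k) j start) (const-≤ 1# 0≤1 j) })

        -- The expected number of queries of `M` on `G` that reveal `k`; it exists by completeness,
        -- being bounded by the number of all queries.
        m : ℕ → Carrier
        m k = proj₁ (expectation k)

        m-upper : ∀ k j → cost G M (price k) j start ≤ m k
        m-upper k j = proj₁ (proj₂ (expectation k)) _ (j , refl)

        m-nonneg : ∀ k → 0# ≤ m k
        m-nonneg k = m-upper k 0

        -- Summing over the edges before taking expectations, each query is charged at most 2.
        m-sum : ∀ ks → (∀ z → occurrences z ks ℕ.≤ 2) → ∑ (map m ks) ≤ fromℕ 2 * T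
        m-sum ks few = ∑-limits (λ k → cost-increasing G M (price-nonneg k) start) (λ k → proj₂ (expectation k)) ks
            λ j → begin
          ∑ (map (λ k → cost G M (price k) j start) ks)         ≡⟨ ∑-cost G M price ks j start ⟩
          cost G M (λ q → ∑ (map (λ k → price k q) ks)) j start ≤⟨ cost-mono-≤ G M (λ q →
              subst (_≤ fromℕ 2) (sym (∑-fromℕ (match (revealed G q)) ks))
                                                                      (fromℕ-mono (few (revealed G q)))) j start ⟩
          cost G M (λ _ → fromℕ 2) j start                      ≤⟨ const-≤ (fromℕ 2) (fromℕ-nonneg 2) j ⟩
          fromℕ 2 * T                                           ∎

        pair : ∀ {e f} → Crossing G s t e f → fromℕ 8 ≤ fromℕ 10 * (m e + m f)
        pair {e} {f} C = separation G₁ G₂ disjoint (λ q → price e q + price f q)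
          (λ q → +-nonneg (price-nonneg e q) (price-nonneg f q))
          (λ q → Sum.map₂ (λ { (inj₁ eq) → ≤-trans (price-hit e q eq) (x≤x+y _ (price-nonneg f q))
                             ; (inj₂ eq) → ≤-trans (price-hit f q eq) (x≤y+x _ (price-nonneg e q)) }) (agree q))
          (λ k → subst (_≤ m e + m f) (sym (cost-+ G M (price e) (price f) k start))
              (+-mono-≤ (m-upper e k) (m-upper f k)))
          where open Crossing C

        -- If every query is charged, any two inputs without a common solution can be compared,
        -- whatever `G` is. So even a run with nothing explored costs 0.8 queries, which absorbs the
        -- additive constants.
        base : fromℕ 8 ≤ fromℕ 10 * T
        base = separation G₁ G₂ disjoint (λ _ → 1#) (λ _ → 0≤1) (λ _ → inj₂ ≤-refl)
                 (λ k → subst (cost G M (λ _ → 1#) k start ≤_) (*-identityˡ T) (const-≤ 1# 0≤1 k))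
          where
          stuck : ∀ {u ks ℓ v} → Trail (loops κ n) forward u ks ℓ v → u ≡ v
          stuck []      = refl
          stuck (a ∷ T) = trans (loops-link κ a) (stuck T)
          open Crossing (crossing {G = loops κ n} {s} {t} (loop κ s) (loop κ t) (s≢t ∘ toℕ-injective) [] [] ⊤⁺ [ 0# + 0# ]<⊤⁺
                           λ T → contradiction (stuck T) s≢t)

        tenfold : ∀ ks → (∀ z → occurrences z ks ℕ.≤ 2) → ∑ (map (λ k → fromℕ 10 * m k) ks) ≤ fromℕ 20 * T
        tenfold ks few = begin
          ∑ (map (λ k → fromℕ 10 * m k) ks) ≡⟨ ∑-* (fromℕ 10) m ks ⟩
          fromℕ 10 * ∑ (map m ks)           ≤⟨ *-monoˡ-≤ (fromℕ-nonneg 10) (m-sum ks few) ⟩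
          fromℕ 10 * (fromℕ 2 * T)          ≡⟨ solve 1 (λ T → numeral 10 :* (numeral 2 :* T) := numeral 20 :* T) refl T ⟩
          fromℕ 20 * T                      ∎

      module _ {es fs : List ℕ} (few-es : ∀ z → occurrences z es ℕ.≤ 2) (few-fs : ∀ z → occurrences z fs ℕ.≤ 2)
               (cross : ∀ {e f} → e ∈ es → f ∈ fs → e ≢ f → Crossing G s t e f) where

        private
          all-heavy : (∀ {e} → e ∈ es → fromℕ 4 ≤ fromℕ 10 * m e) → fromℕ (4 ℕ.* length es) ≤ fromℕ 20 * T + fromℕ 8
          all-heavy heavy = ≤-trans (subst (_≤ ∑ (map (λ k → fromℕ 10 * m k) es)) (∑-const 4 es) (∑-mono-≤ es heavy))
            (≤-trans (tenfold es few-es) (x≤x+y _ (fromℕ-nonneg 8)))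

          -- Of the 8 given by `pair`, at least 4 are left to every `f` crossed with `e`. Only
          -- `f ≡ e` cannot be crossed; it occurs at most twice in `fs`, and granting it 4 each time
          -- costs the final 8.
          one-light : ∀ {e} → e ∈ es → ¬ fromℕ 4 ≤ fromℕ 10 * m e → fromℕ (4 ℕ.* length fs) ≤ fromℕ 20 * T + fromℕ 8
          one-light {e} e∈ light = begin
            fromℕ (4 ℕ.* length fs)                                      ≡⟨ ∑-const 4 fs ⟨
            ∑ (map (λ _ → fromℕ 4) fs)                                   ≤⟨ ∑-mono-≤ fs heavy ⟩
            ∑ (map (λ f → fromℕ 10 * m f + fromℕ 4 * fromℕ (match (just e) f)) fs)
              ≡⟨ ∑-+ (λ f → fromℕ 10 * m f) (λ f → fromℕ 4 * fromℕ (match (just e) f)) fs ⟩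
            ∑ (map (λ f → fromℕ 10 * m f) fs) + ∑ (map (λ f → fromℕ 4 * fromℕ (match (just e) f)) fs)
              ≡⟨ cong (∑ (map (λ f → fromℕ 10 * m f) fs) +_) (trans (∑-* (fromℕ 4) (fromℕ ∘ match (just e)) fs)
                   (cong (fromℕ 4 *_) (∑-fromℕ (match (just e)) fs))) ⟩
            ∑ (map (λ f → fromℕ 10 * m f) fs) + fromℕ 4 * fromℕ (occurrences (just e) fs)
              ≤⟨ +-mono-≤ (tenfold fs few-fs) (*-monoˡ-≤ (fromℕ-nonneg 4) (fromℕ-mono (few-fs (just e)))) ⟩
            fromℕ 20 * T + fromℕ 4 * fromℕ 2                             ≡⟨ cong (fromℕ 20 * T +_) (sym (fromℕ-* 4 2)) ⟩
            fromℕ 20 * T + fromℕ 8                                       ∎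
            where
            heavy : ∀ {f} → f ∈ fs → fromℕ 4 ≤ fromℕ 10 * m f + fromℕ 4 * fromℕ (match (just e) f)
            heavy {f} f∈ with e ℕ.≟ f
            ... | yes _  = ≤-trans (≤-reflexive (solve 0 (numeral 4 := numeral 4 :* numeral 1) refl))
                             (x≤y+x (fromℕ 4 * fromℕ 1) (*-nonneg (fromℕ-nonneg 10) (m-nonneg f)))
            ... | no e≢f = ≤-trans (+-cancelˡ-≤ (fromℕ 4) (begin
                fromℕ 4 + fromℕ 4                 ≡⟨ fromℕ-+ 4 4 ⟨
                fromℕ 8                           ≤⟨ pair (cross e∈ f∈ e≢f) ⟩
                fromℕ 10 * (m e + m f)            ≡⟨ distribˡ (fromℕ 10) (m e) (m f) ⟩
                fromℕ 10 * m e + fromℕ 10 * m f   ≤⟨ +-monoˡ-≤ (fromℕ 10 * m f) (<⇒≤ (≰⇒> light)) ⟩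
                fromℕ 4 + fromℕ 10 * m f          ∎))
                    (x≤x+y (fromℕ 10 * m f) (*-nonneg (fromℕ-nonneg 4) (fromℕ-nonneg 0)))

        -- The threshold 4 is half of the 8 in `pair`, which makes the bounds of the two cases
        -- equal.
        one-side-≤ : fromℕ (4 ℕ.* length es) ≤ fromℕ 20 * T + fromℕ 8 ⊎ fromℕ (4 ℕ.* length fs) ≤ fromℕ
            20 * T + fromℕ 8
        one-side-≤ with all? (λ e → fromℕ 4 ≤? fromℕ 10 * m e) es
        ... | yes heavy = inj₁ (all-heavy (All.lookup heavy))
        ... | no ¬heavy with (e , e∈ , light) ← find (¬All⇒Any¬ (λ e → fromℕ 4 ≤? fromℕ 10 * m e) es ¬heavy) =
            inj₂ (one-light e∈ light)

      explored-≤ : ∀ {N F H} → Exploration G s t N F H → fromℕ N ≤ fromℕ 40 * T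
      explored-≤ {N} {F} {H} E = conclude (one-side-≤ (occurrences-≤ forward uniqueF slotsF)
          (occurrences-≤ backward uniqueH slotsH) (crossings E))
        where
        open Exploration E
        bound : ∀ {l} → N ℕ.≤ 4 ℕ.+ 4 ℕ.* l → fromℕ (4 ℕ.* l) ≤ fromℕ 20 * T + fromℕ 8 → fromℕ N ≤ fromℕ 40 * T
        bound {l} N≤ p = begin
          fromℕ N                               ≤⟨ fromℕ-mono N≤ ⟩
          fromℕ (4 ℕ.+ 4 ℕ.* l)                 ≡⟨ fromℕ-+ 4 (4 ℕ.* l) ⟩
          fromℕ 4 + fromℕ (4 ℕ.* l)             ≤⟨ +-monoʳ-≤ (fromℕ 4) p ⟩
          fromℕ 4 + (fromℕ 20 * T + fromℕ 8)    ≡⟨ solve 1 (λ x → numeral 4 :+ (x :+ numeral 8) := numeral 12 :+ x) refl (fromℕ 20 * T) ⟩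
          -- Rounding 12 up to 16 lets two copies of `base` absorb it, whence 40 = 10 + 10 + 20.
          fromℕ 12 + fromℕ 20 * T               ≤⟨ +-monoˡ-≤ (fromℕ 20 * T) (fromℕ-mono (ℕ.m≤m+n 12 4)) ⟩
          fromℕ 16 + fromℕ 20 * T               ≡⟨ cong (_+ fromℕ 20 * T) (fromℕ-+ 8 8) ⟩
          (fromℕ 8 + fromℕ 8) + fromℕ 20 * T    ≤⟨ +-monoˡ-≤ (fromℕ 20 * T) (+-mono-≤ base base) ⟩
          (fromℕ 10 * T + fromℕ 10 * T) + fromℕ 20 * T
            ≡⟨ solve 1 (λ T → (numeral 10 :* T :+ numeral 10 :* T) :+ numeral 20 :* T := numeral 40 :* T) refl T ⟩
          fromℕ 40 * T                          ∎
        conclude : fromℕ (4 ℕ.* length (map (named forward) F)) ≤ fromℕ 20 * T + fromℕ 8 ⊎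
                   fromℕ (4 ℕ.* length (map (named backward) H)) ≤ fromℕ 20 * T + fromℕ 8 → fromℕ N ≤ fromℕ 40 * T
        conclude (inj₁ p) = bound {length F} N-≤F (subst (λ l → fromℕ (4 ℕ.* l) ≤ fromℕ 20 * T + fromℕ 8)
            (length-map (named forward) F) p)
        conclude (inj₂ p) = bound {length H} N-≤H (subst (λ l → fromℕ (4 ℕ.* l) ≤ fromℕ 20 * T + fromℕ 8)
            (length-map (named backward) H) p)

-- Correctness and instance optimality.

module InstanceOptimality (ℝ : Reals) where
  open Reals ℝ
  open Model ℝ
  open OrderedField ℝ
  open Expectation ℝ
  open Runs ℝ
  open Explorations ℝ
  open LowerBound ℝ

  module _ (select : Selection) {κ n} (G : Graph κ n) {s t : Fin n} (s≢t : s ≢ t) where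

    private
      terminates : ∃ λ N → ∃ λ c → Halts G select (initial s t) N c × Finished G select s t c N
      terminates with (N , c , H , F) ← finish G select _ _ (initial-run G s≢t) (ℕ.n<1+n _) (ℕ.n<1+n _) =
        N , c , H , subst (Finished G select s t c) (ℕ.+-identityʳ N) F

    dijkstra-correct : ∃ λ P → Probability G (bidirectionalDijkstra select n s t) (Solves G s t) P × fromℕ 9 ≤ fromℕ
        10 * P
    dijkstra-correct with (N , c , H , F) ← terminates =
      -- The run is deterministic and its output correct, so the probability is 1; it is attained
      -- with one step more than queries, namely the return.
      1# , ((λ _ (_ , ρ) → returns-≤1 G (bidirectionalDijkstra select n s t) ρ) ,
            (λ v bound → bound 1# (suc N , halts-returns G select H (finished-solves G select F)))) ,
      subst (fromℕ 9 ≤_) (sym (*-identityʳ (fromℕ 10))) (fromℕ-mono (ℕ.n≤1+n 9))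

    dijkstra-optimal : ∃ λ T → ExpectedQueries G (bidirectionalDijkstra select n s t) T ×
      ((A : Algorithm κ) → Correct A → ∀ T′ → ExpectedQueries G (A n s t) T′ → T ≤ fromℕ 40 * T′)
    dijkstra-optimal with (N , c , H , F) ← terminates =
      fromℕ N ,
      ((λ { _ (k , refl) → halts-queries-≤ G select H k }) ,
       (λ v bound → subst (_≤ v) (halts-queries G select H) (bound _ (suc N , refl)))) ,
      λ A correct T′ expected → explored-≤ G correct s≢t expected (proj₂ (proj₂ (exploration G select F)))

theorem3 : (ℝ : Reals) → let open Reals ℝ in let open Model ℝ in
    (κ : Kind) →
    ((select : Selection) → Correct {κ} (bidirectionalDijkstra select))
    × (∃ λ (c : Carrier) →
    (select : Selection) →
    ∀ n (G : Graph κ n) (s t : Fin n) → s ≢ t →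
    ∃ λ T → ExpectedQueries G (bidirectionalDijkstra select n s t) T
    × ((A : Algorithm κ) → Correct A →
    ∀ T′ → ExpectedQueries G (A n s t) T′ → T ≤ c * T′))
theorem3 ℝ κ =
  (λ select n G s t s≢t → dijkstra-correct select G s≢t) ,
  (fromℕ 40 , λ select n G s t s≢t → dijkstra-optimal select G s≢t)
  where
  open Reals ℝ using (fromℕ)
  open InstanceOptimality ℝ
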